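{- Let $\mathfrak A\in K_{\overline\alpha}$ with $\delta(\mathfrak A)>0$. (1) If $\overline\alpha$ is not rational, then for every $\epsilon>0$ there are infinitely many pairwise non-isomorphic $\mathfrak D\in K_{\overline\alpha}$ such that $(\mathfrak A,\mathfrak D)$ is an essential minimal pair with $-\epsilon<\delta(\mathfrak D/\mathfrak A)<0$. (2) If $\overline\alpha$ is rational, then there are infinitely many pairwise non-isomorphic $\mathfrak D\in K_{\overline\alpha}$ such that $(\mathfrak A,\mathfrak D)$ is an essential minimal pair with $\delta(\mathfrak D/\mathfrak A)=-1/c$.
   Context: Fix a finite relational language $L$ in which every relation symbol has arity at least $2$. $K_L$ is the class of all finite $L$-structures (including the empty one) in which every relation symbol is interpreted symmetrically and irreflexively. Fix $\overline\alpha:L\to(0,1]$, writing $\overline\alpha_E=\overline\alpha(E)$, such that it is not the case that all symbols of $L$ are binary and $\overline\alpha_E=1$ for all $E$. For $\mathfrak A\in K_L$ let $N_E(\mathfrak A)$ be the number of subsets of $A$ on which $E$ holds and $\delta(\mathfrak A)=|A|-\sum_{E}\overline\alpha_E N_E(\mathfrak A)$. $K_{\overline\alpha}=\{\mathfrak A\in K_L:\delta(\mathfrak A')\ge0\text{ for all substructures }\mathfrak A'\subseteq\mathfrak A\}$. Subsets are identified with induced substructures; for $\mathfrak A\subseteq \mathfrak D$, $\delta(\mathfrak D/\mathfrak A)=\delta(\mathfrak D)-\delta(\mathfrak A)$, and for substructures $X,Y$ of a structure, $\delta(X/Y)=\delta(X\cup Y)-\delta(Y)$. For $\mathfrak A\subseteq\mathfrak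 B$, $\mathfrak A\le\mathfrak B$ means $\delta(\mathfrak A)\le\delta(\mathfrak A')$ for all $\mathfrak A\subseteq\mathfrak A'\subseteq\mathfrak B$; $(\mathfrak A,\mathfrak B)$ is a minimal pair if $\mathfrak A\subseteq\mathfrak B$, $\mathfrak A\le\mathfrak C$ for all $\mathfrak A\subseteq\mathfrak C\subsetneq\mathfrak B$, but $\mathfrak A\not\le\mathfrak B$. For $\mathfrak B\in K_{\overline\alpha}$ with $\delta(\mathfrak B)>0$, a structure $\mathfrak D\in K_{\overline\alpha}$ with $\mathfrak B\subseteq\mathfrak D$ forms an essential minimal pair $(\mathfrak B,\mathfrak D)$ if $(\mathfrak B,\mathfrak D)$ is a minimal pair and $\delta(\mathfrak D'/\mathfrak D'\cap\mathfrak B)\ge0$ for every substructure $\mathfrak D'\subsetneq\mathfrak D$. $\overline\alpha$ is rational if each $\overline\alpha_E$ is rational; in that case write $\overline\alpha_E=p_E/q_E$ in lowest terms and $c=\mathrm{lcm}\{q_E:E\in L\}$. -}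

module Defs where

open import Level as Level using (0ℓ)
open import Algebra.Bundles using (CommutativeRing)
open import Data.Bool.Base using (Bool; true)
import Data.Bool.Properties as Bool
open import Data.Fin.Base using (Fin)
open import Data.Fin.Permutation using (Permutation′; _⟨$⟩ʳ_)
open import Data.Fin.Properties using (any?)
open import Data.Fin.Subset using (Subset; inside; outside; _⊆_; _⊂_; _∩_; _∪_; ⋃; ⁅_⁆; ⊤; ∣_∣)
open import Data.Fin.Subset.Properties using (_⊆?_)
open import Data.Integer.Base using (ℤ; +_; -[1+_])
open import Data.List.Base as List using ()
open import Data.Nat.Base as ℕ using (ℕ; zero; suc)
open import Data.Nat.LCM using (lcm)
open import Data.Product using (Σ; Σ-syntax; ∃; _×_; _,_; proj₁)
open import Data.Rational.Base using (ℚ; ↥_; ↧ₙ_)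
open import Data.Vec.Base as Vec using (Vec; []; _∷_; map; tabulate; lookup; toList)
open import Data.Vec.Properties using (≡-dec)
import Data.Vec.Functional as Vector
open import Data.Vec.Relation.Unary.Unique.Propositional using (Unique)
open import Function.Definitions using (Injective; Bijective)
open import Relation.Binary.PropositionalEquality using (_≡_; _≢_)
open import Relation.Binary.Core using (Rel)
open import Relation.Binary.Structures using (IsTotalOrder)
open import Relation.Nullary using (¬_; Dec; yes; no)
open import Relation.Nullary.Decidable using (_×-dec_; map′)
open import Relation.Unary using (Pred; Decidable)
import Relation.Binary.Construct.NonStrictToStrict as NonStrictToStrict
import Algebra.Definitions.RawMonoid as RawMonoidDefinitions

-- The real numbers, given by their usual axioms: a Dedekind-complete totally
-- ordered field, which is unique up to isomorphism.
record CompleteOrderedField : Set (Level.suc 0ℓ) where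
  infix 4 _≤_
  infix 9 _⁻¹
  field
    commutativeRing : CommutativeRing 0ℓ 0ℓ
  open CommutativeRing commutativeRing public
  field
    _≤_          : Rel Carrier 0ℓ
    isTotalOrder : IsTotalOrder _≈_ _≤_
    0≉1          : ¬ 0# ≈ 1#
    -- Total for convenience; the value of 0# ⁻¹ is unspecified.
    _⁻¹          : Carrier → Carrier
    *-inverseʳ   : ∀ x → ¬ x ≈ 0# → x * x ⁻¹ ≈ 1#
    +-monoˡ-≤    : ∀ z {x y} → x ≤ y → x + z ≤ y + z
    *-nonNeg     : ∀ {x y} → 0# ≤ x → 0# ≤ y → 0# ≤ x * y
    supremum     : (P : Pred Carrier 0ℓ) → ∃ P →
                   (∃ λ b → ∀ x → P x → x ≤ b) →
                   ∃ λ s → (∀ x → P x → x ≤ s) ×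
                           (∀ b → (∀ x → P x → x ≤ b) → s ≤ b)

  open NonStrictToStrict _≈_ _≤_ public using (_<_)
  open RawMonoidDefinitions +-rawMonoid public using (sum) renaming (_×_ to _·_)

  fromℕ : ℕ → Carrier
  fromℕ n = n · 1#

  fromℤ : ℤ → Carrier
  fromℤ (+ n)    = fromℕ n
  fromℤ -[1+ n ] = - fromℕ (suc n)

  fromℚ : ℚ → Carrier
  fromℚ q = fromℤ (↥ q) * fromℕ (↧ₙ q) ⁻¹

record Language : Set where
  field
    size    : ℕ
    arity   : Fin size → ℕ
    2≤arity : ∀ E → 2 ℕ.≤ arity E

  Symbol : Set
  Symbol = Fin size

∃Vec? : ∀ {n} k {P : Pred (Vec (Fin n) k) 0ℓ} → Decidable P → Dec (∃ P)
∃Vec? zero    P? = map′ ([] ,_) (λ { ([] , p) → p }) (P? [])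
∃Vec? (suc k) P? =
  map′ (λ { (i , t , p) → i ∷ t , p }) (λ { (i ∷ t , p) → i , t , p })
       (any? λ i → ∃Vec? k λ t → P? (i ∷ t))

-- The number of subsets of Fin n satisfying a decidable predicate.
#Subsets : ∀ {n} {P : Pred (Subset n) 0ℓ} → Decidable P → ℕ
#Subsets {zero} P? with P? []
... | yes _ = 1
... | no  _ = 0
#Subsets {suc n} P? =
  #Subsets (λ X → P? (inside ∷ X)) ℕ.+ #Subsets (λ X → P? (outside ∷ X))

-- The set {t₁ , … , tₖ} of entries of a tuple.
entries : ∀ {n k} → Vec (Fin n) k → Subset n
entries t = ⋃ (List.map ⁅_⁆ (toList t))

module Structures (L : Language) where
  open Language L

  -- A member of K_L; every finite structure is isomorphic to one on some Fin n.
  record Structure : Set where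
    field
      card        : ℕ
      rel         : (E : Symbol) → Vec (Fin card) (arity E) → Bool
      symmetric   : ∀ E (π : Permutation′ (arity E)) t →
                    rel E (tabulate λ i → lookup t (π ⟨$⟩ʳ i)) ≡ rel E t
      irreflexive : ∀ E t → rel E t ≡ true → Unique t

    Universe : Set
    Universe = Fin card

    -- By symmetry the choice of the tuple listing X is immaterial.
    HoldsOn : Symbol → Pred (Subset card) 0ℓ
    HoldsOn E X = ∃ λ t → entries t ≡ X × rel E t ≡ true

    holdsOn? : ∀ E → Decidable (HoldsOn E)
    holdsOn? E X = ∃Vec? (arity E) λ t →
      ≡-dec Bool._≟_ (entries t) X ×-dec (rel E t Bool.≟ true)

    N : Symbol → Subset card → ℕ
    N E S = #Subsets λ X → (X ⊆? S) ×-dec holdsOn? E X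

  open Structure

  record Embedding (𝔄 𝔅 : Structure) : Set where
    field
      to        : Universe 𝔄 → Universe 𝔅
      injective : Injective _≡_ _≡_ to
      rel-to    : ∀ E t → rel 𝔅 E (map to t) ≡ rel 𝔄 E t

    image : Subset (card 𝔅)
    image = entries (tabulate to)

  _≅_ : Rel Structure 0ℓ
  𝔄 ≅ 𝔅 = Σ[ f ∈ (Universe 𝔄 → Universe 𝔅) ]
    Bijective _≡_ _≡_ f × (∀ E t → rel 𝔅 E (map f t) ≡ rel 𝔄 E t)

  InfinitelyManyNonIsomorphic : Pred Structure 0ℓ → Set
  InfinitelyManyNonIsomorphic P = Σ[ 𝔇 ∈ (ℕ → Structure) ]
    (∀ i → P (𝔇 i)) × (∀ i j → i ≢ j → ¬ 𝔇 i ≅ 𝔇 j)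

module Predimension (ℝ : CompleteOrderedField) (L : Language)
                    (α : Language.Symbol L → CompleteOrderedField.Carrier ℝ) where
  open CompleteOrderedField ℝ
  open Language L
  open Structures L public
  open Structure
  open Embedding

  -- δ of the substructure of 𝔄 induced on S: the subsets of S on which E holds
  -- are the same in that substructure as in 𝔄.
  δ[_] : (𝔄 : Structure) → Subset (card 𝔄) → Carrier
  δ[ 𝔄 ] S = fromℕ ∣ S ∣ - sum (λ E → α E * fromℕ (N 𝔄 E S))

  δ : Structure → Carrier
  δ 𝔄 = δ[ 𝔄 ] ⊤

  -- δ(X/Y)
  δ[_]_/_ : (𝔄 : Structure) (X Y : Subset (card 𝔄)) → Carrier
  δ[ 𝔄 ] X / Y = δ[ 𝔄 ] (X ∪ Y) - δ[ 𝔄 ] Y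

  -- δ(𝔇/𝔄) for 𝔄 embedded in 𝔇
  δ/ : ∀ {𝔄 𝔇} → Embedding 𝔄 𝔇 → Carrier
  δ/ {𝔄} {𝔇} _ = δ 𝔇 - δ 𝔄

  Kα : Pred Structure 0ℓ
  Kα 𝔄 = ∀ S → 0# ≤ δ[ 𝔄 ] S

  -- S ≤ T for substructures of the ambient structure 𝔇
  Strong : (𝔇 : Structure) → Rel (Subset (card 𝔇)) 0ℓ
  Strong 𝔇 S T = S ⊆ T × (∀ X → S ⊆ X → X ⊆ T → δ[ 𝔇 ] S ≤ δ[ 𝔇 ] X)

  MinimalPair : (𝔇 : Structure) → Rel (Subset (card 𝔇)) 0ℓ
  MinimalPair 𝔇 S T =
    S ⊆ T × (∀ C → S ⊆ C → C ⊂ T → Strong 𝔇 S C) × ¬ Strong 𝔇 S T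

  record EssentialMinimalPair {𝔅 𝔇} (ι : Embedding 𝔅 𝔇) : Set where
    field
      𝔅∈Kα        : Kα 𝔅
      δ𝔅>0        : 0# < δ 𝔅
      𝔇∈Kα        : Kα 𝔇
      minimalPair : MinimalPair 𝔇 (image ι) ⊤
      essential   : ∀ D′ → D′ ⊂ ⊤ → 0# ≤ δ[ 𝔇 ] D′ / (D′ ∩ image ι)

  Rational : Set
  Rational = ∀ E → ∃ λ q → α E ≈ fromℚ q

  -- Elements of ℚ are in lowest terms, so ↧ₙ gives the denominators q_E.
  commonDenominator : Rational → ℕ
  commonDenominator r = Vector.foldr lcm 1 λ E → ↧ₙ (proj₁ (r E))

{-# OPTIONS --safe #-}
module Submission where

open import Defs
open import Level using (0ℓ)
import Algebra.Properties.AbelianGroup as AbelianGroupProperties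
import Algebra.Properties.CommutativeMonoid.Sum as SumProperties
import Algebra.Properties.Ring as RingProperties
import Algebra.Properties.Semiring.Mult as MultProperties
import Algebra.Solver.Ring as RingSolver
open import Algebra.Solver.Ring.AlmostCommutativeRing using (_-Raw-AlmostCommutative⟶_; fromCommutativeRing)
open import Axiom.ExcludedMiddle using (ExcludedMiddle)
open import Data.Bool.Base using (false; true)
import Data.Bool.Properties as Bool
open import Data.Empty using (⊥-elim)
open import Data.Fin.Base as Fin using (Fin; _↑ʳ_; _↑ˡ_; suc; toℕ; zero)
open import Data.Fin.Permutation as Permutation using (Permutation′; _⟨$⟩ʳ_; _⟨$⟩ˡ_)
import Data.Fin.Properties as Fin
open import Data.Fin.Subset using (Subset; inside; outside; ∣_∣) renaming (_∈_ to _∈ˢ_; _∉_ to _∉ˢ_; _∩_ to _∩ˢ_; _⊂_ to _⊂ˢ_; _⊆_ to _⊆ˢ_; ⊤ to ⊤ˢ; ⊥ to ∅)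
import Data.Fin.Subset.Properties as Subset
import Data.Integer.Base as ℤ
import Data.Integer.Properties as ℤ
open import Data.List.Base as List using (List; []; _∷_; filter; length)
open import Data.List.Membership.Propositional using (_∈_)
open import Data.List.Membership.Propositional.Properties using (∈-++⁺ʳ; ∈-++⁺ˡ; ∈-++⁻; ∈-filter⁺; ∈-filter⁻; ∈-lookup; ∈-map⁺; ∈-map⁻)
open import Data.List.Membership.Propositional.Properties.WithK using (unique∧set⇒bag)
import Data.List.Properties as List
open import Data.List.Relation.Binary.BagAndSetEquality using (∼bag⇒↭)
open import Data.List.Relation.Binary.Permutation.Propositional.Properties using (↭-length)
open import Data.List.Relation.Unary.All as All using (All; []; _∷_)
import Data.List.Relation.Unary.All.Properties as All
open import Data.List.Relation.Unary.AllPairs using ([]; _∷_)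
open import Data.List.Relation.Unary.Any using (here; there)
open import Data.List.Relation.Unary.Unique.Propositional using (Unique)
import Data.List.Relation.Unary.Unique.Propositional.Properties as Unique
open import Data.Maybe.Base as Maybe using (Maybe; just; nothing)
open import Data.Nat.Base as ℕ using (suc; s≤s; zero; z≤n; ℕ)
import Data.Nat.Coprimality as Coprime
open import Data.Nat.DivMod using ([m+kn]%n≡m%n; _%_; m<n⇒m%n≡m)
open import Data.Nat.Divisibility as ℕ using (divides)
open import Data.Nat.GCD using (gcd; gcd-GCD; module Bézout)
open import Data.Nat.Induction using (<-rec)
open import Data.Nat.LCM using (gcd*lcm; lcm; m∣lcm[m,n]; n∣lcm[m,n])
import Data.Nat.Properties as ℕ
open import Data.Nat.Tactic.RingSolver using (solve-∀)
open import Data.Product using (_,_; _×_; proj₁; proj₂; Σ-syntax; ∃; ∃₂)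
open import Data.Rational.Base as ℚ using (mkℚ; ℚ; ↥_; ↧ₙ_)
import Data.Rational.Properties as ℚ
open import Data.Sign.Base as Sign using (Sign)
open import Data.Sum.Base as Sum using ([_,_]′; _⊎_; inj₁; inj₂)
open import Data.Unit.Base using (tt; ⊤)
open import Data.Vec.Base as Vec using (Vec; []; _++_; _∷_; here; there)
import Data.Vec.Functional as Vector
import Data.Vec.Properties as Vec
open import Data.Vec.Relation.Unary.Unique.Propositional using () renaming (Unique to Distinct)
import Data.Vec.Relation.Unary.Unique.Propositional.Properties as Distinct
open import Function.Base using (_∘_; id)
open import Function.Bundles using (Equivalence; _⇔_; mk⇔)
open import Relation.Binary.Consequences using (dec⇒weaklyDec)
open import Relation.Binary.Definitions using (tri<; tri>; tri≈)
open import Relation.Binary.PropositionalEquality as ≡ using (_≡_; _≢_)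
open import Relation.Binary.Structures using (IsTotalOrder)
open import Relation.Nullary using (contradiction; does; no; yes; ¬_)
open import Relation.Nullary.Decidable using (_×-dec_; dec-false; dec-true; decidable-stable; does-⇔; ¬?)
open import Relation.Unary using (Decidable; Pred)

-- Everything rests on one sparsity inequality. Let 𝔇 arise from 𝔄 by adding n vertices and edges of
-- total weight n + η, each meeting the new vertices, where 0 < η ≤ δ(𝔄). Suppose that every proper
-- subset of 𝔇, with trace Z on the new vertices, contains new edges of weight at most |Z|. Then
-- δ(D′/D′ ∩ 𝔄) is nonnegative for all proper D′ and equals -η for 𝔇 itself. Membership in `Kα`,
-- minimality and essentiality all follow (`essentialMinimalPair`).
--
-- The inequality (`sparse`) has two sources. If Z misses a new vertex, a running balance s bounds
-- the weight inside Z, and the first vertex of Z after a gap forfeits an edge of weight at least s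
-- + η (`greedy`, `sum≤with-gap`). If Z is everything, some element x of 𝔄 is missing, and with it
-- an edge reserved for x, of weight at least η.
--
-- The first edge of an owner has to link it to its predecessor, so if it is binary it cannot hold
-- an element of 𝔄. A symbol of arity at least 3 has a spare place. A binary symbol with α E < 1,
-- used often, makes the edges outnumber the new vertices by the size of 𝔄, which leaves enough
-- edges that are not first. This is where the excluded language and weights matter (`suitable`).
-- Each owner has boundedly many edges, so for large n the edges can be laid out on a cycle of new
-- vertices without coincidences (`edge-injective`).
--
-- What remains is arithmetic: for arbitrarily large n, find a list of symbols of weight n + η none
-- of whose partial weights lies strictly between i and i + η for an integer i. In the rational case
-- Bézout's identity provides η = 1/c (`unit-foldr-lcm`, `integral-gap`). In the irrational case a
-- Euclidean descent makes m α E - i arbitrarily small and positive, and a record minimum serves as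
-- η (`halve`, `record-excess`). As n is unbounded, so are the cardinalities, which gives infinitely
-- many isomorphism types.

-- New vertices b₀, …, bₙ₋₁ are added to 𝔄, with edges of total weight n + η, so that δ(𝔇/𝔄) = -η.
-- Every edge is owned by one of the bᵢ in it. The edges are dealt out greedily: bᵢ takes edges as long as
-- s, the number of vertices served minus the weight dealt out, stays nonnegative. Choosing the edges so
-- that no partial weight lies strictly between an integer i and i + η, the first edge of the next owner
-- weighs at least s + η. That edge is made to contain the previous vertex too, so that a set of new
-- vertices with a gap loses enough weight to absorb the final excess η. As every element of 𝔄 is put into
-- some edge and η ≤ α E for all E, it follows that δ(D′/D′ ∩ 𝔄) ≥ 0 for all proper D′.
-- If α is rational, the real numbers that are an integral combination of 1 and the α E form a group, which
-- contains 1/c = η, and all partial weights are multiples of η. If α E is irrational, a single symbol is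
-- used and η = M α E - n is less than all earlier positive values of m α E - i.

-- Ordered fields

module OrderedField (ℝ : CompleteOrderedField) where
  open CompleteOrderedField ℝ hiding (zero)
  open IsTotalOrder isTotalOrder public
    using () renaming (refl to ≤-refl; reflexive to ≤-reflexive; trans to ≤-trans; antisym to ≤-antisym; total to ≤-total)
  open MultProperties semiring using (×-homo-+; ×1-homo-*)
  open RingProperties ring using (-‿distribˡ-*; -‿distribʳ-*)
  open AbelianGroupProperties +-abelianGroup using (⁻¹-∙-comm; ε⁻¹≈ε; ⁻¹-involutive)

  fromℕ-+ : ∀ m n → fromℕ (m ℕ.+ n) ≈ fromℕ m + fromℕ n
  fromℕ-+ = ×-homo-+ 1#

  fromℕ-* : ∀ m n → fromℕ (m ℕ.* n) ≈ fromℕ m * fromℕ n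
  fromℕ-* = ×1-homo-*

  fromℕ-cong : ∀ {m n} → m ≡ n → fromℕ m ≈ fromℕ n
  fromℕ-cong ≡.refl = refl

  fromℤ-cong : ∀ {i j} → i ≡ j → fromℤ i ≈ fromℤ j
  fromℤ-cong ≡.refl = refl

  fromℤ-neg : ∀ i → fromℤ (ℤ.- i) ≈ - fromℤ i
  fromℤ-neg (ℤ.+ zero)  = sym ε⁻¹≈ε
  fromℤ-neg (ℤ.+ suc n) = refl
  fromℤ-neg ℤ.-[1+ n ]  = sym (⁻¹-involutive _)

  fromℤ-⊖ : ∀ m n → fromℤ (m ℤ.⊖ n) ≈ fromℕ m - fromℕ n
  fromℤ-⊖ m zero = sym (trans (+-congˡ ε⁻¹≈ε) (+-identityʳ _))
  fromℤ-⊖ zero (suc n) = sym (+-identityˡ _)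
  fromℤ-⊖ (suc m) (suc n) = begin
    fromℤ (suc m ℤ.⊖ suc n)              ≈⟨ fromℤ-cong (ℤ.[1+m]⊖[1+n]≡m⊖n m n) ⟩
    fromℤ (m ℤ.⊖ n)                      ≈⟨ fromℤ-⊖ m n ⟩
    fromℕ m - fromℕ n                    ≈⟨ +-congˡ (+-identityˡ _) ⟨
    fromℕ m + (0# - fromℕ n)             ≈⟨ +-congˡ (+-congʳ (-‿inverseʳ 1#)) ⟨
    fromℕ m + ((1# - 1#) - fromℕ n)      ≈⟨ +-congˡ (+-assoc _ _ _) ⟩
    fromℕ m + (1# + (- 1# - fromℕ n))    ≈⟨ +-congˡ (+-congˡ (⁻¹-∙-comm _ _)) ⟩
    fromℕ m + (1# - fromℕ (suc n))       ≈⟨ +-assoc _ _ _ ⟨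
    (fromℕ m + 1#) - fromℕ (suc n)       ≈⟨ +-congʳ (+-comm _ _) ⟩
    fromℕ (suc m) - fromℕ (suc n)        ∎
    where open import Relation.Binary.Reasoning.Setoid setoid

  fromℤ-+ : ∀ i j → fromℤ (i ℤ.+ j) ≈ fromℤ i + fromℤ j
  fromℤ-+ (ℤ.+ m)    (ℤ.+ n)    = fromℕ-+ m n
  fromℤ-+ (ℤ.+ m)    ℤ.-[1+ n ] = fromℤ-⊖ m (suc n)
  fromℤ-+ ℤ.-[1+ m ] (ℤ.+ n)    = trans (fromℤ-⊖ n (suc m)) (+-comm _ _)
  fromℤ-+ ℤ.-[1+ m ] ℤ.-[1+ n ] = trans
    (-‿cong (trans (fromℕ-cong (≡.cong suc (≡.sym (ℕ.+-suc m n)))) (fromℕ-+ (suc m) (suc n))))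
    (sym (⁻¹-∙-comm _ _))

  private
    fromℤ-+◃ : ∀ n → fromℤ (Sign.+ ℤ.◃ n) ≈ fromℕ n
    fromℤ-+◃ n = fromℤ-cong (ℤ.+◃n≡+n n)

    fromℤ--◃ : ∀ n → fromℤ (Sign.- ℤ.◃ n) ≈ - fromℕ n
    fromℤ--◃ zero    = sym ε⁻¹≈ε
    fromℤ--◃ (suc n) = refl

  fromℤ-* : ∀ i j → fromℤ (i ℤ.* j) ≈ fromℤ i * fromℤ j
  fromℤ-* (ℤ.+ m)    (ℤ.+ n)    = trans (fromℤ-+◃ (m ℕ.* n)) (fromℕ-* m n)
  fromℤ-* (ℤ.+ m)    ℤ.-[1+ n ] = trans (fromℤ--◃ (m ℕ.* suc n)) (trans (-‿cong (fromℕ-* m (suc n))) (-‿distribʳ-* _ _))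
  fromℤ-* ℤ.-[1+ m ] (ℤ.+ n)    = trans (fromℤ--◃ (suc m ℕ.* n)) (trans (-‿cong (fromℕ-* (suc m) n)) (-‿distribˡ-* _ _))
  fromℤ-* ℤ.-[1+ m ] ℤ.-[1+ n ] = begin
    fromℕ (suc m ℕ.* suc n)            ≈⟨ fromℕ-* (suc m) (suc n) ⟩
    fromℕ (suc m) * fromℕ (suc n)      ≈⟨ ⁻¹-involutive _ ⟨
    - - (fromℕ (suc m) * fromℕ (suc n)) ≈⟨ -‿cong (-‿distribʳ-* _ _) ⟩
    - (fromℕ (suc m) * - fromℕ (suc n)) ≈⟨ -‿distribˡ-* _ _ ⟩
    - fromℕ (suc m) * - fromℕ (suc n)  ∎
    where open import Relation.Binary.Reasoning.Setoid setoid

  private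
    fromℤ-morphism : ℤ.+-*-rawRing -Raw-AlmostCommutative⟶ fromCommutativeRing commutativeRing
    fromℤ-morphism = record
      { ⟦_⟧    = fromℤ
      ; +-homo = fromℤ-+
      ; *-homo = fromℤ-*
      ; -‿homo = fromℤ-neg
      ; 0-homo = refl
      ; 1-homo = +-identityʳ 1#
      }

  -- Integer coefficients make numerals available to the solver and have decidable equality, which
  -- is not assumed of the field.
  module Solver = RingSolver ℤ.+-*-rawRing (fromCommutativeRing commutativeRing) fromℤ-morphism
    (λ i j → Maybe.map fromℤ-cong (dec⇒weaklyDec ℤ._≟_ i j))
  open Solver using (solve; _:=_; _:+_; _:*_; _:-_; :-_; con)

  +-mono-≤ : ∀ {x y u v} → x ≤ y → u ≤ v → x + u ≤ y + v
  +-mono-≤ {x} {y} {u} {v} p q = ≤-trans (+-monoˡ-≤ u p)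
    (≤-trans (≤-reflexive (+-comm y u)) (≤-trans (+-monoˡ-≤ y q) (≤-reflexive (+-comm v y))))

  ≤-cong : ∀ {x x′ y y′} → x ≈ x′ → y ≈ y′ → x ≤ y → x′ ≤ y′
  ≤-cong p q r = ≤-trans (≤-reflexive (sym p)) (≤-trans r (≤-reflexive q))

  -- Linear arithmetic: the hypotheses are added up, and the equation, in which both sides have been
  -- moved so that no subtraction occurs, is left to the ring solver.
  lin₁ : ∀ {x₁ y₁ x y} → x₁ ≤ y₁ → y₁ + x ≈ x₁ + y → x ≤ y
  lin₁ {x₁} {y₁} {x} {y} p e = ≤-cong
    (solve 2 (λ x₁ x → (x₁ :+ x) :- x₁ := x) refl x₁ x)
    (trans (+-congʳ e) (solve 2 (λ x₁ y → (x₁ :+ y) :- x₁ := y) refl x₁ y))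
    (+-monoˡ-≤ (- x₁) (+-monoˡ-≤ x p))

  lin₂ : ∀ {x₁ y₁ x₂ y₂ x y} → x₁ ≤ y₁ → x₂ ≤ y₂ → (y₁ + y₂) + x ≈ (x₁ + x₂) + y → x ≤ y
  lin₂ p q = lin₁ (+-mono-≤ p q)

  lin₃ : ∀ {x₁ y₁ x₂ y₂ x₃ y₃ x y} → x₁ ≤ y₁ → x₂ ≤ y₂ → x₃ ≤ y₃ →
         (y₁ + y₂ + y₃) + x ≈ (x₁ + x₂ + x₃) + y → x ≤ y
  lin₃ p q r = lin₁ (+-mono-≤ (+-mono-≤ p q) r)

  ≰⇒> : ∀ {x y} → ¬ x ≤ y → y < x
  ≰⇒> {x} {y} x≰y with ≤-total x y
  ... | inj₁ x≤y = contradiction x≤y x≰y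
  ... | inj₂ y≤x = y≤x , λ y≈x → x≰y (≤-reflexive (sym y≈x))

  <⇒≱ : ∀ {x y} → x < y → ¬ y ≤ x
  <⇒≱ (x≤y , x≉y) y≤x = x≉y (≤-antisym x≤y y≤x)

  <-≤-trans : ∀ {x y z} → x < y → y ≤ z → x < z
  <-≤-trans x<y y≤z = ≰⇒> λ z≤x → <⇒≱ x<y (≤-trans y≤z z≤x)

  ≤-<-trans : ∀ {x y z} → x ≤ y → y < z → x < z
  ≤-<-trans x≤y y<z = ≰⇒> λ z≤x → <⇒≱ y<z (≤-trans z≤x x≤y)

  <-cong : ∀ {x x′ y y′} → x ≈ x′ → y ≈ y′ → x < y → x′ < y′
  <-cong p q r = ≤-<-trans (≤-reflexive (sym p)) (<-≤-trans r (≤-reflexive q))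

  neg-≤ : ∀ {x y} → x ≤ y → - y ≤ - x
  neg-≤ {x} {y} p = lin₁ p (solve 2 (λ x y → y :+ :- y := x :+ :- x) refl x y)

  *-monoʳ-≤ : ∀ {z x y} → 0# ≤ z → x ≤ y → z * x ≤ z * y
  *-monoʳ-≤ {z} {x} {y} 0≤z x≤y = lin₁
    (*-nonNeg 0≤z (lin₁ x≤y (solve 2 (λ x y → y :+ con ℤ.0ℤ := x :+ (y :- x)) refl x y)))
    (solve 3 (λ x y z → z :* (y :- x) :+ z :* x := con ℤ.0ℤ :+ z :* y) refl x y z)

  0≤1 : 0# ≤ 1#
  0≤1 with ≤-total 0# 1#
  ... | inj₁ p = p
  ... | inj₂ p = ≤-trans (*-nonNeg q q)
    (≤-reflexive (trans (solve 1 (λ o → (:- o) :* (:- o) := o :* o) refl 1#) (*-identityʳ 1#)))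
    where
    q : 0# ≤ - 1#
    q = ≤-cong ε⁻¹≈ε refl (neg-≤ p)

  0<1 : 0# < 1#
  0<1 = 0≤1 , 0≉1

  0≤fromℕ : ∀ n → 0# ≤ fromℕ n
  0≤fromℕ zero    = ≤-refl
  0≤fromℕ (suc n) = ≤-cong (+-identityˡ 0#) refl (+-mono-≤ 0≤1 (0≤fromℕ n))

  fromℕ-mono : ∀ {m n} → m ℕ.≤ n → fromℕ m ≤ fromℕ n
  fromℕ-mono {n = n} ℕ.z≤n = 0≤fromℕ n
  fromℕ-mono (ℕ.s≤s p)     = +-mono-≤ ≤-refl (fromℕ-mono p)

  fromℕ-cancel : ∀ {m n} → fromℕ m ≤ fromℕ n → m ℕ.≤ n
  fromℕ-cancel {m} {n} p with m ℕ.≤? n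
  ... | yes m≤n = m≤n
  ... | no  m≰n = contradiction
    (lin₂ p (fromℕ-mono (ℕ.≰⇒> m≰n))
      (solve 3 (λ o m n → (n :+ m) :+ o := (m :+ (o :+ n)) :+ con ℤ.0ℤ) refl 1# (fromℕ m) (fromℕ n)))
    (<⇒≱ 0<1)

  fromℕ-suc>0 : ∀ n → 0# < fromℕ (suc n)
  fromℕ-suc>0 n = <-≤-trans 0<1 (≤-cong (+-identityʳ 1#) refl (fromℕ-mono {1} {suc n} (ℕ.s≤s ℕ.z≤n)))

  >⇒≉ : ∀ {x} → 0# < x → ¬ x ≈ 0#
  >⇒≉ (_ , 0≉x) x≈0 = 0≉x (sym x≈0)

  *-cancelˡ : ∀ {z x y} → ¬ z ≈ 0# → z * x ≈ z * y → x ≈ y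
  *-cancelˡ {z} {x} {y} z≉0 e = trans (sym (lemma x)) (trans (*-congˡ e) (lemma y))
    where
    lemma : ∀ x → z ⁻¹ * (z * x) ≈ x
    lemma x = trans (solve 3 (λ z i x → i :* (z :* x) := (z :* i) :* x) refl z (z ⁻¹) x)
                    (trans (*-congʳ (*-inverseʳ z z≉0)) (*-identityˡ x))

  *-cancelˡ-≤ : ∀ {z x y} → 0# < z → z * x ≤ z * y → x ≤ y
  *-cancelˡ-≤ {z} {x} {y} 0<z p with ≤-total x y
  ... | inj₁ x≤y = x≤y
  ... | inj₂ y≤x = ≤-reflexive (*-cancelˡ (>⇒≉ 0<z) (≤-antisym p (*-monoʳ-≤ (proj₁ 0<z) y≤x)))

  *-pos : ∀ {x y} → 0# < x → 0# < y → 0# < x * y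
  *-pos {x} {y} 0<x 0<y = ≰⇒> λ xy≤0 → <⇒≱ 0<y (*-cancelˡ-≤ 0<x (≤-cong refl (sym (zeroʳ x)) xy≤0))

  ⁻¹-pos : ∀ {x} → 0# < x → 0# < x ⁻¹
  ⁻¹-pos {x} 0<x = ≰⇒> λ p → <⇒≱ 0<1
    (≤-cong (*-inverseʳ x (>⇒≉ 0<x)) (zeroʳ x) (*-monoʳ-≤ (proj₁ 0<x) p))

  module _ (em : ExcludedMiddle 0ℓ) where

    -- If x bounded all natural numbers, they would have a supremum s; as n + 1 ≤ s for all n,
    -- already s - 1 would be an upper bound.
    archimedean : ∀ x → ∃ λ n → x ≤ fromℕ n
    archimedean x with em {∃ λ n → x ≤ fromℕ n}
    ... | yes p = p
    ... | no ¬p = contradiction s≤s-1 (<⇒≱ s-1<s)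
      where
      bounded : ∀ y → (∃ λ n → y ≈ fromℕ n) → y ≤ x
      bounded y (n , e) = ≤-trans (≤-reflexive e) (proj₁ (≰⇒> λ p → ¬p (n , p)))
      sup = supremum (λ y → ∃ λ n → y ≈ fromℕ n) (0# , 0 , refl) (x , bounded)
      s = proj₁ sup
      s≤s-1 : s ≤ s - 1#
      s≤s-1 = proj₂ (proj₂ sup) (s - 1#) λ { y (n , e) →
        lin₂ (≤-reflexive e) (proj₁ (proj₂ sup) (fromℕ (suc n)) (suc n , refl))
          (solve 4 (λ o n s y → (n :+ s) :+ y := (y :+ (o :+ n)) :+ (s :- o)) refl 1# (fromℕ n) s y) }
      s-1<s : s - 1# < s
      s-1<s = ≰⇒> λ p → <⇒≱ 0<1 (lin₁ p (solve 2 (λ o s → (s :- o) :+ o := s :+ con ℤ.0ℤ) refl 1# s))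

    archimedean-* : ∀ {x} → 0# < x → ∀ y → ∃ λ n → y ≤ fromℕ n * x
    archimedean-* {x} 0<x y with archimedean (y * x ⁻¹)
    ... | n , p = n , ≤-cong e (*-comm x _) (*-monoʳ-≤ (proj₁ 0<x) p)
      where
      e : x * (y * x ⁻¹) ≈ y
      e = trans (solve 3 (λ x i y → x :* (y :* i) := (x :* i) :* y) refl x (x ⁻¹) y)
                (trans (*-congʳ (*-inverseʳ x (>⇒≉ 0<x))) (*-identityˡ y))

    modulo : ∀ {a b} → 0# < a → 0# ≤ b → ∃ λ k → 0# ≤ b - fromℕ k * a × b - fromℕ k * a < a
    modulo {a} {b} 0<a 0≤b = go (proj₁ N) (proj₂ N)
      where
      N = archimedean-* 0<a b
      go : ∀ n → b ≤ fromℕ n * a → ∃ λ k → 0# ≤ b - fromℕ k * a × b - fromℕ k * a < a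
      go zero p = 0 , lin₁ 0≤b (solve 2 (λ a b → b :+ con ℤ.0ℤ := con ℤ.0ℤ :+ (b :- con ℤ.0ℤ :* a)) refl a b)
        , ≤-<-trans (lin₁ p (solve 2 (λ a b → con ℤ.0ℤ :* a :+ (b :- con ℤ.0ℤ :* a) := b :+ con ℤ.0ℤ) refl a b)) 0<a
      go (suc n) p with em {b ≤ fromℕ n * a}
      ... | yes q = go n q
      ... | no ¬q with ≰⇒> ¬q | em {a ≤ b - fromℕ n * a}
      ...   | q | no r  = n , lin₁ (proj₁ q) (solve 3 (λ n a b → b :+ con ℤ.0ℤ := n :* a :+ (b :- n :* a)) refl (fromℕ n) a b) , ≰⇒> r
      ...   | q | yes r = suc n
        , lin₁ r (trans (solve 3 (λ n a b → (b :- n :* a) :+ con ℤ.0ℤ := a :+ (b :- (a :+ n :* a))) refl (fromℕ n) a b) (+-congˡ (+-congˡ (-‿cong (sym e)))))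
        , ≤-<-trans (lin₁ p (solve 3 (λ m a b → m :* a :+ (b :- m :* a) := b :+ con ℤ.0ℤ) refl (fromℕ (suc n)) a b)) 0<a
        where
        e : fromℕ (suc n) * a ≈ a + fromℕ n * a
        e = trans (distribʳ a 1# (fromℕ n)) (+-congʳ (*-identityˡ a))

-- Counting subsets

enumerate : ∀ {n} {P : Pred (Subset n) 0ℓ} (P? : Decidable P) →
            Σ[ Xs ∈ List (Subset n) ] Unique Xs × (∀ X → X ∈ Xs ⇔ P X) × length Xs ≡ #Subsets P?
enumerate {zero} P? with P? []
... | yes p = [] ∷ [] , [] ∷ [] , (λ { [] → mk⇔ (λ _ → p) (λ _ → here ≡.refl) }) , ≡.refl
... | no ¬p = [] , [] , (λ { [] → mk⇔ (λ ()) (λ p → ⊥-elim (¬p p)) }) , ≡.refl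
enumerate {suc n} {P} P? with enumerate (λ X → P? (inside ∷ X)) | enumerate (λ X → P? (outside ∷ X))
... | Xs , uX , iX , lX | Ys , uY , iY , lY =
  List.map (inside ∷_) Xs List.++ List.map (outside ∷_) Ys
  , Unique.++⁺ (Unique.map⁺ Vec.∷-injectiveʳ uX) (Unique.map⁺ Vec.∷-injectiveʳ uY) disjoint
  , (λ X → mk⇔ (to X) (from X))
  , ≡.trans (List.length-++ (List.map (inside ∷_) Xs))
          (≡.cong₂ ℕ._+_ (≡.trans (List.length-map _ Xs) lX) (≡.trans (List.length-map _ Ys) lY))
  where
  disjoint : ∀ {X} → ¬ (X ∈ List.map (inside ∷_) Xs × X ∈ List.map (outside ∷_) Ys)
  disjoint (p , q) with ∈-map⁻ _ p | ∈-map⁻ _ q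
  ... | _ , _ , ≡.refl | _ , _ , ()
  to : ∀ X → X ∈ List.map (inside ∷_) Xs List.++ List.map (outside ∷_) Ys → P X
  to X p with ∈-++⁻ (List.map (inside ∷_) Xs) p
  ... | inj₁ q with ∈-map⁻ _ q
  ...   | Y , Y∈ , ≡.refl = Equivalence.to (iX Y) Y∈
  to X p | inj₂ q with ∈-map⁻ _ q
  ...   | Y , Y∈ , ≡.refl = Equivalence.to (iY Y) Y∈
  from : ∀ X → P X → X ∈ List.map (inside ∷_) Xs List.++ List.map (outside ∷_) Ys
  from (inside  ∷ X) p = ∈-++⁺ˡ (∈-map⁺ _ (Equivalence.from (iX X) p))
  from (outside ∷ X) p = ∈-++⁺ʳ _ (∈-map⁺ _ (Equivalence.from (iY X) p))

-- The recursive count does not see how a family of subsets splits into pieces. It may be replaced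
-- by the length of any duplicate-free list of the family, since two such lists are permutations of
-- each other.
#Subsets≡length : ∀ {n} {P : Pred (Subset n) 0ℓ} (P? : Decidable P) {Xs} →
                  Unique Xs → (∀ X → X ∈ Xs ⇔ P X) → #Subsets P? ≡ length Xs
#Subsets≡length P? uX iX with enumerate P?
... | Ys , uY , iY , lY = ≡.trans (≡.sym lY) (↭-length (∼bag⇒↭ (unique∧set⇒bag uY uX λ {X} →
  mk⇔ (Equivalence.from (iX X) ∘ Equivalence.to (iY X)) (Equivalence.from (iY X) ∘ Equivalence.to (iX X)))))

unique-map : ∀ {A B : Set} {f : A → B} {xs} → (∀ {x y} → x ∈ xs → y ∈ xs → f x ≡ f y → x ≡ y) →
             Unique xs → Unique (List.map f xs)
unique-map inj [] = []
unique-map inj (x∉xs ∷ uxs) =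
  All.map⁺ (All.tabulate λ y∈xs e → All.lookup x∉xs y∈xs (inj (here ≡.refl) (there y∈xs) e))
  ∷ unique-map (λ p q → inj (there p) (there q)) uxs

∈-entries⁺ : ∀ {n k} (t : Vec (Fin n) k) i → Vec.lookup t i ∈ˢ entries t
∈-entries⁺ (x ∷ t) zero    = Subset.x∈p∪q⁺ (inj₁ (Subset.x∈⁅x⁆ x))
∈-entries⁺ (x ∷ t) (suc i) = Subset.x∈p∪q⁺ (inj₂ (∈-entries⁺ t i))

∈-entries⁻ : ∀ {n k} (t : Vec (Fin n) k) {v} → v ∈ˢ entries t → ∃ λ i → Vec.lookup t i ≡ v
∈-entries⁻ [] v∈ = contradiction v∈ Subset.∉⊥
∈-entries⁻ (x ∷ t) v∈ with Subset.x∈p∪q⁻ _ _ v∈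
... | inj₁ p = zero , ≡.sym (Subset.x∈⁅y⁆⇒x≡y x p)
... | inj₂ p with ∈-entries⁻ t p
...   | i , e = suc i , e

∈-entries-tabulate⁺ : ∀ {n k} (f : Fin k → Fin n) i → f i ∈ˢ entries (Vec.tabulate f)
∈-entries-tabulate⁺ f i = ≡.subst (_∈ˢ entries (Vec.tabulate f)) (Vec.lookup∘tabulate f i) (∈-entries⁺ (Vec.tabulate f) i)

∈-entries-tabulate⁻ : ∀ {n k} (f : Fin k → Fin n) {v} → v ∈ˢ entries (Vec.tabulate f) → ∃ λ i → f i ≡ v
∈-entries-tabulate⁻ f v∈ with ∈-entries⁻ (Vec.tabulate f) v∈
... | i , e = i , ≡.trans (≡.sym (Vec.lookup∘tabulate f i)) e

permute : ∀ {A : Set} {k} → Permutation′ k → Vec A k → Vec A k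
permute π t = Vec.tabulate λ i → Vec.lookup t (π ⟨$⟩ʳ i)

permute-flip : ∀ {A : Set} {k} (π : Permutation′ k) (t : Vec A k) → permute (Permutation.flip π) (permute π t) ≡ t
permute-flip π t = ≡.trans
  (Vec.tabulate-cong λ i → ≡.trans (Vec.lookup∘tabulate _ (π ⟨$⟩ˡ i)) (≡.cong (Vec.lookup t) (Permutation.inverseʳ π)))
  (Vec.tabulate∘lookup t)

entries-permute : ∀ {n k} (π : Permutation′ k) (t : Vec (Fin n) k) → entries (permute π t) ≡ entries t
entries-permute π t = Subset.⊆-antisym to from
  where
  to : entries (permute π t) ⊆ˢ entries t
  to v∈ with ∈-entries-tabulate⁻ (λ i → Vec.lookup t (π ⟨$⟩ʳ i)) v∈
  ... | i , ≡.refl = ∈-entries⁺ t (π ⟨$⟩ʳ i)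
  from : entries t ⊆ˢ entries (permute π t)
  from v∈ with ∈-entries⁻ t v∈
  ... | i , ≡.refl = ≡.subst (_∈ˢ entries (permute π t)) (≡.cong (Vec.lookup t) (Permutation.inverseʳ π))
                         (∈-entries-tabulate⁺ (λ i → Vec.lookup t (π ⟨$⟩ʳ i)) (π ⟨$⟩ˡ i))

distinct-permute : ∀ {A : Set} {k} (π : Permutation′ k) {t : Vec A k} → Distinct t → Distinct (permute π t)
distinct-permute π u = Distinct.tabulate⁺ λ {i} {j} e →
  ≡.trans (≡.sym (Permutation.inverseˡ π)) (≡.trans (≡.cong (π ⟨$⟩ˡ_) (Distinct.lookup-injective u _ _ e)) (Permutation.inverseˡ π))

permute-map : ∀ {A B : Set} {k} (f : A → B) (π : Permutation′ k) (t : Vec A k) →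
              permute π (Vec.map f t) ≡ Vec.map f (permute π t)
permute-map f π t = ≡.trans (Vec.tabulate-cong λ i → Vec.lookup-map (π ⟨$⟩ʳ i) f t) (Vec.tabulate-∘ f _)

-- The vertices of an extension are `Fin (a ℕ.+ n)`, old ones first, so every subset is `Y ++ Z`
-- with trace `Y` on the old and `Z` on the new vertices.
module _ {a n : ℕ} where

  ∈-++-↑ˡ⁺ : ∀ {Y : Subset a} {Z : Subset n} {x} → x ∈ˢ Y → (x ↑ˡ n) ∈ˢ Y ++ Z
  ∈-++-↑ˡ⁺ {Y} {Z} {x} p = Vec.lookup⇒[]= _ _ (≡.trans (Vec.lookup-++ˡ Y Z x) (Vec.[]=⇒lookup p))

  ∈-++-↑ˡ⁻ : ∀ (Y : Subset a) {Z : Subset n} {x} → (x ↑ˡ n) ∈ˢ Y ++ Z → x ∈ˢ Y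
  ∈-++-↑ˡ⁻ Y {Z} {x} p = Vec.lookup⇒[]= _ _ (≡.trans (≡.sym (Vec.lookup-++ˡ Y Z x)) (Vec.[]=⇒lookup p))

  ∈-++-↑ʳ⁺ : ∀ {Y : Subset a} {Z : Subset n} {z} → z ∈ˢ Z → (a ↑ʳ z) ∈ˢ Y ++ Z
  ∈-++-↑ʳ⁺ {Y} {Z} {z} p = Vec.lookup⇒[]= _ _ (≡.trans (Vec.lookup-++ʳ Y Z z) (Vec.[]=⇒lookup p))

  ∈-++-↑ʳ⁻ : ∀ (Y : Subset a) {Z : Subset n} {z} → (a ↑ʳ z) ∈ˢ Y ++ Z → z ∈ˢ Z
  ∈-++-↑ʳ⁻ Y {Z} {z} p = Vec.lookup⇒[]= _ _ (≡.trans (≡.sym (Vec.lookup-++ʳ Y Z z)) (Vec.[]=⇒lookup p))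

  ↑ˡ≢↑ʳ : ∀ {x : Fin a} {z : Fin n} → x ↑ˡ n ≢ a ↑ʳ z
  ↑ˡ≢↑ʳ {x} {z} e with ≡.trans (≡.sym (Fin.splitAt-↑ˡ a x n)) (≡.trans (≡.cong (Fin.splitAt a) e) (Fin.splitAt-↑ʳ a n z))
  ... | ()

  data Side : Fin (a ℕ.+ n) → Set where
    left  : ∀ x → Side (x ↑ˡ n)
    right : ∀ z → Side (a ↑ʳ z)

  side : ∀ v → Side v
  side v with Fin.splitAt a v in eq
  ... | inj₁ x = ≡.subst Side (Fin.splitAt⁻¹-↑ˡ {a} eq) (left x)
  ... | inj₂ z = ≡.subst Side (Fin.splitAt⁻¹-↑ʳ {a} eq) (right z)

  ++-⊆ : ∀ {Y Y′ : Subset a} {Z Z′ : Subset n} → Y ⊆ˢ Y′ → Z ⊆ˢ Z′ → Y ++ Z ⊆ˢ Y′ ++ Z′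
  ++-⊆ {Y} p q {v} v∈ with side v
  ... | left x  = ∈-++-↑ˡ⁺ (p (∈-++-↑ˡ⁻ Y v∈))
  ... | right z = ∈-++-↑ʳ⁺ (q (∈-++-↑ʳ⁻ Y v∈))

  ++-⊆⁻ˡ : ∀ {Y Y′ : Subset a} {Z Z′ : Subset n} → Y ++ Z ⊆ˢ Y′ ++ Z′ → Y ⊆ˢ Y′
  ++-⊆⁻ˡ {Y} {Y′} p x∈ = ∈-++-↑ˡ⁻ Y′ (p (∈-++-↑ˡ⁺ x∈))

  ⊤++⊤ : ⊤ˢ {a} ++ ⊤ˢ {n} ≡ ⊤ˢ
  ⊤++⊤ = Subset.⊆-antisym Subset.⊆⊤ λ {v} _ → h v (side v)
    where
    h : ∀ v → Side v → v ∈ˢ ⊤ˢ {a} ++ ⊤ˢ {n}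
    h _ (left x)  = ∈-++-↑ˡ⁺ Subset.∈⊤
    h _ (right z) = ∈-++-↑ʳ⁺ Subset.∈⊤

  entries-map-↑ˡ : ∀ {k} (t : Vec (Fin a) k) → entries (Vec.map (_↑ˡ n) t) ≡ entries t ++ ∅
  entries-map-↑ˡ t = Subset.⊆-antisym to from
    where
    to : entries (Vec.map (_↑ˡ n) t) ⊆ˢ entries t ++ ∅
    to v∈ with ∈-entries⁻ (Vec.map (_↑ˡ n) t) v∈
    ... | i , ≡.refl = ≡.subst (_∈ˢ entries t ++ ∅) (≡.sym (Vec.lookup-map i (_↑ˡ n) t)) (∈-++-↑ˡ⁺ (∈-entries⁺ t i))
    from : entries t ++ ∅ ⊆ˢ entries (Vec.map (_↑ˡ n) t)
    from {v} v∈ with side v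
    ... | right z = contradiction (∈-++-↑ʳ⁻ (entries t) v∈) Subset.∉⊥
    ... | left x with ∈-entries⁻ t (∈-++-↑ˡ⁻ (entries t) v∈)
    ...   | i , ≡.refl = ≡.subst (_∈ˢ _) (Vec.lookup-map i (_↑ˡ n) t) (∈-entries⁺ (Vec.map (_↑ˡ n) t) i)

  image-↑ˡ : entries (Vec.tabulate (_↑ˡ n)) ≡ ⊤ˢ {a} ++ ∅ {n}
  image-↑ˡ = Subset.⊆-antisym to from
    where
    to : entries (Vec.tabulate (_↑ˡ n)) ⊆ˢ ⊤ˢ {a} ++ ∅ {n}
    to v∈ with ∈-entries-tabulate⁻ (_↑ˡ n) v∈
    ... | i , ≡.refl = ∈-++-↑ˡ⁺ Subset.∈⊤
    from : ⊤ˢ {a} ++ ∅ {n} ⊆ˢ entries (Vec.tabulate (_↑ˡ n))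
    from {v} v∈ with side v
    ... | right z = contradiction (∈-++-↑ʳ⁻ (⊤ˢ {a}) v∈) Subset.∉⊥
    ... | left x  = ∈-entries-tabulate⁺ (_↑ˡ n) x

∣++∣ : ∀ {a n} (Y : Subset a) (Z : Subset n) → ∣ Y ++ Z ∣ ≡ ∣ Y ∣ ℕ.+ ∣ Z ∣
∣++∣ []            Z = ≡.refl
∣++∣ (inside ∷ Y)  Z = ≡.cong suc (∣++∣ Y Z)
∣++∣ (outside ∷ Y) Z = ∣++∣ Y Z

-- Extending 𝔄 by new vertices and edges

module Weights (ℝ : CompleteOrderedField) (L : Language)
               (α : Language.Symbol L → CompleteOrderedField.Carrier ℝ) where
  open CompleteOrderedField ℝ hiding (zero)
  open OrderedField ℝ
  open Language L
  open SumProperties +-commutativeMonoid using (∑-distrib-+; sum-replicate-zero) renaming (sum-cong-≋ to sum-cong)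

  weight : List Symbol → Carrier
  weight = List.foldr (λ E w → α E + w) 0#

  weight-++ : ∀ Es Fs → weight (Es List.++ Fs) ≈ weight Es + weight Fs
  weight-++ []       Fs = sym (+-identityˡ _)
  weight-++ (E ∷ Es) Fs = trans (+-congˡ (weight-++ Es Fs)) (sym (+-assoc _ _ _))

  weight-cong : ∀ {Es Fs} → Es ≡ Fs → weight Es ≈ weight Fs
  weight-cong ≡.refl = refl

  count : ∀ {k} → Fin k → List (Fin k) → ℕ
  count i is = length (filter (i Fin.≟_) is)

  count-∷ : ∀ {k} (i j : Fin k) is → count i (j ∷ is) ≡ count i (j ∷ []) ℕ.+ count i is
  count-∷ i j is with does (i Fin.≟ j)
  ... | true  = ≡.refl
  ... | false = ≡.refl

  count-map : ∀ {I : Set} {k} (f : I → Fin k) i xs →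
              length (filter (λ x → i Fin.≟ f x) xs) ≡ count i (List.map f xs)
  count-map f i [] = ≡.refl
  count-map f i (x ∷ xs) with does (i Fin.≟ f x)
  ... | true  = ≡.cong suc (count-map f i xs)
  ... | false = count-map f i xs

  private
    sum-pick : ∀ {k} (f : Fin k → Carrier) j → sum (λ i → f i * fromℕ (count i (j ∷ []))) ≈ f j
    sum-pick f zero = trans (+-cong (trans (*-congˡ (+-identityʳ 1#)) (*-identityʳ _)) (zeros (f ∘ suc))) (+-identityʳ _)
      where
      zeros : ∀ {k} (g : Fin k → Carrier) → sum (λ j → g j * 0#) ≈ 0#
      zeros {zero}  g = refl
      zeros {suc k} g = trans (+-cong (zeroʳ _) (zeros (g ∘ suc))) (+-identityˡ _)
    sum-pick f (suc j) = trans
      (+-cong (zeroʳ _) (trans (sum-cong λ i → *-congˡ (fromℕ-cong (shift i))) (sum-pick (f ∘ suc) j)))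
      (+-identityˡ _)
      where
      shift : ∀ i → count (suc i) (suc j ∷ []) ≡ count i (j ∷ [])
      shift i with i Fin.≟ j
      ... | yes _ = ≡.refl
      ... | no  _ = ≡.refl

  -- Turns the sum over symbols in the definition of δ into a sum over edges, which can then be
  -- dealt out one by one.
  sum-count : ∀ Es → sum (λ E → α E * fromℕ (count E Es)) ≈ weight Es
  sum-count [] = trans (sum-cong λ E → zeroʳ (α E)) (sum-replicate-zero size)
  sum-count (F ∷ Es) = begin
    sum (λ E → α E * fromℕ (count E (F ∷ Es)))
      ≈⟨ sum-cong (λ E → trans (*-congˡ (trans (fromℕ-cong (count-∷ E F Es)) (fromℕ-+ (count E (F ∷ [])) (count E Es)))) (distribˡ _ _ _)) ⟩
    sum (λ E → α E * fromℕ (count E (F ∷ [])) + α E * fromℕ (count E Es))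
      ≈⟨ ∑-distrib-+ (λ E → α E * fromℕ (count E (F ∷ []))) (λ E → α E * fromℕ (count E Es)) ⟩
    sum (λ E → α E * fromℕ (count E (F ∷ []))) + sum (λ E → α E * fromℕ (count E Es))
      ≈⟨ +-cong (sum-pick α F) (sum-count Es) ⟩
    weight (F ∷ Es) ∎
    where open import Relation.Binary.Reasoning.Setoid setoid

module Extension
  (em : ExcludedMiddle 0ℓ) (ℝ : CompleteOrderedField) (L : Language)
  (α : Language.Symbol L → CompleteOrderedField.Carrier ℝ)
  (𝔄 : Structures.Structure L) (n : ℕ)
  {I : Set} (symbol : I → Language.Symbol L)
  (vertices : ∀ t → Vec (Fin (Structures.Structure.card 𝔄 ℕ.+ n)) (Language.arity L (symbol t)))
  (ts : List I)
  (vertices-distinct : ∀ {t} → t ∈ ts → Distinct (vertices t))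
  (ts-unique : Unique ts)
  (edge-injective : ∀ {s t} → s ∈ ts → t ∈ ts → symbol s ≡ symbol t →
                    entries (vertices s) ≡ entries (vertices t) → s ≡ t)
  (edge-meets-new : ∀ {t} → t ∈ ts → ∃ λ z → (Structures.Structure.card 𝔄 ↑ʳ z) ∈ˢ entries (vertices t))
  where
  open CompleteOrderedField ℝ hiding (zero)
  open OrderedField ℝ
  open Solver using (solve; _:=_; _:+_; _:*_; _:-_; :-_; con)
  open Language L
  open Weights ℝ L α
  open Predimension ℝ L α
  open SumProperties +-commutativeMonoid using (∑-distrib-+) renaming (sum-cong-≋ to sum-cong)
  open Structure
  private a = card 𝔄

  edge : I → Subset (a ℕ.+ n)
  edge t = entries (vertices t)

  -- New edges are given as sets, so the relation holds of every repetition-free listing of such a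
  -- set; this makes it symmetric and irreflexive. Excluded middle turns it into a Boolean.
  Related : ∀ E → Vec (Fin (a ℕ.+ n)) (arity E) → Set
  Related E u = (∃ λ u′ → Vec.map (_↑ˡ n) u′ ≡ u × rel 𝔄 E u′ ≡ true)
              ⊎ (Distinct u × ∃ λ t → t ∈ ts × symbol t ≡ E × edge t ≡ entries u)

  private
    Related-permute : ∀ E π {u} → Related E u → Related E (permute π u)
    Related-permute E π (inj₁ (u′ , ≡.refl , r)) =
      inj₁ (permute π u′ , ≡.sym (permute-map (_↑ˡ n) π u′) , ≡.trans (symmetric 𝔄 E π u′) r)
    Related-permute E π {u} (inj₂ (d , t , t∈ , s , e)) =
      inj₂ (distinct-permute π d , t , t∈ , s , ≡.trans e (≡.sym (entries-permute π u)))

    does⇒ : ∀ {P : Set} → does (em {P}) ≡ true → P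
    does⇒ {P} e with em {P}
    ... | yes p = p

    ⇒does : ∀ {P : Set} → P → does (em {P}) ≡ true
    ⇒does {P} p = dec-true em p

  𝔇 : Structure
  𝔇 = record
    { card        = a ℕ.+ n
    ; rel         = λ E u → does (em {Related E u})
    ; symmetric   = λ E π u → does-⇔
        (mk⇔ (λ r → ≡.subst (Related E) (permute-flip π u) (Related-permute E (Permutation.flip π) r))
             (Related-permute E π)) em em
    ; irreflexive = λ E u e → distinct E u (does⇒ e)
    }
    where
    distinct : ∀ E u → Related E u → Distinct u
    distinct E _ (inj₁ (u′ , ≡.refl , r)) = Distinct.map⁺ (λ {x} {y} → Fin.↑ˡ-injective n x y) (irreflexive 𝔄 E u′ r)
    distinct E _ (inj₂ (d , _)) = d

  map-↑ˡ-injective : ∀ {k} (u v : Vec (Fin a) k) → Vec.map (_↑ˡ n) u ≡ Vec.map (_↑ˡ n) v → u ≡ v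
  map-↑ˡ-injective []      []      e = ≡.refl
  map-↑ˡ-injective (x ∷ u) (y ∷ v) e =
    ≡.cong₂ _∷_ (Fin.↑ˡ-injective n x y (Vec.∷-injectiveˡ e)) (map-↑ˡ-injective u v (Vec.∷-injectiveʳ e))

  private
    not-old : ∀ {k t} (u : Vec (Fin a) k) → t ∈ ts → edge t ≢ entries (Vec.map (_↑ˡ n) u)
    not-old u t∈ e with edge-meets-new t∈
    ... | z , z∈ = Subset.∉⊥ (∈-++-↑ʳ⁻ (entries u) (≡.subst (_ ∈ˢ_) (≡.trans e (entries-map-↑ˡ u)) z∈))

  ι : Embedding 𝔄 𝔇
  ι = record
    { to        = _↑ˡ n
    ; injective = λ {x} {y} → Fin.↑ˡ-injective n x y
    ; rel-to    = λ E u → lemma E u (rel 𝔄 E u) ≡.refl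
    }
    where
    from-related : ∀ E u → Related E (Vec.map (_↑ˡ n) u) → rel 𝔄 E u ≡ true
    from-related E u (inj₁ (u′ , e , r)) = ≡.trans (≡.cong (rel 𝔄 E) (≡.sym (map-↑ˡ-injective u′ u e))) r
    from-related E u (inj₂ (_ , t , t∈ , _ , e)) = ⊥-elim (not-old u t∈ e)
    lemma : ∀ E u b → rel 𝔄 E u ≡ b → does (em {Related E (Vec.map (_↑ˡ n) u)}) ≡ rel 𝔄 E u
    lemma E u true  e = ≡.trans (⇒does (inj₁ (u , ≡.refl , e))) (≡.sym e)
    lemma E u false e = ≡.trans (dec-false em λ r → contradiction (≡.trans (≡.sym (from-related E u r)) e) λ ()) (≡.sym e)

  inside? : ∀ S → Decidable (λ t → edge t ⊆ˢ S)
  inside? S t = edge t Subset.⊆? S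

  load : Subset (a ℕ.+ n) → Carrier
  load S = weight (List.map symbol (filter (inside? S) ts))

  -- The sets counted are the old ones inside `Y`, padded by `∅`, and the new edges inside `Y ++ Z`.
  -- The two kinds are disjoint because new edges meet the new vertices, and by `edge-injective`
  -- distinct items of the same symbol count as distinct sets.
  N-++ : ∀ E Y Z → N 𝔇 E (Y ++ Z) ≡ N 𝔄 E Y ℕ.+ count E (List.map symbol (filter (inside? (Y ++ Z)) ts))
  N-++ E Y Z with enumerate (λ X → (X Subset.⊆? Y) ×-dec holdsOn? 𝔄 E X)
  ... | Xs , uXs , iXs , lXs = ≡.trans (#Subsets≡length _ unique members)
    (≡.trans (List.length-++ (List.map (_++ ∅) Xs))
      (≡.cong₂ ℕ._+_ (≡.trans (List.length-map _ Xs) lXs) (≡.trans (List.length-map edge new) (count-map symbol E (filter (inside? S) ts)))))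
    where
    S = Y ++ Z
    new = filter (λ t → E Fin.≟ symbol t) (filter (inside? S) ts)

    new⁻ : ∀ {t} → t ∈ new → t ∈ ts × edge t ⊆ˢ S × E ≡ symbol t
    new⁻ t∈ with ∈-filter⁻ (λ t → E Fin.≟ symbol t) {xs = filter (inside? S) ts} t∈
    ... | t∈′ , e with ∈-filter⁻ (inside? S) {xs = ts} t∈′
    ...   | t∈″ , i = t∈″ , (λ {x} → i {x}) , e

    disjoint : ∀ {X} → ¬ (X ∈ List.map (_++ ∅) Xs × X ∈ List.map edge new)
    disjoint (p , q) with ∈-map⁻ _ p | ∈-map⁻ _ q
    ... | W , _ , ≡.refl | t , t∈ , e with edge-meets-new (proj₁ (new⁻ t∈))
    ...   | z , z∈ = Subset.∉⊥ (∈-++-↑ʳ⁻ W (≡.subst (_ ∈ˢ_) (≡.sym e) z∈))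

    unique : Unique (List.map (_++ ∅) Xs List.++ List.map edge new)
    unique = Unique.++⁺
      (Unique.map⁺ (λ {V} {W} → Vec.++-injectiveˡ V W) uXs)
      (unique-map
        (λ p q → let (p′ , _ , e) = new⁻ p ; (q′ , _ , e′) = new⁻ q in edge-injective p′ q′ (≡.trans (≡.sym e) e′))
        (Unique.filter⁺ (λ t → E Fin.≟ symbol t) (Unique.filter⁺ (inside? S) ts-unique)))
      disjoint

    members : ∀ X → X ∈ List.map (_++ ∅) Xs List.++ List.map edge new ⇔ (X ⊆ˢ S × HoldsOn 𝔇 E X)
    members X = mk⇔ to from
      where
      to : X ∈ List.map (_++ ∅) Xs List.++ List.map edge new → X ⊆ˢ S × HoldsOn 𝔇 E X
      to X∈ with ∈-++⁻ (List.map (_++ ∅) Xs) X∈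
      to X∈ | inj₁ p with ∈-map⁻ _ p
      ... | W , W∈ , ≡.refl with Equivalence.to (iXs W) W∈
      ...   | W⊆Y , u , ≡.refl , r =
        ++-⊆ W⊆Y (λ q → contradiction q Subset.∉⊥) , Vec.map (_↑ˡ n) u , entries-map-↑ˡ u , ⇒does (inj₁ (u , ≡.refl , r))
      to X∈ | inj₂ p with ∈-map⁻ _ p
      ... | t , t∈ , ≡.refl with new⁻ t∈
      ...   | t∈′ , t⊆ , ≡.refl =
        (λ {x} → t⊆ {x}) , vertices t , ≡.refl , ⇒does (inj₂ (vertices-distinct t∈′ , t , t∈′ , ≡.refl , ≡.refl))
      from : X ⊆ˢ S × HoldsOn 𝔇 E X → X ∈ List.map (_++ ∅) Xs List.++ List.map edge new
      from (X⊆S , u , ≡.refl , r) with does⇒ r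
      ... | inj₁ (u′ , ≡.refl , r′) = ∈-++⁺ˡ (≡.subst (_∈ _) (≡.sym (entries-map-↑ˡ u′))
        (∈-map⁺ (_++ ∅) (Equivalence.from (iXs (entries u′))
          ((λ {x} → ++-⊆⁻ˡ {Z = ∅} {Z′ = Z} (≡.subst (_⊆ˢ S) (entries-map-↑ˡ u′) X⊆S) {x}) , u′ , ≡.refl , r′))))
      ... | inj₂ (_ , t , t∈ , ≡.refl , e) = ∈-++⁺ʳ _ (≡.subst (_∈ List.map edge new) e
        (∈-map⁺ edge (∈-filter⁺ (λ t → E Fin.≟ symbol t) (∈-filter⁺ (inside? S) t∈ (λ {x} → ≡.subst (_⊆ˢ S) (≡.sym e) X⊆S {x})) ≡.refl)))

  δ-++ : ∀ Y Z → δ[ 𝔇 ] (Y ++ Z) ≈ δ[ 𝔄 ] Y + (fromℕ ∣ Z ∣ - load (Y ++ Z))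
  δ-++ Y Z = begin
    fromℕ ∣ Y ++ Z ∣ - sum (λ E → α E * fromℕ (N 𝔇 E (Y ++ Z)))
      ≈⟨ +-cong (trans (fromℕ-cong (∣++∣ Y Z)) (fromℕ-+ ∣ Y ∣ ∣ Z ∣)) (-‿cong split) ⟩
    (fromℕ ∣ Y ∣ + fromℕ ∣ Z ∣) - (old + load (Y ++ Z))
      ≈⟨ solve 4 (λ y z o l → (y :+ z) :- (o :+ l) := (y :- o) :+ (z :- l)) refl (fromℕ ∣ Y ∣) (fromℕ ∣ Z ∣) old (load (Y ++ Z)) ⟩
    δ[ 𝔄 ] Y + (fromℕ ∣ Z ∣ - load (Y ++ Z)) ∎
    where
    open import Relation.Binary.Reasoning.Setoid setoid
    old = sum (λ E → α E * fromℕ (N 𝔄 E Y))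
    new = List.map symbol (filter (inside? (Y ++ Z)) ts)
    split : sum (λ E → α E * fromℕ (N 𝔇 E (Y ++ Z))) ≈ old + load (Y ++ Z)
    split = begin
      sum (λ E → α E * fromℕ (N 𝔇 E (Y ++ Z)))
        ≈⟨ sum-cong (λ E → trans (*-congˡ (trans (fromℕ-cong (N-++ E Y Z)) (fromℕ-+ (N 𝔄 E Y) (count E new)))) (distribˡ _ _ _)) ⟩
      sum (λ E → α E * fromℕ (N 𝔄 E Y) + α E * fromℕ (count E new))
        ≈⟨ ∑-distrib-+ (λ E → α E * fromℕ (N 𝔄 E Y)) (λ E → α E * fromℕ (count E new)) ⟩
      old + sum (λ E → α E * fromℕ (count E new))
        ≈⟨ +-congˡ (sum-count new) ⟩
      old + load (Y ++ Z) ∎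

  private
    δ-old : ∀ Y → δ[ 𝔇 ] (Y ++ ∅) ≈ δ[ 𝔄 ] Y
    δ-old Y = trans (δ-++ Y ∅) (trans (+-congˡ (+-cong (fromℕ-cong (Subset.∣⊥∣≡0 n))
      (-‿cong (weight-cong (≡.cong (List.map symbol) (List.filter-none (inside? (Y ++ ∅)) (All.tabulate outside-old)))))))
      (solve 1 (λ d → d :+ (con ℤ.0ℤ :- con ℤ.0ℤ) := d) refl (δ[ 𝔄 ] Y)))
      where
      outside-old : ∀ {t} → t ∈ ts → ¬ edge t ⊆ˢ Y ++ ∅
      outside-old t∈ t⊆ with edge-meets-new t∈
      ... | z , z∈ = Subset.∉⊥ (∈-++-↑ʳ⁻ Y (t⊆ z∈))

    image-ι : Embedding.image ι ≡ ⊤ˢ {a} ++ ∅ {n}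
    image-ι = image-↑ˡ {a} {n}

    δ-image : δ[ 𝔇 ] (Embedding.image ι) ≈ δ 𝔄
    δ-image = trans (reflexive (≡.cong δ[ 𝔇 ] image-ι)) (δ-old ⊤ˢ)

  -- By `δ-++`, the sparsity hypothesis says that δ does not drop from `Y` to any proper `Y ++ Z`.
  -- Taking `Y` full gives minimality, arbitrary `Y` gives essentiality, and with 𝔄 in `Kα` also
  -- nonnegativity. Only at the full set does δ drop, to δ 𝔄 - η, and η ≤ δ 𝔄 keeps that
  -- nonnegative.
  essentialMinimalPair : ∀ {η} → 0# < η → η ≤ δ 𝔄 → Kα 𝔄 →
    weight (List.map symbol ts) ≈ fromℕ n + η →
    (∀ Y Z → Y ++ Z ≢ ⊤ˢ → load (Y ++ Z) ≤ fromℕ ∣ Z ∣) →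
    EssentialMinimalPair ι × δ/ ι ≈ - η
  essentialMinimalPair {η} 0<η η≤δ 𝔄∈Kα total sparse = record
    { 𝔅∈Kα        = 𝔄∈Kα
    ; δ𝔅>0        = <-≤-trans 0<η η≤δ
    ; 𝔇∈Kα        = 𝔇∈Kα
    ; minimalPair = Subset.⊆⊤ , strong , not-strong
    ; essential   = essential
    } , δ/≈-η
    where
    δ-⊤ : δ 𝔇 ≈ δ 𝔄 - η
    δ-⊤ = begin
      δ[ 𝔇 ] ⊤ˢ
        ≈⟨ reflexive (≡.cong δ[ 𝔇 ] (⊤++⊤ {a} {n})) ⟨
      δ[ 𝔇 ] (⊤ˢ {a} ++ ⊤ˢ {n})
        ≈⟨ δ-++ ⊤ˢ ⊤ˢ ⟩
      δ 𝔄 + (fromℕ ∣ ⊤ˢ {n} ∣ - load (⊤ˢ {a} ++ ⊤ˢ {n}))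
        ≈⟨ +-congˡ (+-cong (fromℕ-cong (Subset.∣⊤∣≡n n)) (-‿cong (trans (weight-cong (≡.cong (List.map symbol) everything)) total))) ⟩
      δ 𝔄 + (fromℕ n - (fromℕ n + η))
        ≈⟨ solve 3 (λ d n η → d :+ (n :- (n :+ η)) := d :- η) refl (δ 𝔄) (fromℕ n) η ⟩
      δ 𝔄 - η ∎
      where
      open import Relation.Binary.Reasoning.Setoid setoid
      everything : filter (inside? (⊤ˢ {a} ++ ⊤ˢ {n})) ts ≡ ts
      everything = List.filter-all (inside? (⊤ˢ {a} ++ ⊤ˢ {n})) (All.tabulate λ _ {v} _ → ≡.subst (v ∈ˢ_) (≡.sym (⊤++⊤ {a} {n})) Subset.∈⊤)

    δ/≈-η : δ/ ι ≈ - η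
    δ/≈-η = trans (+-congʳ δ-⊤) (solve 2 (λ d η → (d :- η) :- d := :- η) refl (δ 𝔄) η)

    δ-proper : ∀ Y Z → Y ++ Z ≢ ⊤ˢ → δ[ 𝔄 ] Y ≤ δ[ 𝔇 ] (Y ++ Z)
    δ-proper Y Z p = ≤-trans
      (lin₁ (sparse Y Z p) (solve 3 (λ z d l → z :+ d := l :+ (d :+ (z :- l))) refl (fromℕ ∣ Z ∣) (δ[ 𝔄 ] Y) (load (Y ++ Z))))
      (≤-reflexive (sym (δ-++ Y Z)))

    𝔇∈Kα : Kα 𝔇
    𝔇∈Kα S with Vec.≡-dec Bool._≟_ S ⊤ˢ
    ... | yes ≡.refl = ≤-cong refl (sym δ-⊤) (lin₁ η≤δ (solve 2 (λ d η → d :+ con ℤ.0ℤ := η :+ (d :- η)) refl (δ 𝔄) η))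
    ... | no p with Vec.splitAt a S
    ...   | Y , Z , ≡.refl = ≤-trans (𝔄∈Kα Y) (δ-proper Y Z p)

    proper : ∀ {X : Subset (a ℕ.+ n)} → X ⊂ˢ ⊤ˢ → X ≢ ⊤ˢ
    proper (_ , x , _ , x∉X) ≡.refl = x∉X Subset.∈⊤

    strong : ∀ C → Embedding.image ι ⊆ˢ C → C ⊂ˢ ⊤ˢ → Strong 𝔇 (Embedding.image ι) C
    strong C ι⊆C C⊂⊤ = (λ {x} → ι⊆C {x}) , λ X ι⊆X X⊆C → go X ι⊆X (Subset.⊆-⊂-trans X⊆C C⊂⊤)
      where
      go : ∀ X → Embedding.image ι ⊆ˢ X → X ⊂ˢ ⊤ˢ → δ[ 𝔇 ] (Embedding.image ι) ≤ δ[ 𝔇 ] X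
      go X ι⊆X X⊂⊤ with Vec.splitAt a X
      ... | Y , Z , ≡.refl with Subset.⊆-antisym Subset.⊆⊤ (++-⊆⁻ˡ {Z = ∅} {Z′ = Z} (≡.subst (_⊆ˢ Y ++ Z) image-ι ι⊆X))
      ...   | ≡.refl = ≤-trans (≤-reflexive δ-image) (δ-proper ⊤ˢ Z (proper X⊂⊤))

    not-strong : ¬ Strong 𝔇 (Embedding.image ι) ⊤ˢ
    not-strong (_ , s) = <⇒≱ 0<η
      (lin₁ (≤-cong δ-image δ-⊤ (s ⊤ˢ Subset.⊆⊤ (λ x∈ → x∈)))
        (solve 2 (λ d η → (d :- η) :+ η := d :+ con ℤ.0ℤ) refl (δ 𝔄) η))

    essential : ∀ D′ → D′ ⊂ˢ ⊤ˢ → 0# ≤ δ[ 𝔇 ] D′ / (D′ ∩ˢ Embedding.image ι)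
    essential D′ D′⊂⊤ with Vec.splitAt a D′
    ... | Y , Z , ≡.refl = ≤-cong refl
      (sym (+-cong (reflexive (≡.cong δ[ 𝔇 ] (Subset.∪-abs-∩ (Y ++ Z) (Embedding.image ι))))
                   (-‿cong (trans (reflexive (≡.cong δ[ 𝔇 ] meet)) (δ-old Y)))))
      (lin₁ (δ-proper Y Z (proper D′⊂⊤)) (solve 2 (λ d e → d :+ con ℤ.0ℤ := e :+ (d :- e)) refl (δ[ 𝔇 ] (Y ++ Z)) (δ[ 𝔄 ] Y)))
      where
      meet : (Y ++ Z) ∩ˢ Embedding.image ι ≡ Y ++ ∅
      meet = ≡.trans (≡.cong ((Y ++ Z) ∩ˢ_) image-ι) (≡.trans (Vec.zipWith-++ _ Y Z (⊤ˢ {a}) (∅ {n}))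
        (≡.cong₂ _++_ (Subset.∩-identityʳ Y) (Subset.∩-zeroʳ Z)))

-- Distribution of the edges among the new vertices

module Chunks (ℝ : CompleteOrderedField) (L : Language)
  (α : Language.Symbol L → CompleteOrderedField.Carrier ℝ)
  (η : CompleteOrderedField.Carrier ℝ)
  where
  open CompleteOrderedField ℝ hiding (zero)
  open OrderedField ℝ
  open Solver using (solve; _:=_; _:+_; _:*_; _:-_; :-_; con)
  open Language L
  open Weights ℝ L α

  Chunk : Set
  Chunk = Symbol × List Symbol

  total : Chunk → Carrier
  total (E , c) = α E + weight c

  tail : Chunk → List Symbol
  tail = proj₂

  flatten : ∀ {n} → Vec Chunk n → List Symbol
  flatten []             = []
  flatten ((E , c) ∷ cs) = E ∷ c List.++ flatten cs

  -- A chunk lists the edges owned by one new vertex; s is the number of earlier new vertices minus the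
  -- weight of the edges they own.
  Balanced : ∀ {n} → Carrier → Vec Chunk n → Set
  Balanced s []             = s + η ≈ 0#
  Balanced s ((E , c) ∷ cs) = 0# ≤ s × s + η ≤ α E × Balanced (s + 1# - total (E , c)) cs

  Balanced-cong : ∀ {n s s′} (cs : Vec Chunk n) → s ≈ s′ → Balanced s cs → Balanced s′ cs
  Balanced-cong []       e b = trans (+-congʳ (sym e)) b
  Balanced-cong (_ ∷ cs) e (p , q , b) =
    ≤-cong refl e p , ≤-cong (+-congʳ e) refl q , Balanced-cong cs (+-congʳ (+-congʳ e)) b

  -- No partial weight lies strictly between s + i and s + i + η. The condition passes to the rest
  -- of the list, with s adjusted, both when the current owner takes the next edge and when a new
  -- owner does.
  Spread : Carrier → List Symbol → Set
  Spread s Es = ∀ Fs Gs → Es ≡ Fs List.++ Gs → ∀ i →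
    0# ≤ s + fromℕ i - weight Fs ⊎ (s + fromℕ i - weight Fs) + η ≤ 0#

  private
    Gap : Carrier → Set
    Gap x = 0# ≤ x ⊎ x + η ≤ 0#

    Gap-cong : ∀ {x y} → x ≈ y → Gap x → Gap y
    Gap-cong e = Sum.map (≤-cong refl e) (≤-cong (+-congʳ e) refl)

    Spread-next : ∀ {s E Es} → Spread s (E ∷ Es) → Spread (s + 1# - α E) Es
    Spread-next {s} {E} sp Fs Gs ≡.refl i = Gap-cong
      (solve 5 (λ o s e f i → s :+ (o :+ i) :- (e :+ f) := (s :+ o :- e) :+ i :- f) refl 1# s (α E) (weight Fs) (fromℕ i))
      (sp (E ∷ Fs) Gs ≡.refl (suc i))

    Spread-same : ∀ {s E Es} → Spread s (E ∷ Es) → Spread (s - α E) Es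
    Spread-same {s} {E} sp Fs Gs ≡.refl i = Gap-cong
      (solve 4 (λ s e f i → s :+ i :- (e :+ f) := (s :- e) :+ i :- f) refl s (α E) (weight Fs) (fromℕ i))
      (sp (E ∷ Fs) Gs ≡.refl i)

  module _ (0<η : 0# < η) (α≤1 : ∀ E → α E ≤ 1#) where

    -- `greedy` opens a chunk with first edge E, hence its demand s + η ≤ α E; `fill` lets the
    -- current owner go on. The weight equations count the `suc n` vertices still to be opened.
    -- Since α E ≤ 1, the balance is nonnegative again after the first edge of a chunk.
    greedy : ∀ n {s} E Es → 0# ≤ s → s + η ≤ α E → Spread s (E ∷ Es) →
             weight (E ∷ Es) ≈ s + fromℕ (suc n) + η →
             Σ[ cs ∈ Vec Chunk (suc n) ] Balanced s cs × flatten cs ≡ E ∷ Es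
    fill : ∀ n {s} Es → 0# ≤ s → Spread s Es → weight Es ≈ s + fromℕ (suc n) + η →
           Σ[ c ∈ List Symbol ] Σ[ cs ∈ Vec Chunk (suc n) ] Balanced (s - weight c) cs × c List.++ flatten cs ≡ Es

    -- The last owner takes all remaining edges, and by the weight equation the balance ends at -η.
    greedy zero {s} E Es 0≤s s≤ sp w = (E , Es) ∷ [] , (0≤s , s≤ , end) , ≡.cong (E ∷_) (List.++-identityʳ Es)
      where
      end : (s + 1# - (α E + weight Es)) + η ≈ 0#
      end = trans (+-congʳ (+-congˡ (-‿cong w)))
        (solve 3 (λ o s η → (s :+ o :- (s :+ (o :+ con ℤ.0ℤ) :+ η)) :+ η := con ℤ.0ℤ) refl 1# s η)
    greedy (suc n) {s} E Es 0≤s s≤ sp w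
      with fill n {s + 1# - α E} Es
             (lin₂ 0≤s (α≤1 E) (solve 3 (λ o s e → (s :+ o) :+ con ℤ.0ℤ := (con ℤ.0ℤ :+ e) :+ (s :+ o :- e)) refl 1# s (α E)))
             (Spread-next sp)
             (trans (trans (solve 2 (λ e w → w := (e :+ w) :- e) refl (α E) (weight Es)) (+-congʳ w))
               (solve 5 (λ o s n η e → (s :+ (o :+ (o :+ n)) :+ η) :- e := (s :+ o :- e) :+ (o :+ n) :+ η) refl 1# s (fromℕ n) η (α E)))
    ... | c , cs , b , e = (E , c) ∷ cs
      , (0≤s , s≤ , Balanced-cong cs (solve 4 (λ o s e c → (s :+ o :- e) :- c := s :+ o :- (e :+ c)) refl 1# s (α E) (weight c)) b)
      , ≡.cong (E ∷_) e

    -- The edges cannot run out while vertices remain to be opened: weight at least η is left.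
    fill n {s} [] 0≤s sp w = contradiction
      (lin₃ 0≤s (0≤fromℕ (suc n)) (≤-reflexive (sym w))
        (solve 3 (λ s n η → (s :+ n :+ con ℤ.0ℤ) :+ η := (con ℤ.0ℤ :+ con ℤ.0ℤ :+ (s :+ n :+ η)) :+ con ℤ.0ℤ) refl s (fromℕ (suc n)) η))
      (<⇒≱ 0<η)
    -- The gap condition for the prefix consisting of F alone: either F fits into the balance s, or
    -- s + η ≤ α F and F can open the next chunk.
    fill n {s} (F ∷ Es) 0≤s sp w with sp (F ∷ []) Es ≡.refl 0
    ... | inj₁ p with fill n {s - α F} Es
             (≤-cong refl (solve 2 (λ s f → s :+ con ℤ.0ℤ :- (f :+ con ℤ.0ℤ) := s :- f) refl s (α F)) p)
             (Spread-same sp)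
             (trans (trans (solve 2 (λ e w → w := (e :+ w) :- e) refl (α F) (weight Es)) (+-congʳ w))
               (solve 4 (λ s n η e → (s :+ n :+ η) :- e := (s :- e) :+ n :+ η) refl s (fromℕ (suc n)) η (α F)))
    ...   | c , cs , b , e = F ∷ c , cs
      , Balanced-cong cs (solve 3 (λ s f c → (s :- f) :- c := s :- (f :+ c)) refl s (α F) (weight c)) b
      , ≡.cong (F ∷_) e
    fill n {s} (F ∷ Es) 0≤s sp w | inj₂ p
      with greedy n {s} F Es 0≤s
             (lin₁ p (solve 3 (λ s f η → con ℤ.0ℤ :+ (s :+ η) := ((s :+ con ℤ.0ℤ :- (f :+ con ℤ.0ℤ)) :+ η) :+ f) refl s (α F) η))
             sp w
    ... | cs , b , e = [] , cs , Balanced-cong cs (solve 1 (λ s → s := s :- con ℤ.0ℤ) refl s) b , e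

  Balanced⇒0≤s+η : ∀ {n s} (cs : Vec Chunk n) → 0# ≤ η → Balanced s cs → 0# ≤ s + η
  Balanced⇒0≤s+η []       0≤η b           = ≤-reflexive (sym b)
  Balanced⇒0≤s+η (_ ∷ cs) 0≤η (0≤s , _ , _) = ≤-cong (+-identityˡ 0#) refl (+-mono-≤ 0≤s 0≤η)

  -- The next balance s + 1 - α E - w is at least -η, where w is the weight of the tail, and s + η ≤
  -- α E; adding these gives w ≤ 1. This bounds the number of edges of an owner.
  weight-tail≤1 : ∀ {n s} (cs : Vec Chunk n) → 0# ≤ η → Balanced s cs → ∀ i → weight (tail (Vec.lookup cs i)) ≤ 1#
  weight-tail≤1 {s = s} ((E , c) ∷ cs) 0≤η (_ , p , b) zero =
    lin₂ p (Balanced⇒0≤s+η cs 0≤η b)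
      (solve 5 (λ o s e c η → (e :+ ((s :+ o :- (e :+ c)) :+ η)) :+ c := ((s :+ η) :+ con ℤ.0ℤ) :+ o) refl 1# s (α E) (weight c) η)
  weight-tail≤1 (_ ∷ cs) 0≤η (_ , _ , b) (suc i) = weight-tail≤1 cs 0≤η b i

  -- In what follows `ω i` stands for the weight of the edges owned by `i` that lie in a subset with
  -- trace `Z` on the new vertices. A vertex whose predecessor is absent keeps at most its tail.
  FirstLost : ∀ {n} → Vec Chunk n → (Fin n → Carrier) → Set
  FirstLost []       ω = ⊤
  FirstLost (c ∷ cs) ω = ω zero ≤ weight (tail c)

  Bounded : ∀ {n} → Vec Chunk n → Subset n → (Fin n → Carrier) → Set
  Bounded []       []      ω = ⊤
  Bounded (c ∷ cs) (z ∷ Z) ω =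
    (z ≡ outside → ω zero ≤ 0# × FirstLost cs (ω ∘ suc)) × ω zero ≤ total c × Bounded cs Z (ω ∘ suc)

  bounded : ∀ {n} (cs : Vec Chunk n) Z (ω : Fin n → Carrier) →
    (∀ i → i ∉ˢ Z → ω i ≤ 0#) → (∀ i → ω i ≤ total (Vec.lookup cs i)) →
    (∀ i j → toℕ j ≡ suc (toℕ i) → i ∉ˢ Z → ω j ≤ weight (tail (Vec.lookup cs j))) →
    Bounded cs Z ω
  bounded [] [] ω p q r = tt
  bounded (c ∷ cs) (z ∷ Z) ω p q r =
    (λ { ≡.refl → p zero (λ ()) , lost cs (ω ∘ suc) λ j e → r zero (suc j) (≡.cong suc e) (λ ()) })
    , q zero
    , bounded cs Z (ω ∘ suc) (λ i i∉ → p (suc i) (i∉ ∘ Subset.drop-there)) (q ∘ suc)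
        (λ i j e i∉ → r (suc i) (suc j) (≡.cong suc e) (i∉ ∘ Subset.drop-there))
    where
    lost : ∀ {n} (cs : Vec Chunk n) (ω : Fin n → Carrier) → (∀ j → toℕ j ≡ 0 → ω j ≤ weight (tail (Vec.lookup cs j))) → FirstLost cs ω
    lost []      ω r = tt
    lost (_ ∷ _) ω r = r zero ≡.refl

  module _ (0≤η : 0# ≤ η) where

    -- A present vertex that follows an absent one loses its first edge, of weight at least s + η, and this
    -- pays for the deficit -η with which the balance ends.
    sum≤after-present : ∀ {n s} (cs : Vec Chunk n) Z ω → Balanced s cs → Bounded cs Z ω → sum ω ≤ fromℕ ∣ Z ∣ + (s + η)
    sum≤after-absent : ∀ {n s} (cs : Vec Chunk n) Z ω → Balanced s cs → Bounded cs Z ω → FirstLost cs ω → sum ω ≤ fromℕ ∣ Z ∣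

    sum≤after-present [] [] ω b _ = ≤-reflexive (sym (trans (+-identityˡ _) b))
    sum≤after-present {s = s} (c ∷ cs) (outside ∷ Z) ω (0≤s , _ , b) (p , _ , r) with p ≡.refl
    ... | ω≤0 , fl = lin₃ ω≤0 (sum≤after-absent cs Z (ω ∘ suc) b r fl) (+-mono-≤ 0≤s 0≤η)
      (solve 5 (λ w v z s η → (con ℤ.0ℤ :+ z :+ (s :+ η)) :+ (w :+ v) := (w :+ v :+ (con ℤ.0ℤ :+ con ℤ.0ℤ)) :+ (z :+ (s :+ η)))
        refl (ω zero) (sum (ω ∘ suc)) (fromℕ ∣ Z ∣) s η)
    sum≤after-present {s = s} (c ∷ cs) (inside ∷ Z) ω (_ , _ , b) (_ , q , r) =
      lin₂ q (sum≤after-present cs Z (ω ∘ suc) b r)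
        (solve 7 (λ o w v z s η t → (t :+ (z :+ ((s :+ o :- t) :+ η))) :+ (w :+ v) := (w :+ v) :+ ((o :+ z) :+ (s :+ η)))
          refl 1# (ω zero) (sum (ω ∘ suc)) (fromℕ ∣ Z ∣) s η (total c))

    sum≤after-absent [] [] ω b _ _ = ≤-refl
    sum≤after-absent (c ∷ cs) (outside ∷ Z) ω (_ , _ , b) (p , _ , r) _ with p ≡.refl
    ... | ω≤0 , fl = ≤-cong refl (+-identityˡ _) (+-mono-≤ ω≤0 (sum≤after-absent cs Z (ω ∘ suc) b r fl))
    sum≤after-absent {s = s} ((E , c) ∷ cs) (inside ∷ Z) ω (_ , h , b) (_ , _ , r) ω≤c =
      lin₃ ω≤c (sum≤after-present cs Z (ω ∘ suc) b r) h
        (solve 8 (λ o w v z s η e c → (c :+ (z :+ ((s :+ o :- (e :+ c)) :+ η)) :+ e) :+ (w :+ v) := (w :+ v :+ (s :+ η)) :+ (o :+ z))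
          refl 1# (ω zero) (sum (ω ∘ suc)) (fromℕ ∣ Z ∣) s η (α E) (weight c))

    -- Up to the first absent vertex the balance telescopes; from there on `sum≤after-absent`
    -- applies, so the deficit η at the end of the chunks does no harm. The balance s in the bound
    -- is 0 at the start.
    sum≤with-gap : ∀ {n s} (cs : Vec Chunk n) Z ω → Balanced s cs → Bounded cs Z ω → Z ≢ ⊤ˢ → sum ω ≤ fromℕ ∣ Z ∣ + s
    sum≤with-gap [] [] ω b _ Z≢⊤ = contradiction ≡.refl Z≢⊤
    sum≤with-gap {s = s} (c ∷ cs) (outside ∷ Z) ω (0≤s , _ , b) (p , _ , r) _ with p ≡.refl
    ... | ω≤0 , fl = lin₃ ω≤0 (sum≤after-absent cs Z (ω ∘ suc) b r fl) 0≤s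
      (solve 4 (λ w v z s → (con ℤ.0ℤ :+ z :+ s) :+ (w :+ v) := (w :+ v :+ con ℤ.0ℤ) :+ (z :+ s))
        refl (ω zero) (sum (ω ∘ suc)) (fromℕ ∣ Z ∣) s)
    sum≤with-gap {s = s} (c ∷ cs) (inside ∷ Z) ω (_ , _ , b) (_ , q , r) Z≢⊤ =
      lin₂ q (sum≤with-gap cs Z (ω ∘ suc) b r λ { ≡.refl → Z≢⊤ ≡.refl })
        (solve 6 (λ o w v z s t → (t :+ (z :+ (s :+ o :- t))) :+ (w :+ v) := (w :+ v) :+ ((o :+ z) :+ s))
          refl 1# (ω zero) (sum (ω ∘ suc)) (fromℕ ∣ Z ∣) s (total c))

-- The edges

prev : ∀ {m} → Fin (suc m) → Fin (suc m)
prev zero    = Fin.fromℕ _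
prev (suc i) = Fin.inject₁ i

back : ∀ {m} → Fin (suc m) → ℕ → Fin (suc m)
back i zero    = i
back i (suc d) = prev (back i d)

prev-toℕ : ∀ {m} (i : Fin (suc m)) → ∃ λ k → toℕ (prev i) ℕ.+ 1 ≡ toℕ i ℕ.+ k ℕ.* suc m
prev-toℕ {m} zero    = 1 , (begin
  toℕ (Fin.fromℕ m) ℕ.+ 1 ≡⟨ ≡.cong (ℕ._+ 1) (Fin.toℕ-fromℕ m) ⟩
  m ℕ.+ 1                 ≡⟨ ℕ.+-comm m 1 ⟩
  suc m                   ≡⟨ ℕ.*-identityˡ (suc m) ⟨
  1 ℕ.* suc m             ∎)
  where open ≡.≡-Reasoning
prev-toℕ (suc i) = 0 , ≡.trans (ℕ.+-comm _ 1) (≡.trans (≡.cong suc (Fin.toℕ-inject₁ i)) (≡.sym (ℕ.+-identityʳ _)))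

-- `back i d` is i - d modulo `suc m`; the multiple k accounts for wrapping around and avoids
-- subtraction.
back-toℕ : ∀ {m} (i : Fin (suc m)) d → ∃ λ k → toℕ (back i d) ℕ.+ d ≡ toℕ i ℕ.+ k ℕ.* suc m
back-toℕ i zero = 0 , ≡.refl
back-toℕ {m} i (suc d) with prev-toℕ (back i d) | back-toℕ i d
... | k , e | l , f = k ℕ.+ l , (begin
  p ℕ.+ suc d                          ≡⟨ ℕ.+-assoc p 1 d ⟨
  (p ℕ.+ 1) ℕ.+ d                      ≡⟨ ≡.cong (ℕ._+ d) e ⟩
  (b ℕ.+ k ℕ.* suc m) ℕ.+ d            ≡⟨ +-swapʳ b (k ℕ.* suc m) d ⟩
  (b ℕ.+ d) ℕ.+ k ℕ.* suc m            ≡⟨ ≡.cong (ℕ._+ k ℕ.* suc m) f ⟩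
  (toℕ i ℕ.+ l ℕ.* suc m) ℕ.+ k ℕ.* suc m ≡⟨ +-swapʳ (toℕ i) (l ℕ.* suc m) (k ℕ.* suc m) ⟩
  (toℕ i ℕ.+ k ℕ.* suc m) ℕ.+ l ℕ.* suc m ≡⟨ ℕ.+-assoc (toℕ i) _ _ ⟩
  toℕ i ℕ.+ (k ℕ.* suc m ℕ.+ l ℕ.* suc m) ≡⟨ ≡.cong (toℕ i ℕ.+_) (ℕ.*-distribʳ-+ (suc m) k l) ⟨
  toℕ i ℕ.+ (k ℕ.+ l) ℕ.* suc m        ∎)
  where
  open ≡.≡-Reasoning
  b = toℕ (back i d)
  p = toℕ (back i (suc d))
  +-swapʳ : ∀ x y z → (x ℕ.+ y) ℕ.+ z ≡ (x ℕ.+ z) ℕ.+ y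
  +-swapʳ = solve-∀

back-injective : ∀ {m} (i : Fin (suc m)) {d d′} → d ℕ.≤ m → d′ ℕ.≤ m → back i d ≡ back i d′ → d ≡ d′
back-injective {m} i {d} {d′} d≤ d′≤ e with back-toℕ i d | back-toℕ i d′
... | k , f | l , g = begin
  d                          ≡⟨ m<n⇒m%n≡m (s≤s d≤) ⟨
  d % suc m                  ≡⟨ [m+kn]%n≡m%n d l (suc m) ⟨
  (d ℕ.+ l ℕ.* suc m) % suc m ≡⟨ ≡.cong (_% suc m) (ℕ.+-cancelˡ-≡ (b ℕ.+ toℕ i) _ _ same) ⟩
  (d′ ℕ.+ k ℕ.* suc m) % suc m ≡⟨ [m+kn]%n≡m%n d′ k (suc m) ⟩
  d′ % suc m                 ≡⟨ m<n⇒m%n≡m (s≤s d′≤) ⟩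
  d′                         ∎
  where
  open ≡.≡-Reasoning
  b = toℕ (back i d)
  +-interchange : ∀ x y z w → (x ℕ.+ y) ℕ.+ (z ℕ.+ w) ≡ (x ℕ.+ z) ℕ.+ (y ℕ.+ w)
  +-interchange = solve-∀
  same : (b ℕ.+ toℕ i) ℕ.+ (d ℕ.+ l ℕ.* suc m) ≡ (b ℕ.+ toℕ i) ℕ.+ (d′ ℕ.+ k ℕ.* suc m)
  same = begin
    (b ℕ.+ toℕ i) ℕ.+ (d ℕ.+ l ℕ.* suc m)   ≡⟨ +-interchange b (toℕ i) d _ ⟩
    (b ℕ.+ d) ℕ.+ (toℕ i ℕ.+ l ℕ.* suc m)   ≡⟨ ≡.cong₂ ℕ._+_ f (≡.trans (≡.sym g) (≡.cong (λ x → toℕ x ℕ.+ d′) (≡.sym e))) ⟩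
    (toℕ i ℕ.+ k ℕ.* suc m) ℕ.+ (b ℕ.+ d′)  ≡⟨ ℕ.+-comm _ (b ℕ.+ d′) ⟩
    (b ℕ.+ d′) ℕ.+ (toℕ i ℕ.+ k ℕ.* suc m)  ≡⟨ +-interchange b d′ (toℕ i) _ ⟩
    (b ℕ.+ toℕ i) ℕ.+ (d′ ℕ.+ k ℕ.* suc m)  ∎

-- Going d back from j and then d′ back from i returns to j, so d + d′ is a multiple of the cycle
-- length `suc m`; being at most m, it is 0.
back-antisym : ∀ {m} (i j : Fin (suc m)) d d′ → d ℕ.+ d′ ℕ.≤ m → back j d ≡ i → back i d′ ≡ j → i ≡ j
back-antisym {m} i j d d′ d+d′≤m ≡.refl e with back-toℕ j d | back-toℕ i d′
... | k , f | l , g = ≡.cong (back j) (ℕ.m+n≡0⇒m≡0 d (d+d′≡0 (k ℕ.+ l) sum))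
  where
  open ≡.≡-Reasoning
  x = toℕ i
  y = toℕ j
  d+d′≡0 : ∀ q → d ℕ.+ d′ ≡ q ℕ.* suc m → d ℕ.+ d′ ≡ 0
  d+d′≡0 zero    e = e
  d+d′≡0 (suc q) e = contradiction (ℕ.≤-trans (ℕ.m≤m+n (suc m) _) (ℕ.≤-trans (ℕ.≤-reflexive (≡.sym e)) d+d′≤m)) ℕ.1+n≰n
  g′ : y ℕ.+ d′ ≡ x ℕ.+ l ℕ.* suc m
  g′ = ≡.trans (≡.cong (λ z → toℕ z ℕ.+ d′) (≡.sym e)) g
  rearrange₁ : ∀ x y d d′ → (x ℕ.+ y) ℕ.+ (d ℕ.+ d′) ≡ (x ℕ.+ d) ℕ.+ (y ℕ.+ d′)
  rearrange₁ = solve-∀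
  rearrange₂ : ∀ x y k l m → (y ℕ.+ k ℕ.* m) ℕ.+ (x ℕ.+ l ℕ.* m) ≡ (x ℕ.+ y) ℕ.+ (k ℕ.+ l) ℕ.* m
  rearrange₂ = solve-∀
  sum : d ℕ.+ d′ ≡ (k ℕ.+ l) ℕ.* suc m
  sum = ℕ.+-cancelˡ-≡ (x ℕ.+ y) _ _ (begin
    (x ℕ.+ y) ℕ.+ (d ℕ.+ d′)                         ≡⟨ rearrange₁ x y d d′ ⟩
    (x ℕ.+ d) ℕ.+ (y ℕ.+ d′)                         ≡⟨ ≡.cong₂ ℕ._+_ f g′ ⟩
    (y ℕ.+ k ℕ.* suc m) ℕ.+ (x ℕ.+ l ℕ.* suc m)      ≡⟨ rearrange₂ x y k l (suc m) ⟩
    (x ℕ.+ y) ℕ.+ (k ℕ.+ l) ℕ.* suc m                ∎)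

unique-lookup-injective : ∀ {A : Set} {xs : List A} → Unique xs → ∀ i j → List.lookup xs i ≡ List.lookup xs j → i ≡ j
unique-lookup-injective (x∉ ∷ u) zero    zero    e = ≡.refl
unique-lookup-injective (x∉ ∷ u) zero    (suc j) e = contradiction e (All.lookup x∉ (∈-lookup j))
unique-lookup-injective (x∉ ∷ u) (suc i) zero    e = contradiction (≡.sym e) (All.lookup x∉ (∈-lookup i))
unique-lookup-injective (x∉ ∷ u) (suc i) (suc j) e = ≡.cong suc (unique-lookup-injective u i j e)

-- Numbered edges, and elements of 𝔄 as tags

module Items (ℝ : CompleteOrderedField) (L : Language)
  (α : Language.Symbol L → CompleteOrderedField.Carrier ℝ)
  (η : CompleteOrderedField.Carrier ℝ)
  where
  open CompleteOrderedField ℝ hiding (zero)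
  open OrderedField ℝ
  open Language L
  open Weights ℝ L α
  open Chunks ℝ L α η

  -- Owner, position among the edges of the owner, symbol.
  Item : ℕ → Set
  Item n = Fin n × ℕ × Symbol

  symbol : ∀ {n} → Item n → Symbol
  symbol (_ , _ , E) = E

  number : ∀ {n} → Fin n → ℕ → List Symbol → List (Item n)
  number i p []       = []
  number i p (E ∷ Es) = (i , p , E) ∷ number i (suc p) Es

  itemsOf : ∀ {n} → Fin n → Chunk → List (Item n)
  itemsOf i (E , c) = number i 0 (E ∷ c)

  items : ∀ {k n} → (Fin k → Fin n) → Vec Chunk k → List (Item n)
  items f []       = []
  items f (c ∷ cs) = itemsOf (f zero) c List.++ items (f ∘ suc) cs

  map-symbol-number : ∀ {n} (i : Fin n) p Es → List.map symbol (number i p Es) ≡ Es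
  map-symbol-number i p []       = ≡.refl
  map-symbol-number i p (E ∷ Es) = ≡.cong (E ∷_) (map-symbol-number i (suc p) Es)

  map-symbol-items : ∀ {k n} (f : Fin k → Fin n) cs → List.map symbol (items f cs) ≡ flatten cs
  map-symbol-items f []             = ≡.refl
  map-symbol-items f ((E , c) ∷ cs) = ≡.trans (List.map-++ symbol (itemsOf (f zero) (E , c)) (items (f ∘ suc) cs))
    (≡.cong₂ List._++_ (map-symbol-number (f zero) 0 (E ∷ c)) (map-symbol-items (f ∘ suc) cs))

  ∈-number⁻ : ∀ {n} {i j : Fin n} {p q E} Es → (j , q , E) ∈ number i p Es → j ≡ i × p ℕ.≤ q × q ℕ.< p ℕ.+ length Es
  ∈-number⁻ (_ ∷ Es) (here ≡.refl) = ≡.refl , ℕ.≤-refl , ℕ.m<m+n _ ℕ.z<s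
  ∈-number⁻ {p = p} (_ ∷ Es) (there t∈) with ∈-number⁻ Es t∈
  ... | e , p≤q , q< = e , ℕ.<⇒≤ p≤q , ℕ.≤-trans q< (ℕ.≤-reflexive (≡.sym (ℕ.+-suc p (length Es))))

  ∈-items⁻ : ∀ {k n} (f : Fin k → Fin n) cs {j q E} → (j , q , E) ∈ items f cs →
             ∃ λ i → j ≡ f i × q ℕ.≤ length (tail (Vec.lookup cs i))
  ∈-items⁻ f ((E , c) ∷ cs) t∈ with ∈-++⁻ (itemsOf (f zero) (E , c)) t∈
  ... | inj₁ p with ∈-number⁻ (E ∷ c) p
  ...   | e , _ , q< = zero , e , ℕ.s≤s⁻¹ q<
  ∈-items⁻ f (_ ∷ cs) t∈ | inj₂ p with ∈-items⁻ (f ∘ suc) cs p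
  ...   | i , e , q≤ = suc i , e , q≤

  number-unique : ∀ {n} (i : Fin n) p Es → Unique (number i p Es)
  number-unique i p []       = []
  number-unique i p (E ∷ Es) =
    All.tabulate (λ { t∈ ≡.refl → ℕ.1+n≰n (proj₁ (proj₂ (∈-number⁻ Es t∈))) }) ∷ number-unique i (suc p) Es

  items-unique : ∀ {k n} (f : Fin k → Fin n) → (∀ {i j} → f i ≡ f j → i ≡ j) → ∀ cs → Unique (items f cs)
  items-unique f inj []             = []
  items-unique f inj ((E , c) ∷ cs) = Unique.++⁺ (number-unique (f zero) 0 (E ∷ c))
    (items-unique (f ∘ suc) (Fin.suc-injective ∘ inj) cs) disjoint
    where
    disjoint : ∀ {t} → ¬ (t ∈ number (f zero) 0 (E ∷ c) × t ∈ items (f ∘ suc) cs)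
    disjoint (t∈ , t∈′) with ∈-number⁻ (E ∷ c) t∈ | ∈-items⁻ (f ∘ suc) cs t∈′
    ... | ≡.refl , _ | i , e , _ = contradiction (inj e) λ ()

  -- Every owner has exactly one item in position 0.
  count-later-items : ∀ {k n} (f : Fin k → Fin n) cs →
    k ℕ.+ length (filter (λ t → 1 ℕ.≤? proj₁ (proj₂ t)) (items f cs)) ≡ length (flatten cs)
  count-later-items f [] = ≡.refl
  count-later-items {suc k} f ((E , c) ∷ cs) = ≡.cong suc (begin
    k ℕ.+ length (filter later (number (f zero) 1 c List.++ items (f ∘ suc) cs))
      ≡⟨ ≡.cong (λ xs → k ℕ.+ length xs) (List.filter-++ later (number (f zero) 1 c) (items (f ∘ suc) cs)) ⟩
    k ℕ.+ length (filter later (number (f zero) 1 c) List.++ rest)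
      ≡⟨ ≡.cong (λ xs → k ℕ.+ length (xs List.++ rest)) (List.filter-all later (All.tabulate λ t∈ → proj₁ (proj₂ (∈-number⁻ c t∈)))) ⟩
    k ℕ.+ length (number (f zero) 1 c List.++ rest)
      ≡⟨ ≡.cong (k ℕ.+_) (List.length-++ (number (f zero) 1 c)) ⟩
    k ℕ.+ (length (number (f zero) 1 c) ℕ.+ length rest)
      ≡⟨ ≡.cong (λ l → k ℕ.+ (l ℕ.+ length rest)) (≡.trans (≡.sym (List.length-map symbol (number (f zero) 1 c))) (≡.cong length (map-symbol-number (f zero) 1 c))) ⟩
    k ℕ.+ (length c ℕ.+ length rest)
      ≡⟨ swap k (length c) (length rest) ⟩
    length c ℕ.+ (k ℕ.+ length rest)
      ≡⟨ ≡.cong (length c ℕ.+_) (count-later-items (f ∘ suc) cs) ⟩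
    length c ℕ.+ length (flatten cs)
      ≡⟨ List.length-++ c ⟨
    length (c List.++ flatten cs) ∎)
    where
    open ≡.≡-Reasoning
    later : ∀ {n} → Decidable {A = Item n} (λ t → 1 ℕ.≤ proj₁ (proj₂ t))
    later t = 1 ℕ.≤? proj₁ (proj₂ t)
    rest = filter later (items (f ∘ suc) cs)
    swap : ∀ x y z → x ℕ.+ (y ℕ.+ z) ≡ y ℕ.+ (x ℕ.+ z)
    swap = solve-∀

  weight-filter-items : ∀ {k n} {P : Pred (Item n) 0ℓ} (P? : Decidable P) (f : Fin k → Fin n) cs →
    weight (List.map symbol (filter P? (items f cs))) ≈
    sum (λ i → weight (List.map symbol (filter P? (itemsOf (f i) (Vec.lookup cs i)))))
  weight-filter-items P? f []       = refl
  weight-filter-items P? f (c ∷ cs) = trans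
    (weight-cong (≡.trans (≡.cong (List.map symbol) (List.filter-++ P? (itemsOf (f zero) c) (items (f ∘ suc) cs)))
                          (List.map-++ symbol (filter P? (itemsOf (f zero) c)) _)))
    (trans (weight-++ (List.map symbol (filter P? (itemsOf (f zero) c))) _) (+-congˡ (weight-filter-items P? (f ∘ suc) cs)))

  module _ (0<α : ∀ E → 0# < α E) {I : Set} (symbolᵢ : I → Symbol) {P : Pred I 0ℓ} (P? : Decidable P) where

    weight-filter≤ : ∀ xs → weight (List.map symbolᵢ (filter P? xs)) ≤ weight (List.map symbolᵢ xs)
    weight-filter≤ [] = ≤-refl
    weight-filter≤ (x ∷ xs) with does (P? x)
    ... | true  = +-mono-≤ ≤-refl (weight-filter≤ xs)
    ... | false = ≤-cong (+-identityˡ _) refl (+-mono-≤ (proj₁ (0<α (symbolᵢ x))) (weight-filter≤ xs))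

    weight-filter-drop : ∀ {x xs} → x ∈ xs → ¬ P x →
      weight (List.map symbolᵢ (filter P? xs)) + α (symbolᵢ x) ≤ weight (List.map symbolᵢ xs)
    weight-filter-drop {x} {.x ∷ xs} (here ≡.refl) ¬p with P? x
    ... | yes p = contradiction p ¬p
    ... | no _  = ≤-cong (+-comm _ _) refl (+-mono-≤ ≤-refl (weight-filter≤ xs))
    weight-filter-drop {x} {y ∷ xs} (there x∈) ¬p with does (P? y)
    ... | true  = ≤-cong (sym (+-assoc _ _ _)) refl (+-mono-≤ ≤-refl (weight-filter-drop x∈ ¬p))
    ... | false = ≤-cong (+-identityˡ _) refl (+-mono-≤ (proj₁ (0<α (symbolᵢ y))) (weight-filter-drop x∈ ¬p))

  -- An edge in position 0 has to keep the predecessor of its owner, so it can take up an element of 𝔄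
  -- only if there is room for a third vertex.
  record Tagging {n} (a : ℕ) (ts : List (Item n)) : Set where
    field
      tag           : Item n → Maybe (Fin a)
      tag-injective : ∀ {s t x} → tag s ≡ just x → tag t ≡ just x → s ≡ t
      tag-covers    : ∀ x → ∃ λ t → t ∈ ts × tag t ≡ just x
      tag-special   : ∀ {i p E x} → tag (i , p , E) ≡ just x → 1 ℕ.≤ p ⊎ 3 ℕ.≤ arity E

  -- The element x of 𝔄 becomes the tag of the x-th item satisfying `P`.
  tagging : ExcludedMiddle 0ℓ → ∀ {n} a (ts : List (Item n)) → Unique ts →
    {P : Pred (Item n) 0ℓ} (P? : Decidable P) → (∀ {i p E} → P (i , p , E) → 1 ℕ.≤ p ⊎ 3 ℕ.≤ arity E) →
    a ℕ.≤ length (filter P? ts) → Tagging a ts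
  tagging em {n} a ts uts {P} P? special a≤ = record
    { tag           = tag
    ; tag-injective = λ p q → ≡.trans (≡.sym (tag⁻ p)) (tag⁻ q)
    ; tag-covers    = λ x → g x , proj₁ (g∈ x) , tag-g x
    ; tag-special   = λ {i} {p} {E} {x} e → special (≡.subst P (tag⁻ e) (proj₂ (g∈ x)))
    }
    where
    g : Fin a → Item n
    g x = List.lookup (filter P? ts) (Fin.inject≤ x a≤)
    g∈ : ∀ x → g x ∈ ts × P (g x)
    g∈ x = ∈-filter⁻ P? {xs = ts} (∈-lookup (Fin.inject≤ x a≤))
    g-injective : ∀ {x y} → g x ≡ g y → x ≡ y
    g-injective e = Fin.inject≤-injective a≤ a≤ _ _ (unique-lookup-injective (Unique.filter⁺ P? uts) _ _ e)
    tag : Item n → Maybe (Fin a)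
    tag t with em {∃ λ x → g x ≡ t}
    ... | yes (x , _) = just x
    ... | no _        = nothing
    tag⁻ : ∀ {t x} → tag t ≡ just x → g x ≡ t
    tag⁻ {t} e with em {∃ λ x → g x ≡ t}
    tag⁻ ≡.refl | yes (x , f) = f
    tag-g : ∀ x → tag (g x) ≡ just x
    tag-g x with em {∃ λ y → g y ≡ g x}
    ... | yes (y , e) = ≡.cong just (g-injective e)
    ... | no ¬p       = contradiction (x , ≡.refl) ¬p

-- Placing the edges on the cycle of new vertices

module Edges
  (ℝ : CompleteOrderedField) (L : Language)
  (α : Language.Symbol L → CompleteOrderedField.Carrier ℝ)
  (η : CompleteOrderedField.Carrier ℝ)
  {a m : ℕ} (K : ℕ) (2K≤m : K ℕ.+ K ℕ.≤ m)
  (ts : List (Items.Item ℝ L α η (suc m)))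
  (short : ∀ {i p E} → (i , p , E) ∈ ts → Language.arity L E ℕ.+ p ℕ.≤ K)
  (T : Items.Tagging ℝ L α η a ts)
  where
  open Language L
  open Items ℝ L α η
  open Tagging T

  -- The edge of (i , p , E), of arity r, consists of the new vertices at cyclic distances 0, …, r - 2
  -- behind i and one more vertex: the tag in 𝔄, or else the new vertex at distance r - 1 + p.
  slot₀ : Maybe (Fin a) → Item (suc m) → Fin (a ℕ.+ suc m)
  slot₀ (just x) _           = x ↑ˡ suc m
  slot₀ nothing  (i , p , E) = a ↑ʳ back i (ℕ.pred (arity E) ℕ.+ p)

  slot : Item (suc m) → ℕ → Fin (a ℕ.+ suc m)
  slot t           zero    = slot₀ (tag t) t
  slot (i , _ , _) (suc j) = a ↑ʳ back i j

  vertices : ∀ t → Vec (Fin (a ℕ.+ suc m)) (arity (symbol t))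
  vertices t = Vec.tabulate (slot t ∘ toℕ)

  edge : Item (suc m) → Subset (a ℕ.+ suc m)
  edge t = entries (vertices t)

  slot∈edge : ∀ t {j} → j ℕ.< arity (symbol t) → slot t j ∈ˢ edge t
  slot∈edge t {j} j< = ≡.subst (λ k → slot t k ∈ˢ edge t) (Fin.toℕ-fromℕ< j<) (∈-entries-tabulate⁺ (slot t ∘ toℕ) (Fin.fromℕ< j<))

  owner∈edge : ∀ i p E → (a ↑ʳ i) ∈ˢ edge (i , p , E)
  owner∈edge i p E = slot∈edge (i , p , E) {1} (2≤arity E)

  edge-meets-new : ∀ {t} → t ∈ ts → ∃ λ z → (a ↑ʳ z) ∈ˢ edge t
  edge-meets-new {i , p , E} _ = i , owner∈edge i p E

  old∈edge⁻ : ∀ t {x} → (x ↑ˡ suc m) ∈ˢ edge t → tag t ≡ just x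
  old∈edge⁻ t {x} x∈ with ∈-entries-tabulate⁻ {k = arity (symbol t)} (slot t ∘ toℕ) x∈
  ... | j , e = go (toℕ j) e
    where
    go₀ : ∀ y → slot₀ y t ≡ x ↑ˡ suc m → y ≡ just x
    go₀ (just y) e = ≡.cong just (Fin.↑ˡ-injective (suc m) y x e)
    go₀ nothing  e = contradiction (≡.sym e) ↑ˡ≢↑ʳ
    go : ∀ j → slot t j ≡ x ↑ˡ suc m → tag t ≡ just x
    go zero    e = go₀ (tag t) e
    go (suc j) e = contradiction (≡.sym e) ↑ˡ≢↑ʳ

  new∈edge⁻ : ∀ i p E {z} → (a ↑ʳ z) ∈ˢ edge (i , p , E) →
              ∃ λ d → back i d ≡ z × (2 ℕ.+ d ℕ.≤ arity E ⊎ d ≡ ℕ.pred (arity E) ℕ.+ p)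
  new∈edge⁻ i p E {z} z∈ with ∈-entries-tabulate⁻ (slot (i , p , E) ∘ toℕ) z∈
  ... | j , e = go (toℕ j) (Fin.toℕ<n j) e
    where
    t : Item (suc m)
    t = i , p , E
    go₀ : ∀ y → slot₀ y t ≡ a ↑ʳ z → back i (ℕ.pred (arity E) ℕ.+ p) ≡ z
    go₀ (just y) e = contradiction e ↑ˡ≢↑ʳ
    go₀ nothing  e = Fin.↑ʳ-injective a _ _ e
    go : ∀ j → j ℕ.< arity E → slot t j ≡ a ↑ʳ z → _
    go zero    _  e = _ , go₀ (tag t) e , inj₂ ≡.refl
    go (suc d) d< e = d , Fin.↑ʳ-injective a _ _ e , inj₁ d<

  private
    1+pred : ∀ E → suc (ℕ.pred (arity E)) ≡ arity E
    1+pred E = ℕ.suc-pred (arity E) {{ℕ.>-nonZero (ℕ.<⇒≤ (2≤arity E))}}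

    offset<K : ∀ {i p E d} → (i , p , E) ∈ ts → 2 ℕ.+ d ℕ.≤ arity E ⊎ d ≡ ℕ.pred (arity E) ℕ.+ p → d ℕ.< K
    offset<K {p = p} {E} t∈ (inj₁ q) = ℕ.≤-trans (ℕ.<⇒≤ q) (ℕ.≤-trans (ℕ.m≤m+n (arity E) p) (short t∈))
    offset<K {p = p} {E} t∈ (inj₂ ≡.refl) = ℕ.≤-trans (ℕ.≤-reflexive (≡.cong (ℕ._+ p) (1+pred E))) (short t∈)

    <K⇒≤m : ∀ {d} → d ℕ.< K → d ℕ.≤ m
    <K⇒≤m d<K = ℕ.≤-trans (ℕ.<⇒≤ d<K) (ℕ.≤-trans (ℕ.m≤m+n K K) 2K≤m)

    last-offset≢ : ∀ E p {d} → 2 ℕ.+ d ℕ.≤ arity E → d ≢ ℕ.pred (arity E) ℕ.+ p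
    last-offset≢ E p 2+d≤ ≡.refl = ℕ.1+n≰n (ℕ.≤-trans
      (ℕ.s≤s (ℕ.≤-trans (ℕ.≤-reflexive (≡.sym (1+pred E))) (ℕ.s≤s (ℕ.m≤m+n (ℕ.pred (arity E)) p)))) 2+d≤)

  vertices-distinct : ∀ {t} → t ∈ ts → Distinct (vertices t)
  vertices-distinct {t@(i , p , E)} t∈ = Distinct.tabulate⁺ λ {j} {k} e →
    Fin.toℕ-injective (go (toℕ j) (toℕ k) (Fin.toℕ<n j) (Fin.toℕ<n k) e)
    where
    go₀ : ∀ y {d} → 2 ℕ.+ d ℕ.≤ arity E → slot₀ y t ≢ a ↑ʳ back i d
    go₀ (just x) q e = ↑ˡ≢↑ʳ e
    go₀ nothing  q e = last-offset≢ E p q (≡.sym (back-injective i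
      (<K⇒≤m (offset<K t∈ (inj₂ ≡.refl))) (<K⇒≤m (offset<K t∈ (inj₁ q))) (Fin.↑ʳ-injective a _ _ e)))
    go : ∀ j k → j ℕ.< arity E → k ℕ.< arity E → slot t j ≡ slot t k → j ≡ k
    go zero    zero    _ _ _ = ≡.refl
    go zero    (suc k) _ q e = contradiction e (go₀ (tag t) q)
    go (suc j) zero    q _ e = contradiction (≡.sym e) (go₀ (tag t) q)
    go (suc j) (suc k) p q e = ≡.cong suc (back-injective i
      (<K⇒≤m (offset<K t∈ (inj₁ p))) (<K⇒≤m (offset<K t∈ (inj₁ q))) (Fin.↑ʳ-injective a _ _ e))

  -- An untagged edge determines its owner, since the offsets of its vertices are less than half of
  -- the number of new vertices, and then its position, from the largest offset.
  edge-injective : ∀ {s t} → s ∈ ts → t ∈ ts → symbol s ≡ symbol t → edge s ≡ edge t → s ≡ t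
  edge-injective {s@(i , p , E)} {t@(j , q , .E)} s∈ t∈ ≡.refl e = go (tag s) (tag t) ≡.refl ≡.refl
    where
    go : ∀ x y → tag s ≡ x → tag t ≡ y → s ≡ t
    go (just x) _ f _ = tag-injective f (old∈edge⁻ t (≡.subst (_ ∈ˢ_) e
      (≡.subst (λ y → slot₀ y s ∈ˢ edge s) f (slot∈edge s {0} (ℕ.<⇒≤ (2≤arity E))))))
    go nothing (just x) _ g = tag-injective (old∈edge⁻ s (≡.subst (_ ∈ˢ_) (≡.sym e)
      (≡.subst (λ y → slot₀ y t ∈ˢ edge t) g (slot∈edge t {0} (ℕ.<⇒≤ (2≤arity E)))))) g
    go nothing nothing f g
      with new∈edge⁻ j q E (≡.subst (_ ∈ˢ_) e (owner∈edge i p E))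
         | new∈edge⁻ i p E (≡.subst (_ ∈ˢ_) (≡.sym e) (owner∈edge j q E))
    ... | d , b , o | d′ , b′ , o′
      with back-antisym i j d d′ (ℕ.≤-trans (ℕ.+-mono-≤ (ℕ.<⇒≤ (offset<K t∈ o)) (ℕ.<⇒≤ (offset<K s∈ o′))) 2K≤m) b b′
    ...   | ≡.refl
      with new∈edge⁻ i p E (≡.subst (_ ∈ˢ_) (≡.sym e)
             (≡.subst (λ y → slot₀ y t ∈ˢ edge t) g (slot∈edge t {0} (ℕ.<⇒≤ (2≤arity E)))))
    ...     | d″ , b″ , o″
      with back-injective i (<K⇒≤m (offset<K s∈ o″)) (<K⇒≤m (offset<K t∈ (inj₂ ≡.refl))) b″ | o″
    ...       | ≡.refl | inj₁ r = contradiction ≡.refl (last-offset≢ E q r)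
    ...       | ≡.refl | inj₂ r = ≡.cong (λ q → i , q , E) (≡.sym (ℕ.+-cancelˡ-≡ (ℕ.pred (arity E)) _ _ r))

  -- With arity at least 3 the predecessor sits in slot 2. A binary edge in position 0 carries no
  -- tag, so its slot 0 is the new vertex at distance 1 + 0.
  head-meets-previous : ∀ i E → (a ↑ʳ prev i) ∈ˢ edge (i , 0 , E)
  head-meets-previous i E with 3 ℕ.≤? arity E
  ... | yes 3≤ = slot∈edge (i , 0 , E) {2} 3≤
  ... | no ¬3≤ = ≡.subst (_∈ˢ edge (i , 0 , E)) (go (tag (i , 0 , E)) ≡.refl) (slot∈edge (i , 0 , E) {0} (ℕ.<⇒≤ (2≤arity E)))
    where
    go : ∀ y → tag (i , 0 , E) ≡ y → slot₀ y (i , 0 , E) ≡ a ↑ʳ prev i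
    go (just x) f = contradiction (tag-special f) λ { (inj₁ ()) ; (inj₂ q) → ¬3≤ q }
    go nothing  f = ≡.cong (λ r → a ↑ʳ back i (ℕ.pred r ℕ.+ 0)) (ℕ.≤-antisym (ℕ.s≤s⁻¹ (ℕ.≰⇒> ¬3≤)) (2≤arity E))

  tagged-edge : ∀ {t x} → tag t ≡ just x → (x ↑ˡ suc m) ∈ˢ edge t
  tagged-edge {t} f = ≡.subst (λ y → slot₀ y t ∈ˢ edge t) f (slot∈edge t {0} (ℕ.<⇒≤ (2≤arity (symbol t))))

-- From a list of symbols to an essential minimal pair

module Build
  (em : ExcludedMiddle 0ℓ) (ℝ : CompleteOrderedField) (L : Language)
  (α : Language.Symbol L → CompleteOrderedField.Carrier ℝ)
  (0<α : ∀ E → CompleteOrderedField._<_ ℝ (CompleteOrderedField.0# ℝ) (α E))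
  (α≤1 : ∀ E → CompleteOrderedField._≤_ ℝ (α E) (CompleteOrderedField.1# ℝ))
  where
  open CompleteOrderedField ℝ hiding (zero)
  open OrderedField ℝ
  open Solver using (solve; _:=_; _:+_; _:*_; _:-_; :-_; con)
  open Language L
  open Weights ℝ L α
  open Predimension ℝ L α
  open Structure

  length*≤weight : ∀ {μ} → (∀ E → μ ≤ α E) → ∀ Es → fromℕ (length Es) * μ ≤ weight Es
  length*≤weight {μ} μ≤ []       = ≤-reflexive (zeroˡ μ)
  length*≤weight {μ} μ≤ (E ∷ Es) = lin₂ (μ≤ E) (length*≤weight μ≤ Es)
    (trans (+-congˡ (trans (distribʳ μ 1# (fromℕ (length Es))) (+-congʳ (*-identityˡ μ))))
      (solve 4 (λ e w l μ → (e :+ w) :+ (μ :+ l) := (μ :+ l) :+ (e :+ w)) refl (α E) (weight Es) (fromℕ (length Es) * μ) μ))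

  -- Two ways to provide a tag for each of the a elements of 𝔄: at least a edges that are not the
  -- first of their owner, as only n are first, or a edges of one symbol with room for a third
  -- vertex.
  Enough : ℕ → ℕ → List Symbol → Set
  Enough n a Es = n ℕ.+ a ℕ.≤ length Es ⊎ (∃ λ E → 3 ℕ.≤ arity E × a ℕ.≤ count E Es)

  module _ (𝔄 : Structure) {η} (0<η : 0# < η) (η≤α : ∀ E → η ≤ α E)
    {m K : ℕ} (2K≤m : K ℕ.+ K ℕ.≤ m) where
    open Chunks ℝ L α η
    open Items ℝ L α η
    private a = card 𝔄

    module _ (cs : Vec Chunk (suc m)) (cs-balanced : Balanced 0# cs)
      (short : ∀ {i p E} → (i , p , E) ∈ items id cs → arity E ℕ.+ p ℕ.≤ K)
      (T : Tagging a (items id cs)) where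
      open Tagging T
      open Edges ℝ L α η K 2K≤m (items id cs) short T

      private
        all : List (Item (suc m))
        all = items id cs

      open Extension em ℝ L α 𝔄 (suc m) symbol vertices all vertices-distinct
        (items-unique id id cs) edge-injective edge-meets-new
        public using (𝔇; ι; load; inside?; essentialMinimalPair)

      module _ (w : weight (flatten cs) ≈ fromℕ (suc m) + η) where

        -- If all new vertices are present, some x in 𝔄 is absent; losing the edge tagged x, of
        -- weight at least η, brings the total n + η down to at most n. Otherwise `sum≤with-gap`
        -- applies with initial balance 0.
        sparse : ∀ Y Z → Y ++ Z ≢ ⊤ˢ → load (Y ++ Z) ≤ fromℕ ∣ Z ∣
        sparse Y Z YZ≢⊤ with Vec.≡-dec Bool._≟_ Z ⊤ˢ
        sparse Y .⊤ˢ YZ≢⊤ | yes ≡.refl with Fin.any? (λ x → ¬? (x Subset.∈? Y))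
        ... | no ¬∃ = contradiction
          (≡.trans (≡.cong (_++ ⊤ˢ {suc m}) (Subset.⊆-antisym {i = Y} Subset.⊆⊤ λ {x} _ → decidable-stable (x Subset.∈? Y) λ x∉ → ¬∃ (x , x∉))) (⊤++⊤ {a} {suc m}))
          YZ≢⊤
        ... | yes (x , x∉Y) with tag-covers x
        ...   | t , t∈ , f = ≤-cong refl (fromℕ-cong (≡.sym (Subset.∣⊤∣≡n (suc m))))
          (lin₃ (weight-filter-drop 0<α symbol (inside? (Y ++ ⊤ˢ)) t∈ λ t⊆ → x∉Y (∈-++-↑ˡ⁻ Y (t⊆ (tagged-edge f))))
                (η≤α (symbol t)) (≤-reflexive (trans (weight-cong (map-symbol-items id cs)) w))
            (solve 5 (λ l e w n η → (w :+ e :+ (n :+ η)) :+ l := ((l :+ e) :+ η :+ w) :+ n)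
              refl (load (Y ++ ⊤ˢ)) (α (symbol t)) (weight (List.map symbol all)) (fromℕ (suc m)) η))
        sparse Y Z YZ≢⊤ | no Z≢⊤ = ≤-cong (sym (weight-filter-items (inside? S) id cs)) (+-identityʳ _)
          (sum≤with-gap (proj₁ 0<η) cs Z ω cs-balanced (bounded cs Z ω owner-absent ω≤total previous-absent) Z≢⊤)
          where
          S = Y ++ Z
          ω : Fin (suc m) → Carrier
          ω i = weight (List.map symbol (filter (inside? S) (itemsOf i (Vec.lookup cs i))))

          listed : Fin (suc m) → List Symbol
          listed i = proj₁ (Vec.lookup cs i) ∷ tail (Vec.lookup cs i)

          owner-absent : ∀ i → i ∉ˢ Z → ω i ≤ 0#
          owner-absent i i∉Z = ≤-reflexive (weight-cong (≡.cong (List.map symbol)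
            (List.filter-none (inside? S) {xs = number i 0 (listed i)} (All.tabulate λ { {j , p , E} t∈ t⊆ →
              i∉Z (≡.subst (_∈ˢ Z) (proj₁ (∈-number⁻ (listed i) t∈)) (∈-++-↑ʳ⁻ Y (t⊆ (owner∈edge j p E)))) }))))

          ω≤total : ∀ i → ω i ≤ total (Vec.lookup cs i)
          ω≤total i = ≤-trans (weight-filter≤ 0<α symbol (inside? S) (itemsOf i (Vec.lookup cs i)))
            (≤-reflexive (weight-cong (map-symbol-number i 0 (listed i))))

          previous-absent : ∀ i j → toℕ j ≡ suc (toℕ i) → i ∉ˢ Z → ω j ≤ weight (tail (Vec.lookup cs j))
          previous-absent i (suc j) e i∉Z = ≤-trans
            (≤-reflexive (weight-cong (≡.cong (List.map symbol) (List.filter-reject (inside? S) head∉))))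
            (≤-trans (weight-filter≤ 0<α symbol (inside? S) (number (suc j) 1 c))
                     (≤-reflexive (weight-cong (map-symbol-number (suc j) 1 c))))
            where
            E = proj₁ (Vec.lookup cs (suc j))
            c = tail (Vec.lookup cs (suc j))
            prev≡i : Fin.inject₁ j ≡ i
            prev≡i = Fin.toℕ-injective (≡.trans (Fin.toℕ-inject₁ j) (ℕ.suc-injective e))
            head∉ : ¬ edge (suc j , 0 , E) ⊆ˢ S
            head∉ h⊆ = i∉Z (≡.subst (_∈ˢ Z) prev≡i (∈-++-↑ʳ⁻ Y (h⊆ (head-meets-previous (suc j) E))))

        balanced⇒pair : η ≤ δ 𝔄 → Kα 𝔄 → EssentialMinimalPair ι × δ/ ι ≈ - η
        balanced⇒pair η≤δ 𝔄∈Kα = essentialMinimalPair 0<η η≤δ 𝔄∈Kα (trans (weight-cong (map-symbol-items id cs)) w) sparse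

    -- The tail of a chunk weighs at most 1 and each of its edges at least μ, so (k + 1) μ > 1
    -- limits it to k edges. Hence arity plus position is at most K, as the layout on the cycle
    -- requires.
    build : η ≤ δ 𝔄 → Kα 𝔄 →
      ∀ {μ} → (∀ E → μ ≤ α E) → ∀ k → 1# < fromℕ (suc k) * μ → (∀ E → arity E ℕ.+ k ℕ.≤ K) →
      ∀ Es → Spread 0# Es → weight Es ≈ fromℕ (suc m) + η → Enough (suc m) a Es →
      Σ[ 𝔇 ∈ Structure ] card 𝔇 ≡ a ℕ.+ suc m × Kα 𝔇 × (Σ[ ι ∈ Embedding 𝔄 𝔇 ] EssentialMinimalPair ι × δ/ ι ≈ - η)
    build η≤δ 𝔄∈Kα μ≤α k 1<kμ arity+k≤K [] sp w enough = contradiction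
      (lin₂ (0≤fromℕ (suc m)) (≤-reflexive (sym w)) (solve 2 (λ n η → (n :+ con ℤ.0ℤ) :+ η := (con ℤ.0ℤ :+ (n :+ η)) :+ con ℤ.0ℤ) refl (fromℕ (suc m)) η))
      (<⇒≱ 0<η)
    build η≤δ 𝔄∈Kα {μ} μ≤α k 1<kμ arity+k≤K (E ∷ Es) sp w enough
      with greedy 0<η α≤1 m {0#} E Es ≤-refl (≤-cong (sym (+-identityˡ η)) refl (η≤α E)) sp (trans w (+-congʳ (sym (+-identityˡ _))))
    ... | cs , b , fl = 𝔇 cs b short T , ≡.refl , EssentialMinimalPair.𝔇∈Kα (proj₁ pair) , ι cs b short T , pair
      where
      tail-length : ∀ i → length (tail (Vec.lookup cs i)) ℕ.≤ k
      tail-length i with length (tail (Vec.lookup cs i)) ℕ.≤? k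
      ... | yes p = p
      ... | no ¬p = contradiction
        (≤-trans (≤-cong (*-comm μ _) (*-comm μ _) (*-monoʳ-≤ 0≤μ (fromℕ-mono (ℕ.≰⇒> ¬p))))
          (≤-trans (length*≤weight μ≤α (tail (Vec.lookup cs i))) (weight-tail≤1 cs (proj₁ 0<η) b i)))
        (<⇒≱ 1<kμ)
        where
        0≤μ : 0# ≤ μ
        0≤μ with ≤-total 0# μ
        ... | inj₁ p = p
        ... | inj₂ p = contradiction (≤-trans (*-monoʳ-≤ (0≤fromℕ (suc k)) p) (≤-trans (≤-reflexive (zeroʳ _)) 0≤1)) (<⇒≱ 1<kμ)
      short : ∀ {i p E} → (i , p , E) ∈ items id cs → arity E ℕ.+ p ℕ.≤ K
      short {E = E} t∈ with ∈-items⁻ id cs t∈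
      ... | i , _ , p≤ = ℕ.≤-trans (ℕ.+-monoʳ-≤ (arity E) (ℕ.≤-trans p≤ (tail-length i))) (arity+k≤K E)
      T : Tagging a (items id cs)
      T = tag-by enough
        where
        tag-by : Enough (suc m) a (E ∷ Es) → Tagging a (items id cs)
        tag-by (inj₁ p) = tagging em a _ (items-unique id id cs) (λ t → 1 ℕ.≤? proj₁ (proj₂ t)) inj₁
          (ℕ.+-cancelˡ-≤ (suc m) _ _ (ℕ.≤-trans p (ℕ.≤-reflexive (≡.sym (≡.trans (count-later-items id cs) (≡.cong length fl))))))
        tag-by (inj₂ (F , 3≤ , p)) = tagging em a _ (items-unique id id cs) (λ t → F Fin.≟ symbol t) (λ { ≡.refl → inj₂ 3≤ })
          (ℕ.≤-trans p (ℕ.≤-reflexive (≡.sym (≡.trans (count-map symbol F (items id cs)) (≡.cong (count F) (≡.trans (map-symbol-items id cs) fl))))))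
      pair = balanced⇒pair cs b short T (trans (weight-cong fl) w) η≤δ 𝔄∈Kα

-- Infinitely many isomorphism types; uniform bounds

module _ {L : Language} where
  open Structures L
  open Structure

  ≅⇒card≡ : ∀ 𝔄 𝔅 → 𝔄 ≅ 𝔅 → card 𝔄 ≡ card 𝔅
  ≅⇒card≡ 𝔄 𝔅 (f , (injective , surjective) , _) = ℕ.≤-antisym (Fin.injective⇒≤ injective)
    (Fin.injective⇒≤ {f = λ y → proj₁ (surjective y)} λ {x} {y} e →
      ≡.trans (≡.sym (proj₂ (surjective x) ≡.refl)) (≡.trans (≡.cong f e) (proj₂ (surjective y) ≡.refl)))

  -- Each structure is chosen larger than the one before, and isomorphic structures have equal
  -- cardinality.
  unbounded⇒infinitelyMany : ∀ {P : Pred Structure 0ℓ} → (∀ B → Σ[ 𝔇 ∈ Structure ] B ℕ.≤ card 𝔇 × P 𝔇) →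
                             InfinitelyManyNonIsomorphic P
  unbounded⇒infinitelyMany {P} next = 𝔇 , P𝔇 , distinct
    where
    chain : ℕ → Σ[ 𝔇 ∈ Structure ] P 𝔇
    chain zero    = let 𝔇 , _ , p = next 0 in 𝔇 , p
    chain (suc i) = let 𝔇 , _ , p = next (suc (card (proj₁ (chain i)))) in 𝔇 , p
    𝔇 : ℕ → Structure
    𝔇 i = proj₁ (chain i)
    P𝔇 : ∀ i → P (𝔇 i)
    P𝔇 i = proj₂ (chain i)
    step : ∀ i → card (𝔇 i) ℕ.< card (𝔇 (suc i))
    step i = proj₁ (proj₂ (next (suc (card (𝔇 i)))))
    increasing : ∀ {i j} → i ℕ.<′ j → card (𝔇 i) ℕ.< card (𝔇 j)
    increasing {i} (ℕ.<′-base)   = step i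
    increasing {j = suc j} (ℕ.≤′-step p) = ℕ.<-trans (increasing p) (step j)
    distinct : ∀ i j → i ≢ j → ¬ 𝔇 i ≅ 𝔇 j
    distinct i j i≢j iso with ℕ.<-cmp i j
    ... | tri< i<j _ _ = ℕ.<⇒≢ (increasing (ℕ.<⇒<′ i<j)) (≅⇒card≡ (𝔇 i) (𝔇 j) iso)
    ... | tri≈ _ i≡j _ = i≢j i≡j
    ... | tri> _ _ j<i = ℕ.<⇒≢ (increasing (ℕ.<⇒<′ j<i)) (≡.sym (≅⇒card≡ (𝔇 i) (𝔇 j) iso))

bounded-arity : ∀ {k} (f : Fin k → ℕ) → ∃ λ R → ∀ i → f i ℕ.≤ R
bounded-arity {zero}  f = 0 , λ ()
bounded-arity {suc k} f with bounded-arity (f ∘ suc)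
... | R , f≤R = f zero ℕ.⊔ R , λ { zero → ℕ.m≤m⊔n _ R ; (suc i) → ℕ.≤-trans (f≤R i) (ℕ.m≤n⊔m (f zero) R) }

module PositiveMinima (ℝ : CompleteOrderedField) where
  open CompleteOrderedField ℝ hiding (zero)
  open OrderedField ℝ

  min-pos : ∀ {x y} → 0# < x → 0# < y → ∃ λ z → 0# < z × z ≤ x × z ≤ y
  min-pos {x} {y} 0<x 0<y with ≤-total x y
  ... | inj₁ x≤y = x , 0<x , ≤-refl , x≤y
  ... | inj₂ y≤x = y , 0<y , y≤x , ≤-refl

  min-pos-Fin : ∀ {k} (f : Fin k → Carrier) → (∀ i → 0# < f i) → ∃ λ z → 0# < z × (∀ i → z ≤ f i)
  min-pos-Fin {zero}  f 0<f = 1# , 0<1 , λ ()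
  min-pos-Fin {suc k} f 0<f with min-pos-Fin (f ∘ suc) (0<f ∘ suc)
  ... | z , 0<z , z≤ with min-pos (0<f zero) 0<z
  ...   | w , 0<w , w≤f , w≤z = w , 0<w , λ { zero → w≤f ; (suc i) → ≤-trans w≤z (z≤ i) }

-- Existence for sufficiently long lists of symbols

module Existence
  (em : ExcludedMiddle 0ℓ) (ℝ : CompleteOrderedField) (L : Language)
  (α : Language.Symbol L → CompleteOrderedField.Carrier ℝ)
  (0<α : ∀ E → CompleteOrderedField._<_ ℝ (CompleteOrderedField.0# ℝ) (α E))
  (α≤1 : ∀ E → CompleteOrderedField._≤_ ℝ (α E) (CompleteOrderedField.1# ℝ))
  where
  open CompleteOrderedField ℝ hiding (zero)
  open OrderedField ℝ
  open PositiveMinima ℝ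
  open Solver using (solve; _:=_; _:+_; _:*_; _:-_; :-_; con)
  open Language L
  open Weights ℝ L α
  open Predimension ℝ L α
  open Structure
  open Build em ℝ L α 0<α α≤1

  -- An edge of symbol F contributes 1 - α F ≥ 0 to the difference between number and weight; only
  -- the contributions of E are kept.
  count*≤slack : ∀ E Es → fromℕ (count E Es) * (1# - α E) + weight Es ≤ fromℕ (length Es)
  count*≤slack E [] = ≤-reflexive (trans (+-identityʳ _) (zeroˡ _))
  count*≤slack E (F ∷ Es) with E Fin.≟ F
  ... | yes ≡.refl = lin₁ (count*≤slack E Es)
    (trans (+-congˡ (+-congʳ (trans (distribʳ (1# - α E) 1# c) (+-congʳ (*-identityˡ _)))))
      (solve 5 (λ o e c w l → l :+ ((o :- e) :+ c :* (o :- e) :+ (e :+ w)) := (c :* (o :- e) :+ w) :+ (o :+ l))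
        refl 1# (α E) c (weight Es) (fromℕ (length Es))))
    where c = fromℕ (count E Es)
  ... | no _ = lin₂ (count*≤slack E Es) (α≤1 F)
    (solve 5 (λ o f c w l → (l :+ o) :+ (c :+ (f :+ w)) := ((c :+ w) :+ f) :+ (o :+ l))
      refl 1# (α F) (fromℕ (count E Es) * (1# - α E)) (weight Es) (fromℕ (length Es)))

  private
    Suitable : Symbol → ℕ → ℕ → Set
    Suitable E a J = ∀ {n η} Es → 0# ≤ η → weight Es ≈ fromℕ n + η → J ℕ.≤ count E Es → Enough n a Es

    -- For arity at least 3, any a edges of symbol E will do. For arity 2, α E < 1, and J copies
    -- with J (1 - α E) ≥ a make the number of edges exceed their weight, which is at least n, by at
    -- least a.
    suitable : ∀ E → ¬ (arity E ≡ 2 × α E ≈ 1#) → ∀ a → ∃ (Suitable E a)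
    suitable E ¬excluded a with arity E ℕ.≟ 2
    ... | no  arity≢2 = a , λ Es _ _ a≤ → inj₂ (E , ℕ.≤∧≢⇒< (2≤arity E) (arity≢2 ∘ ≡.sym) , a≤)
    ... | yes arity≡2 = J , λ {n} {η} Es 0≤η w J≤ → inj₁ (fromℕ-cancel (≤-trans (≤-reflexive (fromℕ-+ n a))
      (lin₁ (+-mono-≤ (+-mono-≤ (+-mono-≤ a≤J (*-monoˡ (fromℕ-mono J≤))) (count*≤slack E Es)) (+-mono-≤ 0≤η (≤-reflexive (sym w))))
        (solve 7 (λ a j c w l n η → ((j :+ c :+ l) :+ (η :+ w)) :+ (n :+ a) := ((a :+ j :+ (c :+ w)) :+ (con ℤ.0ℤ :+ (n :+ η))) :+ l)
          refl (fromℕ a) (fromℕ J * (1# - α E)) (fromℕ (count E Es) * (1# - α E)) (weight Es) (fromℕ (length Es)) (fromℕ n) η))))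
      where
      0<1-α : 0# < 1# - α E
      0<1-α = ≰⇒> λ p → ¬excluded (arity≡2 , ≤-antisym (α≤1 E)
        (lin₁ p (solve 2 (λ o e → con ℤ.0ℤ :+ o := (o :- e) :+ e) refl 1# (α E))))
      J = proj₁ (archimedean-* em 0<1-α (fromℕ a))
      a≤J = proj₂ (archimedean-* em 0<1-α (fromℕ a))
      *-monoˡ : ∀ {x y} → x ≤ y → x * (1# - α E) ≤ y * (1# - α E)
      *-monoˡ p = ≤-cong (*-comm _ _) (*-comm _ _) (*-monoʳ-≤ (proj₁ 0<1-α) p)

  weight-replicate : ∀ k E → weight (List.replicate k E) ≈ fromℕ k * α E
  weight-replicate zero    E = sym (zeroˡ _)
  weight-replicate (suc k) E = trans (+-congˡ (weight-replicate k E))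
    (sym (trans (distribʳ (α E) 1# (fromℕ k)) (+-congʳ (*-identityˡ _))))

  count-replicate : ∀ k (E : Symbol) Es → k ℕ.≤ count E (List.replicate k E List.++ Es)
  count-replicate zero    E Es = z≤n
  count-replicate (suc k) E Es with E Fin.≟ E
  ... | yes _ = s≤s (count-replicate k E Es)
  ... | no E≢E = contradiction ≡.refl E≢E

  Realises : (𝔄 : Structure) → Carrier → ℕ → Set
  Realises 𝔄 η n = Σ[ 𝔇 ∈ Structure ] n ℕ.≤ card 𝔇 × Kα 𝔇 ×
    (Σ[ ι ∈ Embedding 𝔄 𝔇 ] EssentialMinimalPair ι × δ/ ι ≈ - η)

  -- The bound B depends only on 𝔄 and E, so η, n and the list may be chosen after it.
  realise : (𝔄 : Structure) → Kα 𝔄 → ∀ E → ¬ (arity E ≡ 2 × α E ≈ 1#) →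
    ∃ λ B → ∀ {η n} Es → 0# < η → (∀ F → η ≤ α F) → η ≤ δ 𝔄 → B ℕ.≤ n → B ℕ.≤ count E Es →
    Chunks.Spread ℝ L α η 0# Es → weight Es ≈ fromℕ n + η → Realises 𝔄 η n
  realise 𝔄 𝔄∈Kα E ¬excluded = B , λ { {η} {n} → go {η} {n} }
    where
    μ = proj₁ (min-pos-Fin α 0<α)
    0<μ = proj₁ (proj₂ (min-pos-Fin α 0<α))
    μ≤α = proj₂ (proj₂ (min-pos-Fin α 0<α))
    k = proj₁ (archimedean-* em 0<μ 1#)
    1<kμ : 1# < fromℕ (suc k) * μ
    1<kμ = ≰⇒> λ p → <⇒≱ 0<μ (lin₂ p (proj₂ (archimedean-* em 0<μ 1#))
      (trans (solve 4 (λ o x y μ → (o :+ x) :+ μ := (o :+ (μ :+ x)) :+ con ℤ.0ℤ) refl 1# (fromℕ k * μ) (fromℕ k * μ) μ)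
        (+-congʳ (trans (+-comm _ _) (+-congʳ (sym (trans (distribʳ μ 1# (fromℕ k)) (+-congʳ (*-identityˡ μ)))))))))
    R = proj₁ (bounded-arity arity)
    K = R ℕ.+ k
    J = proj₁ (suitable E ¬excluded (card 𝔄))
    -- For n = m + 1 this yields 2K ≤ m, and it provides the J copies of E that `suitable` asks for.
    B = suc (K ℕ.+ K) ℕ.+ J
    go : ∀ {η n} Es → 0# < η → (∀ F → η ≤ α F) → η ≤ δ 𝔄 → B ℕ.≤ n → B ℕ.≤ count E Es →
      Chunks.Spread ℝ L α η 0# Es → weight Es ≈ fromℕ n + η → Realises 𝔄 η n
    go {η} {suc m} Es 0<η η≤α η≤δ B≤n B≤c sp w
      with build 𝔄 0<η η≤α {m} {K} (ℕ.≤-trans (ℕ.m≤m+n (K ℕ.+ K) J) (ℕ.s≤s⁻¹ B≤n)) η≤δ 𝔄∈Kα μ≤α k 1<kμ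
             (λ F → ℕ.+-monoˡ-≤ k (proj₂ (bounded-arity arity) F)) Es sp w
             (proj₂ (suitable E ¬excluded (card 𝔄)) Es (proj₁ 0<η) w (ℕ.≤-trans (ℕ.m≤n+m J _) B≤c))
    ... | 𝔇 , e , rest = 𝔇 , ℕ.≤-trans (ℕ.m≤n+m (suc m) (card 𝔄)) (ℕ.≤-reflexive (≡.sym e)) , rest

-- Rational weights

module Fractions (ℝ : CompleteOrderedField) where
  open CompleteOrderedField ℝ hiding (zero)
  open OrderedField ℝ
  open Solver using (solve; _:=_; _:+_; _:*_; _:-_; :-_; con)

  fraction : ∀ {x} q → 0# < x → x ≈ fromℚ q →
             ∃ λ p → fromℕ (↧ₙ q) * x ≈ fromℕ (suc p) × Coprime.Coprime (suc p) (↧ₙ q)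
  fraction {x} q@(mkℚ n d-1 coprime) 0<x e = positive n (Coprime.recompute coprime) (begin
    d * x                     ≈⟨ *-congˡ e ⟩
    d * (fromℤ n * d ⁻¹)      ≈⟨ solve 3 (λ d n i → d :* (n :* i) := (d :* i) :* n) refl d (fromℤ n) (d ⁻¹) ⟩
    (d * d ⁻¹) * fromℤ n      ≈⟨ *-congʳ (*-inverseʳ d (>⇒≉ (fromℕ-suc>0 d-1))) ⟩
    1# * fromℤ n              ≈⟨ *-identityˡ _ ⟩
    fromℤ n                   ∎)
    where
    open import Relation.Binary.Reasoning.Setoid setoid
    d = fromℕ (suc d-1)
    0<dx : 0# < d * x
    0<dx = *-pos (fromℕ-suc>0 d-1) 0<x
    positive : ∀ n → Coprime.Coprime ℤ.∣ n ∣ (suc d-1) → d * x ≈ fromℤ n →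
               ∃ λ p → d * x ≈ fromℕ (suc p) × Coprime.Coprime (suc p) (suc d-1)
    positive (ℤ.+ zero)  _ e = contradiction e (>⇒≉ 0<dx)
    positive (ℤ.+ suc p) c e = p , e , c
    positive ℤ.-[1+ p ]  _ e = contradiction
      (lin₂ (proj₁ 0<dx) (≤-reflexive e) (solve 2 (λ y n → (y :+ :- n) :+ n := (con ℤ.0ℤ :+ y) :+ con ℤ.0ℤ) refl (d * x) (fromℕ (suc p))))
      (<⇒≱ (fromℕ-suc>0 p))

  -- Forming the quotient in ℚ divides i and m + 1 by their gcd g, which is cancelled here.
  rational-quotient : ∀ {x} m i → fromℕ (suc m) * x ≈ fromℕ i → x ≈ fromℚ (ℤ.+ i ℚ./ suc m)
  rational-quotient {x} m i e = *-cancelˡ d≉0 (begin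
    d * x                       ≈⟨ *-cancelˡ g≉0 scaled ⟩
    fromℤ (↥ q)                 ≈⟨ *-identityˡ _ ⟨
    1# * fromℤ (↥ q)            ≈⟨ *-congʳ (*-inverseʳ d d≉0) ⟨
    (d * d ⁻¹) * fromℤ (↥ q)    ≈⟨ solve 3 (λ d n i → d :* (n :* i) := (d :* i) :* n) refl d (fromℤ (↥ q)) (d ⁻¹) ⟨
    d * (fromℤ (↥ q) * d ⁻¹)    ∎)
    where
    open import Relation.Binary.Reasoning.Setoid setoid
    q = ℤ.+ i ℚ./ suc m
    d = fromℕ (↧ₙ q)
    g = fromℕ (gcd i (suc m))
    n≈gq : fromℤ (↥ q) * g ≈ fromℕ i
    n≈gq = trans (sym (fromℤ-* (↥ q) (ℤ.+ gcd i (suc m)))) (fromℤ-cong (ℚ.↥-/ (ℤ.+ i) (suc m)))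
    d≈gq : d * g ≈ fromℕ (suc m)
    d≈gq = trans (sym (fromℤ-* (ℤ.+ ↧ₙ q) (ℤ.+ gcd i (suc m)))) (fromℤ-cong (ℚ.↧-/ (ℤ.+ i) (suc m)))
    d≉0 : ¬ d ≈ 0#
    d≉0 e = >⇒≉ (fromℕ-suc>0 m) (trans (sym d≈gq) (trans (*-congʳ e) (zeroˡ _)))
    g≉0 : ¬ g ≈ 0#
    g≉0 e = >⇒≉ (fromℕ-suc>0 m) (trans (sym d≈gq) (trans (*-congˡ e) (zeroʳ _)))
    scaled : g * (d * x) ≈ g * fromℤ (↥ q)
    scaled = begin
      g * (d * x)       ≈⟨ solve 3 (λ g d x → g :* (d :* x) := (d :* g) :* x) refl g d x ⟩
      (d * g) * x       ≈⟨ *-congʳ d≈gq ⟩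
      fromℕ (suc m) * x ≈⟨ e ⟩
      fromℕ i           ≈⟨ n≈gq ⟨
      fromℤ (↥ q) * g   ≈⟨ *-comm _ _ ⟩
      g * fromℤ (↥ q)   ∎

  module SubgroupOfFractions (G : Pred Carrier 0ℓ) (G-cong : ∀ {x y} → x ≈ y → G x → G y)
    (G-- : ∀ {x y} → G x → G y → G (x - y)) where

    G-0 : ∀ {x} → G x → G 0#
    G-0 {x} Gx = G-cong (-‿inverseʳ x) (G-- Gx Gx)

    G-+ : ∀ {x y} → G x → G y → G (x + y)
    G-+ {x} {y} Gx Gy = G-cong (solve 2 (λ x y → x :- (con ℤ.0ℤ :- y) := x :+ y) refl x y) (G-- Gx (G-- (G-0 Gy) Gy))

    G-· : ∀ k {x} → G x → G (fromℕ k * x)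
    G-· zero    {x} Gx = G-cong (sym (zeroˡ x)) (G-0 Gx)
    G-· (suc k) {x} Gx = G-cong (sym (trans (distribʳ x 1# (fromℕ k)) (+-congʳ (*-identityˡ x)))) (G-+ Gx (G-· k Gx))

    -- That 1/d belongs to G.
    Unit : ℕ → Set
    Unit d = ∃ λ x → G x × fromℕ d * x ≈ 1#

    private
      transport : ∀ {g x m y n} → g ℕ.+ y ℕ.* n ≡ x ℕ.* m → fromℕ g + fromℕ y * fromℕ n ≈ fromℕ x * fromℕ m
      transport {g} {x} {m} {y} {n} eq = trans (+-congˡ (sym (fromℕ-* y n)))
        (trans (sym (fromℕ-+ g (y ℕ.* n))) (trans (fromℕ-cong eq) (fromℕ-* x m)))

      difference : ∀ {g b c} → g + b ≈ c → c - b ≈ g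
      difference {g} {b} {c} e = trans (+-congʳ (sym e)) (solve 2 (λ g b → (g :+ b) :- b := g) refl g b)

      module GcdLcm (m n : ℕ) {u v : Carrier} (mu≈1 : fromℕ m * u ≈ 1#) (nv≈1 : fromℕ n * v ≈ 1#) where
        M = fromℕ m
        N = fromℕ n
        g = fromℕ (gcd m n)
        l = fromℕ (lcm m n)
        open import Relation.Binary.Reasoning.Setoid setoid

        gl≈mn : g * l ≈ M * N
        gl≈mn = trans (sym (fromℕ-* (gcd m n) (lcm m n))) (trans (fromℕ-cong (gcd*lcm m n)) (fromℕ-* m n))

        g≉0 : ¬ g ≈ 0#
        g≉0 e = 0≉1 (begin
          0#                ≈⟨ solve 3 (λ l u v → con ℤ.0ℤ := con ℤ.0ℤ :* l :* (u :* v)) refl l u v ⟩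
          0# * l * (u * v)  ≈⟨ *-congʳ (*-congʳ e) ⟨
          g * l * (u * v)   ≈⟨ *-congʳ gl≈mn ⟩
          M * N * (u * v)   ≈⟨ solve 4 (λ M N u v → M :* N :* (u :* v) := (M :* u) :* (N :* v)) refl M N u v ⟩
          (M * u) * (N * v) ≈⟨ *-cong mu≈1 nv≈1 ⟩
          1# * 1#           ≈⟨ *-identityʳ 1# ⟩
          1#                ∎)

        lcm-inverse : ∀ z → (M * N) * z ≈ g → l * z ≈ 1#
        lcm-inverse z e = *-cancelˡ g≉0 (trans (sym (*-assoc _ _ _)) (trans (*-congʳ gl≈mn) (trans e (sym (*-identityʳ g)))))

    -- Here x = p/d. If u p - v d = 1, then u x - v = 1/d; the other sign is symmetric.
    unit-coprime : ∀ {p d x} → Coprime.Coprime p d → fromℕ d * x ≈ fromℕ p → G 1# → G x → Unit d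
    unit-coprime {p} {d} {x} c e G1 Gx with Coprime.coprime-Bézout c
    ... | Bézout.+- u v eq = fromℕ u * x - fromℕ v * 1# , G-- (G-· u Gx) (G-· v G1) , (begin
      D * (U * x - V * 1#)   ≈⟨ solve 5 (λ D U x V o → D :* (U :* x :- V :* o) := U :* (D :* x) :- (V :* D) :* o) refl D U x V 1# ⟩
      U * (D * x) - (V * D) * 1# ≈⟨ +-cong (*-congˡ e) (-‿cong (*-identityʳ _)) ⟩
      U * fromℕ p - V * D    ≈⟨ difference (transport {1} {u} {p} {v} {d} eq) ⟩
      fromℕ 1                ≈⟨ +-identityʳ 1# ⟩
      1#                     ∎)
      where
      open import Relation.Binary.Reasoning.Setoid setoid
      D = fromℕ d
      U = fromℕ u
      V = fromℕ v
    ... | Bézout.-+ u v eq = fromℕ v * 1# - fromℕ u * x , G-- (G-· v G1) (G-· u Gx) , (begin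
      D * (V * 1# - U * x)   ≈⟨ solve 5 (λ D U x V o → D :* (V :* o :- U :* x) := (V :* D) :* o :- U :* (D :* x)) refl D U x V 1# ⟩
      (V * D) * 1# - U * (D * x) ≈⟨ +-cong (*-identityʳ _) (-‿cong (*-congˡ e)) ⟩
      V * D - U * fromℕ p    ≈⟨ difference (transport {1} {v} {d} {u} {p} eq) ⟩
      fromℕ 1                ≈⟨ +-identityʳ 1# ⟩
      1#                     ∎)
      where
      open import Relation.Binary.Reasoning.Setoid setoid
      D = fromℕ d
      U = fromℕ u
      V = fromℕ v

    -- If x m - y n = gcd(m, n), then x/n - y/m = gcd(m, n)/(m n) = 1/lcm(m, n).
    unit-lcm : ∀ m n → Unit m → Unit n → Unit (lcm m n)
    unit-lcm m n (u , Gu , mu≈1) (v , Gv , nv≈1) with Bézout.identity (gcd-GCD m n)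
    ... | Bézout.+- x y eq = fromℕ x * v - fromℕ y * u , G-- (G-· x Gv) (G-· y Gu) , lcm-inverse _ (begin
      (M * N) * (X * v - Y * u)         ≈⟨ solve 6 (λ M N u v x y → (M :* N) :* (x :* v :- y :* u) := x :* M :* (N :* v) :- y :* N :* (M :* u)) refl M N u v X Y ⟩
      X * M * (N * v) - Y * N * (M * u) ≈⟨ +-cong (trans (*-congˡ nv≈1) (*-identityʳ _)) (-‿cong (trans (*-congˡ mu≈1) (*-identityʳ _))) ⟩
      X * M - Y * N                     ≈⟨ difference (transport {gcd m n} {x} {m} {y} {n} eq) ⟩
      g                                 ∎)
      where
      open import Relation.Binary.Reasoning.Setoid setoid
      open GcdLcm m n mu≈1 nv≈1
      X = fromℕ x
      Y = fromℕ y
    ... | Bézout.-+ x y eq = fromℕ y * u - fromℕ x * v , G-- (G-· y Gu) (G-· x Gv) , lcm-inverse _ (begin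
      (M * N) * (Y * u - X * v)         ≈⟨ solve 6 (λ M N u v x y → (M :* N) :* (y :* u :- x :* v) := y :* N :* (M :* u) :- x :* M :* (N :* v)) refl M N u v X Y ⟩
      Y * N * (M * u) - X * M * (N * v) ≈⟨ +-cong (trans (*-congˡ mu≈1) (*-identityʳ _)) (-‿cong (trans (*-congˡ nv≈1) (*-identityʳ _))) ⟩
      Y * N - X * M                     ≈⟨ difference (transport {gcd m n} {y} {n} {x} {m} eq) ⟩
      g                                 ∎)
      where
      open import Relation.Binary.Reasoning.Setoid setoid
      open GcdLcm m n mu≈1 nv≈1
      X = fromℕ x
      Y = fromℕ y

    unit-foldr-lcm : G 1# → ∀ {k} (f : Fin k → ℕ) → (∀ i → Unit (f i)) → Unit (Vector.foldr lcm 1 f)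
    unit-foldr-lcm G1 {zero}  f U = 1# , G1 , trans (*-identityʳ _) (+-identityʳ 1#)
    unit-foldr-lcm G1 {suc k} f U = unit-lcm (f zero) _ (U zero) (unit-foldr-lcm G1 (f ∘ suc) (U ∘ suc))

∣foldr-lcm : ∀ {k} (f : Fin k → ℕ) i → f i ℕ.∣ Vector.foldr lcm 1 f
∣foldr-lcm f zero    = m∣lcm[m,n] (f zero) _
∣foldr-lcm f (suc i) = ℕ.∣-trans (∣foldr-lcm (f ∘ suc) i) (n∣lcm[m,n] (f zero) _)

module RationalCase
  (em : ExcludedMiddle 0ℓ) (ℝ : CompleteOrderedField) (L : Language)
  (α : Language.Symbol L → CompleteOrderedField.Carrier ℝ)
  (0<α : ∀ E → CompleteOrderedField._<_ ℝ (CompleteOrderedField.0# ℝ) (α E))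
  (α≤1 : ∀ E → CompleteOrderedField._≤_ ℝ (α E) (CompleteOrderedField.1# ℝ))
  (rational : Predimension.Rational ℝ L α)
  (E₀ : Language.Symbol L)
  where
  open CompleteOrderedField ℝ hiding (zero)
  open OrderedField ℝ
  open Fractions ℝ
  open Solver using (solve; _:=_; _:+_; _:*_; _:-_; :-_; con)
  open Language L
  open Weights ℝ L α
  open Predimension ℝ L α
  open Structure
  open Existence em ℝ L α 0<α α≤1

  denominator : Symbol → ℕ
  denominator E = ↧ₙ (proj₁ (rational E))

  c : ℕ
  c = commonDenominator rational

  numerator : ∀ E → ∃ λ p → fromℕ (denominator E) * α E ≈ fromℕ (suc p) × Coprime.Coprime (suc p) (denominator E)
  numerator E = fraction (proj₁ (rational E)) (0<α E) (proj₂ (rational E))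

  -- The weights enter with nonnegative coefficients, as a list of edges requires. The result is
  -- nevertheless a group: if α E = p/q, then -α E = (q - 1) α E - p.
  IntegralCombination : Carrier → Set
  IntegralCombination x = ∃₂ λ Es n → x + fromℕ n ≈ weight Es

  private
    G = IntegralCombination

    G-cong : ∀ {x y} → x ≈ y → G x → G y
    G-cong e (Es , n , f) = Es , n , trans (+-congʳ (sym e)) f

    G-+ : ∀ {x y} → G x → G y → G (x + y)
    G-+ {x} {y} (Es , m , e) (Fs , n , f) = Es List.++ Fs , m ℕ.+ n , (begin
      (x + y) + fromℕ (m ℕ.+ n)       ≈⟨ +-congˡ (fromℕ-+ m n) ⟩
      (x + y) + (fromℕ m + fromℕ n)   ≈⟨ solve 4 (λ x y m n → (x :+ y) :+ (m :+ n) := (x :+ m) :+ (y :+ n)) refl x y (fromℕ m) (fromℕ n) ⟩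
      (x + fromℕ m) + (y + fromℕ n)   ≈⟨ +-cong e f ⟩
      weight Es + weight Fs           ≈⟨ weight-++ Es Fs ⟨
      weight (Es List.++ Fs)          ∎)
      where open import Relation.Binary.Reasoning.Setoid setoid

    G-1 : G 1#
    G-1 with numerator E₀
    ... | p , e , _ = List.replicate (denominator E₀) E₀ , p , sym (trans (weight-replicate (denominator E₀) E₀) e)

    G-fromℕ : ∀ n → G (fromℕ n)
    G-fromℕ zero    = [] , 0 , +-identityʳ _
    G-fromℕ (suc n) = G-+ G-1 (G-fromℕ n)

    G-neg-α : ∀ E → G (- α E)
    G-neg-α E with numerator E
    ... | p , e , _ = List.replicate d-1 E , suc p , (begin
      - α E + fromℕ (suc p)         ≈⟨ +-congˡ e ⟨
      - α E + fromℕ (suc d-1) * α E ≈⟨ +-congˡ (trans (distribʳ (α E) 1# (fromℕ d-1)) (+-congʳ (*-identityˡ _))) ⟩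
      - α E + (α E + fromℕ d-1 * α E) ≈⟨ solve 2 (λ e d → :- e :+ (e :+ d) := d) refl (α E) (fromℕ d-1 * α E) ⟩
      fromℕ d-1 * α E               ≈⟨ weight-replicate d-1 E ⟨
      weight (List.replicate d-1 E) ∎)
      where
      open import Relation.Binary.Reasoning.Setoid setoid
      d-1 = ℚ.denominator-1 (proj₁ (rational E))

    G-neg-weight : ∀ Es → G (- weight Es)
    G-neg-weight []       = [] , 0 , solve 0 (:- con ℤ.0ℤ :+ con ℤ.0ℤ := con ℤ.0ℤ) refl
    G-neg-weight (E ∷ Es) = G-cong (solve 2 (λ e w → :- e :+ :- w := :- (e :+ w)) refl (α E) (weight Es))
      (G-+ (G-neg-α E) (G-neg-weight Es))

    G-- : ∀ {x y} → G x → G y → G (x - y)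
    G-- {x} {y} Gx (Es , n , e) = G-cong
      (trans (+-congˡ (+-congˡ (-‿cong (sym e)))) (solve 3 (λ x y n → x :+ (n :+ :- (y :+ n)) := x :- y) refl x y (fromℕ n)))
      (G-+ Gx (G-+ (G-fromℕ n) (G-neg-weight Es)))

    G-α : ∀ E → G (α E)
    G-α E = E ∷ [] , 0 , refl

  open SubgroupOfFractions G G-cong G-- hiding (G-+)

  private
    unit-c : Unit c
    unit-c = unit-foldr-lcm G-1 denominator λ E → let p , e , cop = numerator E in unit-coprime cop e G-1 (G-α E)

    c≉0 : ¬ fromℕ c ≈ 0#
    c≉0 e = 0≉1 (trans (sym (trans (*-congʳ e) (zeroˡ _))) (proj₂ (proj₂ unit-c)))

    0<c : 0# < fromℕ c
    0<c = 0≤fromℕ c , λ e → c≉0 (sym e)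

  η : Carrier
  η = fromℕ c ⁻¹

  0<η : 0# < η
  0<η = ⁻¹-pos 0<c

  η-combination : IntegralCombination η
  η-combination with unit-c
  ... | x , Gx , cx≈1 = G-cong (*-cancelˡ c≉0 (trans cx≈1 (sym (*-inverseʳ _ c≉0)))) Gx

  Integral : Carrier → Set
  Integral x = ∃ λ z → fromℕ c * x ≈ fromℤ z

  integral-+ : ∀ {x y} → Integral x → Integral y → Integral (x + y)
  integral-+ (i , e) (j , f) = i ℤ.+ j , trans (distribˡ _ _ _) (trans (+-cong e f) (sym (fromℤ-+ i j)))

  integral-neg : ∀ {x} → Integral x → Integral (- x)
  integral-neg {x} (i , e) = ℤ.- i , trans (solve 2 (λ c x → c :* :- x := :- (c :* x)) refl (fromℕ c) x) (trans (-‿cong e) (sym (fromℤ-neg i)))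

  integral-fromℕ : ∀ n → Integral (fromℕ n)
  integral-fromℕ n = ℤ.+ (c ℕ.* n) , sym (fromℕ-* c n)

  integral-* : ∀ {x} n → Integral x → Integral (x * fromℕ n)
  integral-* {x} n (i , e) = i ℤ.* ℤ.+ n , trans (sym (*-assoc _ _ _)) (trans (*-congʳ e) (sym (fromℤ-* i (ℤ.+ n))))

  integral-α : ∀ E → Integral (α E)
  integral-α E with ∣foldr-lcm denominator E | numerator E
  ... | divides k c≡kd | p , e , _ = ℤ.+ (k ℕ.* suc p) , (begin
    fromℕ c * α E                        ≈⟨ *-congʳ (trans (fromℕ-cong c≡kd) (fromℕ-* k (denominator E))) ⟩
    (fromℕ k * fromℕ (denominator E)) * α E ≈⟨ *-assoc _ _ _ ⟩
    fromℕ k * (fromℕ (denominator E) * α E) ≈⟨ *-congˡ e ⟩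
    fromℕ k * fromℕ (suc p)              ≈⟨ fromℕ-* k (suc p) ⟨
    fromℕ (k ℕ.* suc p)                  ∎)
    where open import Relation.Binary.Reasoning.Setoid setoid

  integral-weight : ∀ Es → Integral (weight Es)
  integral-weight []       = integral-fromℕ 0
  integral-weight (E ∷ Es) = integral-+ (integral-α E) (integral-weight Es)

  integral-sum : ∀ {k} (f : Fin k → Carrier) → (∀ i → Integral (f i)) → Integral (sum f)
  integral-sum {zero}  f int = integral-fromℕ 0
  integral-sum {suc k} f int = integral-+ (int zero) (integral-sum (f ∘ suc) (int ∘ suc))

  -- The integer c x is either nonnegative or at most -1. As all partial weights are integral in
  -- this sense, every list has the gap property.
  integral-gap : ∀ {x} → Integral x → 0# ≤ x ⊎ x + η ≤ 0#
  integral-gap {x} (ℤ.+ n , e) = inj₁ (*-cancelˡ-≤ 0<c (≤-cong (sym (zeroʳ _)) (sym e) (0≤fromℕ n)))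
  integral-gap {x} (ℤ.-[1+ n ] , e) = inj₂ (*-cancelˡ-≤ 0<c (lin₁ (0≤fromℕ n) (begin
    fromℕ n + fromℕ c * (x + η)           ≈⟨ +-congˡ (trans (distribˡ _ _ _) (+-cong e (*-inverseʳ _ c≉0))) ⟩
    fromℕ n + (- (1# + fromℕ n) + 1#)     ≈⟨ solve 3 (λ o n c → n :+ (:- (o :+ n) :+ o) := con ℤ.0ℤ :+ c :* con ℤ.0ℤ) refl 1# (fromℕ n) (fromℕ c) ⟩
    0# + fromℕ c * 0#                     ∎)))
    where open import Relation.Binary.Reasoning.Setoid setoid

  integral-pos : ∀ {x} → Integral x → 0# < x → η ≤ x
  integral-pos {x} int 0<x with integral-gap (integral-neg int)
  ... | inj₁ p = contradiction (lin₁ p (solve 1 (λ x → :- x :+ x := con ℤ.0ℤ :+ con ℤ.0ℤ) refl x)) (<⇒≱ 0<x)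
  ... | inj₂ p = lin₁ p (solve 2 (λ x η → con ℤ.0ℤ :+ η := (:- x :+ η) :+ x) refl x η)

  private
    -- If α E₀ = p/q, then q copies of E₀ have integer weight p, so n can be enlarged without
    -- changing η.
    weight-padded : ∀ k Es n → η + fromℕ n ≈ weight Es →
      weight (List.replicate (k ℕ.* denominator E₀) E₀ List.++ Es) ≈ fromℕ (k ℕ.* suc (proj₁ (numerator E₀)) ℕ.+ n) + η
    weight-padded k Es n e = begin
      weight (List.replicate (k ℕ.* d) E₀ List.++ Es)  ≈⟨ weight-++ (List.replicate (k ℕ.* d) E₀) Es ⟩
      weight (List.replicate (k ℕ.* d) E₀) + weight Es ≈⟨ +-cong (weight-replicate (k ℕ.* d) E₀) (sym e) ⟩
      fromℕ (k ℕ.* d) * α E₀ + (η + fromℕ n)           ≈⟨ +-congʳ multiple ⟩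
      fromℕ (k ℕ.* p) + (η + fromℕ n)                  ≈⟨ solve 3 (λ k η n → k :+ (η :+ n) := (k :+ n) :+ η) refl (fromℕ (k ℕ.* p)) η (fromℕ n) ⟩
      (fromℕ (k ℕ.* p) + fromℕ n) + η                  ≈⟨ +-congʳ (fromℕ-+ (k ℕ.* p) n) ⟨
      fromℕ (k ℕ.* p ℕ.+ n) + η                        ∎
      where
      open import Relation.Binary.Reasoning.Setoid setoid
      d = denominator E₀
      p = suc (proj₁ (numerator E₀))
      multiple : fromℕ (k ℕ.* d) * α E₀ ≈ fromℕ (k ℕ.* p)
      multiple = begin
        fromℕ (k ℕ.* d) * α E₀       ≈⟨ *-congʳ (fromℕ-* k d) ⟩
        fromℕ k * fromℕ d * α E₀     ≈⟨ *-assoc _ _ _ ⟩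
        fromℕ k * (fromℕ d * α E₀)   ≈⟨ *-congˡ (proj₁ (proj₂ (numerator E₀))) ⟩
        fromℕ k * fromℕ p            ≈⟨ fromℕ-* k p ⟨
        fromℕ (k ℕ.* p)              ∎

    spread : ∀ Es → Chunks.Spread ℝ L α η 0# Es
    spread Es Fs _ _ i = integral-gap (integral-+ (integral-+ (integral-fromℕ 0) (integral-fromℕ i)) (integral-neg (integral-weight Fs)))

    integral-δ : ∀ 𝔄 → Integral (δ 𝔄)
    integral-δ 𝔄 = integral-+ (integral-fromℕ ∣ ⊤ˢ {card 𝔄} ∣) (integral-neg (integral-sum _ λ E → integral-* (N 𝔄 E ⊤ˢ) (integral-α E)))

  rational-case : (𝔄 : Structure) → Kα 𝔄 → 0# < δ 𝔄 → ¬ (arity E₀ ≡ 2 × α E₀ ≈ 1#) → ∀ B → ∃ λ n → B ℕ.≤ n × Realises 𝔄 η n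
  rational-case 𝔄 𝔄∈Kα 0<δ ¬excluded B = n′ , ℕ.≤-trans (ℕ.m≤m+n B C) k≤n′ ,
    proj₂ bound Fs 0<η (λ F → integral-pos (integral-α F) (0<α F)) (integral-pos (integral-δ 𝔄) 0<δ)
      (ℕ.≤-trans (ℕ.m≤n+m C B) k≤n′) (ℕ.≤-trans (ℕ.m≤n+m C B) k≤count) (spread Fs)
      (weight-padded k Es n (proj₂ (proj₂ η-combination)))
    where
    bound = realise 𝔄 𝔄∈Kα E₀ ¬excluded
    C = proj₁ bound
    k = B ℕ.+ C
    Es = proj₁ η-combination
    n = proj₁ (proj₂ η-combination)
    Fs = List.replicate (k ℕ.* denominator E₀) E₀ List.++ Es
    n′ = k ℕ.* suc (proj₁ (numerator E₀)) ℕ.+ n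

    k≤n′ : k ℕ.≤ n′
    k≤n′ = ℕ.≤-trans (ℕ.m≤m*n k (suc (proj₁ (numerator E₀)))) (ℕ.m≤m+n _ n)

    k≤count : k ℕ.≤ count E₀ Fs
    k≤count = ℕ.≤-trans (ℕ.m≤m*n k (denominator E₀)) (count-replicate (k ℕ.* denominator E₀) E₀ Es)

-- Irrational weights

least : ExcludedMiddle 0ℓ → {P : Pred ℕ 0ℓ} → ∃ P → ∃ λ m → P m × (∀ {k} → k ℕ.< m → ¬ P k)
least em {P} (m , p) = <-rec (λ m → P m → ∃ λ m → P m × (∀ {k} → k ℕ.< m → ¬ P k)) go m p
  where
  go : ∀ m → (∀ {k} → k ℕ.< m → P k → ∃ λ m → P m × (∀ {k} → k ℕ.< m → ¬ P k)) → P m → ∃ λ m → P m × (∀ {k} → k ℕ.< m → ¬ P k)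
  go m rec p with em {∃ λ k → k ℕ.< m × P k}
  ... | yes (k , k<m , q) = rec k<m q
  ... | no ¬∃ = m , p , λ {k} k<m q → ¬∃ (k , k<m , q)

module IrrationalMultiples (em : ExcludedMiddle 0ℓ) (ℝ : CompleteOrderedField)
  (β : CompleteOrderedField.Carrier ℝ)
  (0<β : CompleteOrderedField._<_ ℝ (CompleteOrderedField.0# ℝ) β)
  (β≤1 : CompleteOrderedField._≤_ ℝ β (CompleteOrderedField.1# ℝ))
  (irrational : ¬ ∃ λ q → CompleteOrderedField._≈_ ℝ β (CompleteOrderedField.fromℚ ℝ q))
  where
  open CompleteOrderedField ℝ hiding (zero)
  open OrderedField ℝ
  open PositiveMinima ℝ
  open Fractions ℝ
  open Solver using (solve; _:=_; _:+_; _:*_; _:-_; :-_; con)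

  excess : ℕ → ℕ → Carrier
  excess m i = fromℕ m * β - fromℕ i

  multiple≉integer : ∀ m i → ¬ fromℕ (suc m) * β ≈ fromℕ i
  multiple≉integer m i e = irrational (ℤ.+ i ℚ./ suc m , rational-quotient m i e)

  β≉1 : ¬ β ≈ 1#
  β≉1 e = multiple≉integer 0 1 (trans (*-congʳ (+-identityʳ 1#)) (trans (*-identityˡ β) (trans e (sym (+-identityʳ 1#)))))

  private
    excess-0 : ∀ i → ¬ 0# < excess 0 i
    excess-0 i p = <⇒≱ p (lin₁ (0≤fromℕ i) (solve 2 (λ i β → i :+ (con ℤ.0ℤ :* β :- i) := con ℤ.0ℤ :+ con ℤ.0ℤ) refl (fromℕ i) β))

    excess≉0 : ∀ m i → 0# ≤ excess (suc m) i → 0# < excess (suc m) i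
    excess≉0 m i p = p , λ e → multiple≉integer m i (trans (solve 2 (λ x i → x := (x :- i) :+ i) refl (fromℕ (suc m) * β) (fromℕ i))
      (trans (+-congʳ (sym e)) (+-identityˡ _)))

  -- Reducing x modulo (1 modulo x) halves x.
  halve : ∀ m i → 0# < excess m i → ∃₂ λ m′ i′ → 0# < excess m′ i′ × excess m′ i′ + excess m′ i′ ≤ excess m i
  halve zero    i 0<x = contradiction 0<x (excess-0 i)
  halve (suc m) i 0<x = suc m′ , i′ , excess≉0 m′ i′ (≤-cong refl x-kz≈ (proj₁ (proj₂ mod-z))) , (≤-cong (+-cong x-kz≈ x-kz≈) refl halved)
    where
    x = excess (suc m) i
    -- In z = 1 - j x the coefficient of β is not positive, so z need not be an excess; the second
    -- reduction x - k z has a positive coefficient again.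
    mod-x = modulo em 0<x 0≤1
    j = proj₁ mod-x
    z = 1# - fromℕ j * x
    z<x : z < x
    z<x = proj₂ (proj₂ mod-x)
    0<z : 0# < z
    0<z = proj₁ (proj₂ mod-x) , λ 0≈z → nonzero j (trans (solve 2 (λ o y → y := o :- (o :- y)) refl 1# (fromℕ j * x))
                                     (trans (+-congˡ (-‿cong (sym 0≈z))) (solve 1 (λ o → o :- con ℤ.0ℤ := o) refl 1#)))
      where
      nonzero : ∀ j → ¬ fromℕ j * x ≈ 1#
      nonzero zero    e = 0≉1 (trans (sym (zeroˡ x)) e)
      nonzero (suc j) e = multiple≉integer (m ℕ.+ j ℕ.* suc m) (1 ℕ.+ suc j ℕ.* i) (begin
        fromℕ (suc j ℕ.* suc m) * β             ≈⟨ *-congʳ (fromℕ-* (suc j) (suc m)) ⟩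
        fromℕ (suc j) * fromℕ (suc m) * β       ≈⟨ solve 4 (λ J M β I → J :* M :* β := J :* (M :* β :- I) :+ J :* I) refl (fromℕ (suc j)) (fromℕ (suc m)) β (fromℕ i) ⟩
        fromℕ (suc j) * x + fromℕ (suc j) * fromℕ i ≈⟨ +-cong e (sym (fromℕ-* (suc j) i)) ⟩
        fromℕ (1 ℕ.+ suc j ℕ.* i)               ∎)
        where open import Relation.Binary.Reasoning.Setoid setoid
    mod-z = modulo em 0<z (proj₁ 0<x)
    k = proj₁ mod-z
    m′ = m ℕ.+ (k ℕ.* j) ℕ.* suc m
    i′ = i ℕ.+ k ℕ.* (1 ℕ.+ j ℕ.* i)
    x-kz≈ : x - fromℕ k * z ≈ excess (suc m′) i′
    x-kz≈ = begin
      x - K * z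
        ≈⟨ solve 6 (λ o M β I K J → (M :* β :- I) :- K :* (o :- J :* (M :* β :- I)) := (M :+ K :* J :* M) :* β :- (I :+ K :* (o :+ J :* I))) refl 1# (fromℕ (suc m)) β (fromℕ i) K J ⟩
      (fromℕ (suc m) + K * J * fromℕ (suc m)) * β - (fromℕ i + K * (1# + J * fromℕ i))
        ≈⟨ +-cong (*-congʳ (sym m-eq)) (-‿cong (sym i-eq)) ⟩
      excess (suc m′) i′ ∎
      where
      open import Relation.Binary.Reasoning.Setoid setoid
      K = fromℕ k
      J = fromℕ j
      m-eq : fromℕ (suc m′) ≈ fromℕ (suc m) + K * J * fromℕ (suc m)
      m-eq = trans (fromℕ-+ (suc m) ((k ℕ.* j) ℕ.* suc m)) (+-congˡ (trans (fromℕ-* (k ℕ.* j) (suc m)) (*-congʳ (fromℕ-* k j))))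
      i-eq : fromℕ i′ ≈ fromℕ i + K * (1# + J * fromℕ i)
      i-eq = trans (fromℕ-+ i (k ℕ.* (1 ℕ.+ j ℕ.* i))) (+-congˡ (trans (fromℕ-* k (1 ℕ.+ j ℕ.* i)) (*-congˡ (+-congˡ (fromℕ-* j i)))))
    x′<z : x - fromℕ k * z < z
    x′<z = proj₂ (proj₂ mod-z)
    halved : (x - fromℕ k * z) + (x - fromℕ k * z) ≤ x
    -- As z < x, the quotient k is at least 1, so the remainder x′ is at most x - z; with x′ < z
    -- this gives 2 x′ ≤ x.
    halved = go k x′<z
      where
      go : ∀ k → x - fromℕ k * z < z → (x - fromℕ k * z) + (x - fromℕ k * z) ≤ x
      go zero    x<z = contradiction (≤-trans (proj₁ z<x) (≤-reflexive (solve 2 (λ x z → x := x :- con ℤ.0ℤ :* z) refl x z))) (<⇒≱ x<z)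
      go (suc k) (x′≤z , _) = lin₂ x′≤z (*-nonNeg (0≤fromℕ k) (proj₁ 0<z))
        (trans (+-congˡ (+-cong y≈ y≈)) (trans (solve 3 (λ x z w → (z :+ w) :+ ((x :- (z :+ w)) :+ (x :- (z :+ w))) := ((x :- (z :+ w)) :+ con ℤ.0ℤ) :+ x) refl x z (fromℕ k * z))
          (+-congʳ (+-congʳ (sym y≈)))))
        where
        y≈ : x - fromℕ (suc k) * z ≈ x - (z + fromℕ k * z)
        y≈ = +-congˡ (-‿cong (trans (distribʳ z 1# (fromℕ k)) (+-congʳ (*-identityˡ z))))

  small-power : ∀ k → ∃₂ λ m i → 0# < excess m i × fromℕ (2 ℕ.^ k) * excess m i ≤ 1#
  small-power zero = 1 , 0 , excess≉0 0 0 (≤-cong refl (sym excess≈β) (proj₁ 0<β)) ,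
    ≤-trans (≤-reflexive (trans (*-congʳ (+-identityʳ 1#)) (trans (*-identityˡ _) excess≈β))) β≤1
    where
    excess≈β : excess 1 0 ≈ β
    excess≈β = trans (+-congʳ (trans (*-congʳ (+-identityʳ 1#)) (*-identityˡ β))) (solve 1 (λ β → β :- con ℤ.0ℤ := β) refl β)
  small-power (suc k) with small-power k
  ... | m , i , 0<x , p with halve m i 0<x
  ...   | m′ , i′ , 0<x′ , q = m′ , i′ , 0<x′ , ≤-trans
    (≤-reflexive (trans (*-congʳ (trans (fromℕ-+ (2 ℕ.^ k) _) (+-congˡ (fromℕ-+ (2 ℕ.^ k) 0))))
      (solve 2 (λ P y → (P :+ (P :+ con ℤ.0ℤ)) :* y := P :* (y :+ y)) refl (fromℕ (2 ℕ.^ k)) (excess m′ i′))))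
    (≤-trans (*-monoʳ-≤ (0≤fromℕ (2 ℕ.^ k)) q) p)

  small : ∀ ε → 0# < ε → ∃₂ λ m i → 0# < excess m i × excess m i < ε
  small ε 0<ε with archimedean-* em 0<ε 1#
  ... | N , 1≤Nε with small-power N
  ...   | m , i , 0<x , p = m , i , 0<x , ≰⇒> λ ε≤x → <⇒≱ 0<x
    (lin₃ p (*-monoˡ (fromℕ-mono (2^n>n N))) (≤-trans 1≤Nε (*-monoʳ-≤ (0≤fromℕ N) ε≤x))
      (trans (solve 4 (λ o P n x → (o :+ P :+ n) :+ x := (P :+ (x :+ n) :+ o) :+ con ℤ.0ℤ) refl 1# (fromℕ (2 ℕ.^ N) * x) (fromℕ N * x) x)
        (+-congʳ (+-congʳ (+-congˡ (sym (trans (distribʳ x 1# (fromℕ N)) (+-congʳ (*-identityˡ x)))))))))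
    where
    x = excess m i
    *-monoˡ : ∀ {y z} → y ≤ z → y * x ≤ z * x
    *-monoˡ p = ≤-cong (*-comm _ _) (*-comm _ _) (*-monoʳ-≤ (proj₁ 0<x) p)
    2^n>n : ∀ n → n ℕ.< 2 ℕ.^ n
    2^n>n zero    = ℕ.z<s
    2^n>n (suc n) = ℕ.≤-trans (ℕ.+-mono-≤ (ℕ.≤-trans (ℕ.s≤s z≤n) (2^n>n n)) (2^n>n n)) (ℕ.≤-reflexive (≡.cong (2 ℕ.^ n ℕ.+_) (≡.sym (ℕ.+-identityʳ _))))

  private
    step-excess : ∀ m {i i′} → i ℕ.< i′ → excess m i′ + 1# ≤ excess m i
    step-excess m {i} {i′} i<i′ = lin₁ (fromℕ-mono i<i′) (solve 4 (λ o x i i′ → i′ :+ (x :- i′ :+ o) := (o :+ i) :+ (x :- i)) refl 1# (fromℕ m * β) (fromℕ i) (fromℕ i′))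

  -- For fixed m the excesses differ by integers: those with smaller i′ are larger, and those with
  -- larger i′ are at most `excess m i` - 1 ≤ 0.
  gap-at : ∀ m i → excess m i ≤ 1# → ∀ i′ → excess m i′ ≤ 0# ⊎ excess m i ≤ excess m i′
  gap-at m i x≤1 i′ with i′ ℕ.≤? i
  ... | yes p = inj₂ (lin₁ (fromℕ-mono p) (solve 3 (λ x i i′ → i :+ (x :- i) := i′ :+ (x :- i′)) refl (fromℕ m * β) (fromℕ i) (fromℕ i′)))
  ... | no ¬p = inj₁ (lin₂ (step-excess m (ℕ.≰⇒> ¬p)) x≤1 (solve 3 (λ o x y → (x :+ o) :+ y := ((y :+ o) :+ x) :+ con ℤ.0ℤ) refl 1# (excess m i) (excess m i′)))

  -- By induction on J, either ε′ is kept or it is lowered to a positive excess at J not exceeding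
  -- it. An excess in (0, ε′) can then occur only at an index that is at least J.
  avoid : ∀ J ε → 0# < ε → ε ≤ 1# →
    ∃ λ ε′ → 0# < ε′ × ε′ ≤ ε × (∀ {m} → m ℕ.< J → ∀ i → excess m i ≤ 0# ⊎ ε′ ≤ excess m i)
  avoid zero    ε 0<ε ε≤1 = ε , 0<ε , ≤-refl , λ ()
  avoid (suc J) ε 0<ε ε≤1 with avoid J ε 0<ε ε≤1
  ... | ε′ , 0<ε′ , ε′≤ε , gap with em {∃ λ i → 0# < excess J i × excess J i ≤ ε′}
  ...   | yes (i , 0<x , x≤ε′) = excess J i , 0<x , ≤-trans x≤ε′ ε′≤ε , gap′
    where
    gap′ : ∀ {m} → m ℕ.< suc J → ∀ i′ → excess m i′ ≤ 0# ⊎ excess J i ≤ excess m i′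
    gap′ {m} m<1+J i′ with ℕ.m≤n⇒m<n∨m≡n (ℕ.s≤s⁻¹ m<1+J)
    ... | inj₁ m<J    = Sum.map₂ (≤-trans x≤ε′) (gap m<J i′)
    ... | inj₂ ≡.refl = gap-at J i (≤-trans x≤ε′ (≤-trans ε′≤ε ε≤1)) i′
  ...   | no ¬∃ = ε′ , 0<ε′ , ε′≤ε , gap′
    where
    gap′ : ∀ {m} → m ℕ.< suc J → ∀ i′ → excess m i′ ≤ 0# ⊎ ε′ ≤ excess m i′
    gap′ {m} m<1+J i′ with ℕ.m≤n⇒m<n∨m≡n (ℕ.s≤s⁻¹ m<1+J)
    ... | inj₁ m<J    = gap m<J i′
    ... | inj₂ ≡.refl with em {excess m i′ ≤ 0#}
    ...   | yes p = inj₁ p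
    ...   | no ¬p = inj₂ (proj₁ (≰⇒> λ q → ¬∃ (i′ , ≰⇒> ¬p , q)))

  -- M is the least index with an excess in (0, ε′), for ε′ from `avoid`. Minimality makes this
  -- excess a lower bound for all positive excesses up to M, and the choice of ε′ forces J ≤ M.
  record-excess : ∀ J ε → 0# < ε → ε ≤ 1# → ∃₂ λ M n → J ℕ.≤ M × 0# < excess M n × excess M n < ε ×
    (∀ {m} → m ℕ.≤ M → ∀ i → excess m i ≤ 0# ⊎ excess M n ≤ excess m i)
  record-excess J ε 0<ε ε≤1 = search (avoid J ε 0<ε ε≤1)
    where
    Best : Set
    Best = ∃₂ λ M n → J ℕ.≤ M × 0# < excess M n × excess M n < ε ×
      (∀ {m} → m ℕ.≤ M → ∀ i → excess m i ≤ 0# ⊎ excess M n ≤ excess m i)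
    Small : Carrier → ℕ → Set
    Small ε′ m = ∃ λ i → 0# < excess m i × excess m i < ε′
    conclude : ∀ ε′ → ε′ ≤ ε → (∀ {m} → m ℕ.< J → ∀ i → excess m i ≤ 0# ⊎ ε′ ≤ excess m i) →
      (∃ λ M → Small ε′ M × (∀ {m} → m ℕ.< M → ¬ Small ε′ m)) → Best
    conclude ε′ ε′≤ε gap (M , (n , 0<x , x<ε′) , minimal) = M , n , ℕ.≮⇒≥ M≮J , 0<x , <-≤-trans x<ε′ ε′≤ε , best
      where
      M≮J : ¬ M ℕ.< J
      M≮J M<J = [ <⇒≱ 0<x , <⇒≱ x<ε′ ]′ (gap M<J n)
      best : ∀ {m} → m ℕ.≤ M → ∀ i → excess m i ≤ 0# ⊎ excess M n ≤ excess m i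
      best {m} m≤M i with ℕ.m≤n⇒m<n∨m≡n m≤M
      ... | inj₂ ≡.refl = gap-at M n (≤-trans (proj₁ x<ε′) (≤-trans ε′≤ε ε≤1)) i
      ... | inj₁ m<M with em {excess m i ≤ 0#}
      ...   | yes p = inj₁ p
      ...   | no ¬p = inj₂ (proj₁ (≰⇒> λ q → minimal m<M (i , ≰⇒> ¬p , ≤-<-trans q x<ε′)))
    search : (∃ λ ε′ → 0# < ε′ × ε′ ≤ ε × (∀ {m} → m ℕ.< J → ∀ i → excess m i ≤ 0# ⊎ ε′ ≤ excess m i)) → Best
    search (ε′ , 0<ε′ , ε′≤ε , gap) = conclude ε′ ε′≤ε gap (least em (small ε′ 0<ε′))

module IrrationalCase
  (em : ExcludedMiddle 0ℓ) (ℝ : CompleteOrderedField) (L : Language)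
  (α : Language.Symbol L → CompleteOrderedField.Carrier ℝ)
  (0<α : ∀ E → CompleteOrderedField._<_ ℝ (CompleteOrderedField.0# ℝ) (α E))
  (α≤1 : ∀ E → CompleteOrderedField._≤_ ℝ (α E) (CompleteOrderedField.1# ℝ))
  (E : Language.Symbol L)
  (irrational : ¬ ∃ λ q → CompleteOrderedField._≈_ ℝ (α E) (CompleteOrderedField.fromℚ ℝ q))
  where
  open CompleteOrderedField ℝ hiding (zero)
  open OrderedField ℝ
  open PositiveMinima ℝ
  open Solver using (solve; _:=_; _:+_; _:*_; _:-_; :-_; con)
  open Language L
  open Weights ℝ L α
  open Predimension ℝ L α
  open Structure
  open Existence em ℝ L α 0<α α≤1
  open IrrationalMultiples em ℝ (α E) (0<α E) (α≤1 E) irrational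

  private
    replicate-prefix : ∀ M Fs {Gs} → List.replicate M E ≡ Fs List.++ Gs → Fs ≡ List.replicate (length Fs) E × length Fs ℕ.≤ M
    replicate-prefix M       []       e = ≡.refl , z≤n
    replicate-prefix (suc M) (F ∷ Fs) e with List.∷-injective e
    ... | ≡.refl , e′ with replicate-prefix M Fs e′
    ...   | p , q = ≡.cong (E ∷_) p , s≤s q

    -- A prefix of length m weighs m α E, so the partial balances are the numbers -`excess m i`.
    spread : ∀ {M n} → (∀ {m} → m ℕ.≤ M → ∀ i → excess m i ≤ 0# ⊎ excess M n ≤ excess m i) →
      Chunks.Spread ℝ L α (excess M n) 0# (List.replicate M E)
    spread {M} {n} best Fs Gs e i = Sum.map
      (λ p → lin₁ p (trans (solve 1 (λ z → con ℤ.0ℤ :+ con ℤ.0ℤ := z :+ (con ℤ.0ℤ :- z)) refl (excess m i)) (+-congˡ x≈)))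
      (λ p → lin₁ p (trans (+-congˡ (+-congʳ (sym x≈)))
        (solve 2 (λ z η → z :+ ((con ℤ.0ℤ :- z) :+ η) := η :+ con ℤ.0ℤ) refl (excess m i) (excess M n))))
      (best (proj₂ (replicate-prefix M Fs e)) i)
      where
      m = length Fs
      x≈ : 0# - excess m i ≈ 0# + fromℕ i - weight Fs
      x≈ = trans (solve 2 (λ w i → con ℤ.0ℤ :- (w :- i) := con ℤ.0ℤ :+ i :- w) refl (fromℕ m * α E) (fromℕ i))
        (+-congˡ (-‿cong (trans (sym (weight-replicate m E)) (weight-cong (≡.sym (proj₁ (replicate-prefix M Fs e)))))))

    integer-part≥ : ∀ {B J M n} → fromℕ (suc B) ≤ fromℕ J * α E → J ℕ.≤ M → excess M n ≤ 1# → B ℕ.≤ n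
    integer-part≥ {B} {J} {M} {n} p J≤M x≤1 = fromℕ-cancel (lin₃ p
      (≤-cong (*-comm _ _) (*-comm _ _) (*-monoʳ-≤ (proj₁ (0<α E)) (fromℕ-mono J≤M))) x≤1
      (solve 5 (λ o b j m n → (j :+ m :+ o) :+ b := ((o :+ b) :+ j :+ (m :- n)) :+ n) refl 1# (fromℕ B) (fromℕ J * α E) (fromℕ M * α E) (fromℕ n)))

  irrational-case : (𝔄 : Structure) → Kα 𝔄 → 0# < δ 𝔄 → ∀ ε → 0# < ε → ∀ B →
    ∃₂ λ η n → η < ε × 0# < η × B ℕ.≤ n × Realises 𝔄 η n
  irrational-case 𝔄 𝔄∈Kα 0<δ ε 0<ε B = conclude (realise 𝔄 𝔄∈Kα E (β≉1 ∘ proj₂))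
    where
    -- The bound ε₃ for η lies below ε, δ 𝔄, all weights and 1.
    μ = min-pos-Fin α 0<α
    ε₁ = min-pos 0<ε 0<δ
    ε₂ = min-pos (proj₁ (proj₂ ε₁)) (proj₁ (proj₂ μ))
    ε₃ = min-pos (proj₁ (proj₂ ε₂)) 0<1
    ε₃≤ε₂ = proj₁ (proj₂ (proj₂ ε₃))
    ε₃≤1 = proj₂ (proj₂ (proj₂ ε₃))
    ε₃≤ε₁ = ≤-trans ε₃≤ε₂ (proj₁ (proj₂ (proj₂ ε₂)))
    ε₃≤ε = ≤-trans ε₃≤ε₁ (proj₁ (proj₂ (proj₂ ε₁)))
    ε₃≤δ = ≤-trans ε₃≤ε₁ (proj₂ (proj₂ (proj₂ ε₁)))
    ε₃≤α : ∀ F → proj₁ ε₃ ≤ α F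
    ε₃≤α F = ≤-trans (≤-trans ε₃≤ε₂ (proj₂ (proj₂ (proj₂ ε₂)))) (proj₂ (proj₂ μ) F)

    conclude : (∃ λ C → ∀ {η n} Es → 0# < η → (∀ F → η ≤ α F) → η ≤ δ 𝔄 → C ℕ.≤ n → C ℕ.≤ count E Es →
                 Chunks.Spread ℝ L α η 0# Es → weight Es ≈ fromℕ n + η → Realises 𝔄 η n) →
               ∃₂ λ η n → η < ε × 0# < η × B ℕ.≤ n × Realises 𝔄 η n
    conclude (C , go) = approximate (archimedean-* em (0<α E) (fromℕ (suc (B ℕ.+ C))))
      where
      approximate : (∃ λ J → fromℕ (suc (B ℕ.+ C)) ≤ fromℕ J * α E) → ∃₂ λ η n → η < ε × 0# < η × B ℕ.≤ n × Realises 𝔄 η n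
      approximate (J , p) = finish (record-excess (J ℕ.+ C) (proj₁ ε₃) (proj₁ (proj₂ ε₃)) ε₃≤1)
        where
        finish : (∃₂ λ M n → J ℕ.+ C ℕ.≤ M × 0# < excess M n × excess M n < proj₁ ε₃ ×
                   (∀ {m} → m ℕ.≤ M → ∀ i → excess m i ≤ 0# ⊎ excess M n ≤ excess m i)) →
                 ∃₂ λ η n → η < ε × 0# < η × B ℕ.≤ n × Realises 𝔄 η n
        finish (M , n , J+C≤M , 0<η , η<ε₃@(η≤ε₃ , _) , best) =
          excess M n , n , <-≤-trans η<ε₃ ε₃≤ε , 0<η , ℕ.≤-trans (ℕ.m≤m+n B C) B+C≤n ,
          go (List.replicate M E) 0<η (λ F → ≤-trans η≤ε₃ (ε₃≤α F)) (≤-trans η≤ε₃ ε₃≤δ)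
            (ℕ.≤-trans (ℕ.m≤n+m C B) B+C≤n) (ℕ.≤-trans (ℕ.≤-trans (ℕ.m≤n+m C J) J+C≤M) M≤count)
            (spread {n = n} best) (trans (weight-replicate M E) (solve 2 (λ x n → x := n :+ (x :- n)) refl (fromℕ M * α E) (fromℕ n)))
          where
          B+C≤n : B ℕ.+ C ℕ.≤ n
          B+C≤n = integer-part≥ {J = J} p (ℕ.≤-trans (ℕ.m≤m+n J C) J+C≤M) (≤-trans η≤ε₃ ε₃≤1)
          M≤count : M ℕ.≤ count E (List.replicate M E)
          M≤count = ≡.subst (λ Es → M ℕ.≤ count E Es) (List.++-identityʳ (List.replicate M E)) (count-replicate M E [])

theorem3p33 :
  ExcludedMiddle 0ℓ →
  (ℝ : CompleteOrderedField) (L : Language) →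
  let open CompleteOrderedField ℝ
      open Language L in
  (α : Symbol → Carrier) →
  let open Predimension ℝ L α in
  (∀ E → 0# < α E × α E ≤ 1#) →
  ¬ (∀ E → arity E ≡ 2 × α E ≈ 1#) →
  (𝔄 : Structure) → Kα 𝔄 → 0# < δ 𝔄 →
  (¬ Rational → ∀ ε → 0# < ε →
    InfinitelyManyNonIsomorphic λ 𝔇 →
      Kα 𝔇 × (Σ[ ι ∈ Embedding 𝔄 𝔇 ]
        EssentialMinimalPair ι × (- ε) < δ/ ι × δ/ ι < 0#))
  ×
  ((rational : Rational) →
    InfinitelyManyNonIsomorphic λ 𝔇 →
      Kα 𝔇 × (Σ[ ι ∈ Embedding 𝔄 𝔇 ]
        EssentialMinimalPair ι ×
        δ/ ι ≈ - (fromℕ (commonDenominator rational) ⁻¹)))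
theorem3p33 em ℝ L α α-bounds ¬excluded 𝔄 𝔄∈Kα 0<δ = irrational-part , rational-part
  where
  open CompleteOrderedField ℝ hiding (zero)
  open OrderedField ℝ
  open Solver using (solve; _:=_; _:+_; _:*_; _:-_; :-_; con)
  open Language L
  open Predimension ℝ L α
  open Structure

  0<α : ∀ E → 0# < α E
  0<α E = proj₁ (α-bounds E)

  α≤1 : ∀ E → α E ≤ 1#
  α≤1 E = proj₂ (α-bounds E)

  counterexample : ∀ {P : Symbol → Set} → ¬ (∀ E → P E) → ∃ λ E → ¬ P E
  counterexample ¬∀ = decidable-stable em λ ¬∃ → ¬∀ λ E → decidable-stable em λ ¬p → ¬∃ (E , ¬p)

  irrational-part : ¬ Rational → ∀ ε → 0# < ε → InfinitelyManyNonIsomorphic λ 𝔇 →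
    Kα 𝔇 × (Σ[ ι ∈ Embedding 𝔄 𝔇 ] EssentialMinimalPair ι × (- ε) < δ/ ι × δ/ ι < 0#)
  irrational-part ¬rational ε 0<ε = unbounded⇒infinitelyMany λ B → extract B (irrational-case 𝔄 𝔄∈Kα 0<δ ε 0<ε B)
    where
    irrational-symbol : ∃ λ E → ¬ ∃ λ q → α E ≈ fromℚ q
    irrational-symbol = counterexample ¬rational
    open IrrationalCase em ℝ L α 0<α α≤1 (proj₁ irrational-symbol) (proj₂ irrational-symbol)
    extract : ∀ B → (∃₂ λ η n → η < ε × 0# < η × B ℕ.≤ n × Existence.Realises em ℝ L α 0<α α≤1 𝔄 η n) →
      Σ[ 𝔇 ∈ Structure ] B ℕ.≤ card 𝔇 × Kα 𝔇 × (Σ[ ι ∈ Embedding 𝔄 𝔇 ] EssentialMinimalPair ι × (- ε) < δ/ ι × δ/ ι < 0#)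
    extract B (η , n , η<ε , 0<η , B≤n , 𝔇 , n≤ , 𝔇∈Kα , ι , pair , δ≈-η) =
      𝔇 , ℕ.≤-trans B≤n n≤ , 𝔇∈Kα , ι , pair ,
      <-cong refl (sym δ≈-η) (≰⇒> λ p → <⇒≱ η<ε (lin₁ p (solve 2 (λ η ε → :- ε :+ ε := :- η :+ η) refl η ε))) ,
      <-cong (sym δ≈-η) refl (≰⇒> λ p → <⇒≱ 0<η (lin₁ p (solve 1 (λ η → :- η :+ η := con ℤ.0ℤ :+ con ℤ.0ℤ) refl η)))

  rational-part : (rational : Rational) → InfinitelyManyNonIsomorphic λ 𝔇 →
    Kα 𝔇 × (Σ[ ι ∈ Embedding 𝔄 𝔇 ] EssentialMinimalPair ι × δ/ ι ≈ - (fromℕ (commonDenominator rational) ⁻¹))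
  rational-part rational = unbounded⇒infinitelyMany λ B → extract B (rational-case 𝔄 𝔄∈Kα 0<δ (proj₂ symbol) B)
    where
    symbol : ∃ λ E → ¬ (arity E ≡ 2 × α E ≈ 1#)
    symbol = counterexample ¬excluded
    open RationalCase em ℝ L α 0<α α≤1 rational (proj₁ symbol)
    extract : ∀ B → (∃ λ n → B ℕ.≤ n × Existence.Realises em ℝ L α 0<α α≤1 𝔄 η n) →
      Σ[ 𝔇 ∈ Structure ] B ℕ.≤ card 𝔇 × Kα 𝔇 × (Σ[ ι ∈ Embedding 𝔄 𝔇 ] EssentialMinimalPair ι × δ/ ι ≈ - (fromℕ (commonDenominator rational) ⁻¹))
    extract B (n , B≤n , 𝔇 , n≤ , rest) = 𝔇 , ℕ.≤-trans B≤n n≤ , rest
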